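{- Let $\mathbb{K}$ be a field of characteristic zero, $n\ge 4$, and $m=\binom n2$. Consider the system of parameters of $\mathcal{I}_n$ composed of the $m$ elementary symmetric polynomials in the variables $x_{\{i,j\}}$, and let $e_1\le\dots\le e_t$ be the degrees of the corresponding secondary invariants. Then $$t=\frac{m!}{n!}=\frac{\binom n2!}{n!},\qquad e_t=\binom m2-\mu_n=\binom{\binom n2}{2}-\mu_n,\qquad \beta(\mathcal{I}_n)\le\binom{\binom n2}{2}-\mu_n,$$ where $\mu_n=0$ if $n$ is even, and $\mu_n=\lceil\frac34(n-1)\rceil$ if $n$ is odd.
   Context: Let $\mathbb{K}[x_{\{i,j\}}]$ be the polynomial ring in the $m=\binom n2$ variables indexed by the pairs $\{i,j\}$, $1\le i<j\le n$. The symmetric group $\mathfrak{S}_n$ acts on it by $\sigma\cdot x_{\{i,j\}}=x_{\{\sigma(i),\sigma(j)\}}$, and $\mathcal{I}_n:=\mathbb{K}[x_{\{i,j\}}]^{\mathfrak{S}_n}$. A system of parameters of $\mathcal{I}_n$ is a set of $m$ homogeneous invariants $\theta_1,\dots,\theta_m$ such that $\mathcal{I}_n$ is a finitely generated module over $\mathbb{K}[\theta_1,\dots,\theta_m]$; then $\mathcal{I}_n$ is a free module over $\mathbb{K}[\theta_1,\dots,\theta_m]$, so there are homogeneous invariants $\eta_1,\dots,\eta_t$ (secondary invariants) with $\mathcal{I}_n=\bigoplus_{i=1}^t\eta_i\,\mathbb{K}[\theta_1,\dots,\theta_m]$; their number $t$ and their degrees (as a multiset) depend only on the degrees of the $\theta_i$.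 $\beta(\mathcal{I}_n)$ denotes the smallest integer $d$ such that $\mathcal{I}_n$ is generated as a $\mathbb{K}$-algebra by its invariants of degree at most $d$. -}

module Defs where

open import Level using (Level; _⊔_)
open import Algebra.Bundles using (CommutativeRing)
open import Algebra.Apartness.Bundles using (HeytingField; HeytingCommutativeRing)
import Algebra.Properties.Monoid.Mult as Mult
open import Data.Bool.Base using (if_then_else_)
open import Data.Fin.Base as Fin using (Fin; toℕ)
import Data.Fin.Properties as Finₚ
open import Data.Fin.Permutation using (Permutation′; _⟨$⟩ʳ_)
open import Data.List.Base
  using (List; []; _∷_; [_]; _++_; map; foldr; length; concatMap; mapMaybe;
         allFin; cartesianProductWith)
open import Data.List.Membership.Propositional.Properties using (∈-∃++)
import Data.List.Membership.DecPropositional as DecMembership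
open import Data.List.Relation.Binary.Permutation.Propositional
  using (_↭_; ↭-refl; ↭-trans; ↭-sym; prep)
open import Data.List.Relation.Binary.Permutation.Propositional.Properties
  using (shift; drop-∷; ∈-resp-↭; ¬x∷xs↭[])
open import Data.List.Relation.Unary.Any using (here)
open import Data.Maybe.Base as Maybe using ()
open import Data.Nat.Base using (ℕ; zero; suc; _+_; _*_; _∸_; _≤_; _<_; _/_)
open import Data.Nat.Combinatorics using (_C_)
open import Data.Nat.Divisibility using (_∣?_)
import Data.Nat.Properties as ℕₚ
open import Data.Product.Base using (Σ; ∃; _×_; _,_; map₂)
import Data.Vec.Functional as Vector
open import Function.Bundles using (Injection)
open import Function.Properties.Inverse using (↔⇒↣)
open import Relation.Binary.Definitions
  using (Decidable; DecidableEquality; tri<; tri≈; tri>)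
open import Relation.Binary.PropositionalEquality
  using (_≡_; _≢_; refl; cong)
open import Relation.Nullary using (yes; no; does; contradiction)
open import Relation.Nullary.Decidable using (dec⇒maybe)

private
  variable
    a b : Level
    X Y : Set a

ringOf : ∀ {c ℓ₁ ℓ₂} → HeytingField c ℓ₁ ℓ₂ → CommutativeRing c ℓ₁
ringOf F =
  HeytingCommutativeRing.commutativeRing (HeytingField.heytingCommutativeRing F)

-- Apartness from 0 is the constructive form of "nonzero": it is equivalent
-- to being invertible.
CharacteristicZero : ∀ {c ℓ₁ ℓ₂} → HeytingField c ℓ₁ ℓ₂ → Set ℓ₂
CharacteristicZero F = ∀ k → (suc k ×ᴷ 1#) # 0#
  where
  open HeytingField F using (_#_; 0#; 1#)
  open Mult (CommutativeRing.+-monoid (ringOf F)) renaming (_×_ to _×ᴷ_)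

-- Monomials: the free commutative monoid on X, i.e. lists up to
-- permutation.  Multiplication is concatenation, the degree is the length.
Monomial : Set a → Set a
Monomial X = List X

module _ {X : Set a} (_≟_ : DecidableEquality X) where

  open DecMembership _≟_ using (_∈?_)

  infix 4 _↭?_
  _↭?_ : Decidable (_↭_ {A = X})
  []       ↭? []       = yes ↭-refl
  []       ↭? (y ∷ ys) = no λ p → ¬x∷xs↭[] (↭-sym p)
  (x ∷ xs) ↭? ys with x ∈? ys
  ... | no  x∉ys = no λ p → x∉ys (∈-resp-↭ p (here refl))
  ... | yes x∈ys with ∈-∃++ x∈ys
  ...   | us , vs , refl with xs ↭? (us ++ vs)
  ...     | yes p = yes (↭-trans (prep x p) (↭-sym (shift x us vs)))
  ...     | no ¬p = no λ q → ¬p (drop-∷ (↭-trans q (shift x us vs)))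

module Polynomials {c ℓ} (R : CommutativeRing c ℓ) where

  private module R = CommutativeRing R

  -- A formal sum of terms, in which monomials may be repeated and
  -- coefficients may vanish; see _≈ₚ_ below for equality.
  Poly : Set a → Set (a ⊔ c)
  Poly X = List (R.Carrier × Monomial X)

  0ₚ : Poly X
  0ₚ = []

  const : R.Carrier → Poly X
  const r = [ (r , []) ]

  1ₚ : Poly X
  1ₚ = const R.1#

  infixl 6 _+ₚ_
  infixl 7 _*ₚ_

  _+ₚ_ : Poly X → Poly X → Poly X
  _+ₚ_ = _++_

  _*ₚ_ : Poly X → Poly X → Poly X
  _*ₚ_ = cartesianProductWith λ (r , α) (s , β) → (r R.* s , α ++ β)

  sumₚ : ∀ {t} → (Fin t → Poly X) → Poly X
  sumₚ = Vector.foldr _+ₚ_ 0ₚ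

  rename : (X → Y) → Poly X → Poly Y
  rename f = map (map₂ (map f))

  -- P (θ): the value of P when each variable y is replaced by θ y.  The
  -- subalgebra R[θ] is the set of all  eval θ P.
  eval : {Y : Set b} → (Y → Poly X) → Poly Y → Poly X
  eval θ []            = 0ₚ
  eval θ ((r , β) ∷ P) = const r *ₚ foldr (λ y → θ y *ₚ_) 1ₚ β +ₚ eval θ P

  module Coefficients {X : Set a} (_≟_ : DecidableEquality X) where

    coeff : Monomial X → Poly X → R.Carrier
    coeff α []            = R.0#
    coeff α ((r , β) ∷ p) =
      (if does (_↭?_ _≟_ β α) then r else R.0#) R.+ coeff α p

    infix 4 _≈ₚ_
    _≈ₚ_ : Poly X → Poly X → Set (a ⊔ ℓ)
    p ≈ₚ q = ∀ α → coeff α p R.≈ coeff α q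

    Homogeneous : ℕ → Poly X → Set (a ⊔ ℓ)
    Homogeneous d p = ∀ α → length α ≢ d → coeff α p R.≈ R.0#

    DegreeAtMost : ℕ → Poly X → Set (a ⊔ ℓ)
    DegreeAtMost d p = ∀ α → d < length α → coeff α p R.≈ R.0#

  -- The sum, over all k-element sublists of xs, of the product of their
  -- members.
  elementarySymmetric : ℕ → List X → Poly X
  elementarySymmetric k xs = map (R.1# ,_) (choose k xs)
    where
    choose : ℕ → List X → List (Monomial X)
    choose zero    xs       = [ [] ]
    choose (suc k) []       = []
    choose (suc k) (x ∷ xs) = map (x ∷_) (choose k xs) ++ choose (suc k) xs

-- The unordered pair {i,j} with i ≠ j, represented with its smaller element
-- first.
record Pair (n : ℕ) : Set where
  constructor mkPair
  field
    lo hi : Fin n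
    lo<hi : lo Fin.< hi

open Pair

private
  mkPair-cong : ∀ {n} {i i′ j j′ : Fin n} {p : i Fin.< j} {p′ : i′ Fin.< j′} →
                i ≡ i′ → j ≡ j′ → mkPair i j p ≡ mkPair i′ j′ p′
  mkPair-cong refl refl = cong (mkPair _ _) (ℕₚ.<-irrelevant _ _)

infix 4 _≟ᴾ_
_≟ᴾ_ : ∀ {n} → DecidableEquality (Pair n)
e ≟ᴾ f with lo e Finₚ.≟ lo f | hi e Finₚ.≟ hi f
... | yes p | yes q = yes (mkPair-cong p q)
... | no ¬p | _     = no λ e≡f → ¬p (cong lo e≡f)
... | _     | no ¬q = no λ e≡f → ¬q (cong hi e≡f)

unordered : ∀ {n} (i j : Fin n) → i ≢ j → Pair n
unordered i j i≢j with Finₚ.<-cmp i j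
... | tri< i<j _ _ = mkPair i j i<j
... | tri≈ _ i≡j _ = contradiction i≡j i≢j
... | tri> _ _ j<i = mkPair j i j<i

allPairs : ∀ n → List (Pair n)
allPairs n =
  concatMap (λ i → mapMaybe (λ j → Maybe.map (mkPair i j) (dec⇒maybe (i Finₚ.<? j)))
                            (allFin n))
            (allFin n)

infixr 8 _·_
_·_ : ∀ {n} → Permutation′ n → Pair n → Pair n
σ · e = unordered (σ ⟨$⟩ʳ lo e) (σ ⟨$⟩ʳ hi e)
          λ eq → Finₚ.<⇒≢ (lo<hi e) (Injection.injective (↔⇒↣ σ) eq)

module Invariants {c ℓ} (R : CommutativeRing c ℓ) (n : ℕ) where

  open Polynomials R public
  open Coefficients (_≟ᴾ_ {n}) public

  IsInvariant : Poly (Pair n) → Set ℓ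
  IsInvariant f = ∀ σ → rename (σ ·_) f ≈ₚ f

  -- I_n = ⊕ᵢ ηᵢ R[θ] as a free R[θ]-module with basis η, where ηᵢ is
  -- homogeneous of degree eᵢ.  (The directness clause asks for the
  -- coefficients Pᵢ(θ), and not only the products ηᵢ Pᵢ(θ), to vanish, so
  -- that no ηᵢ is 0.)  Spanning makes I_n finitely generated over R[θ].
  record IsSecondary {m t : ℕ} (θ : Fin m → Poly (Pair n))
                     (η : Fin t → Poly (Pair n)) (e : Fin t → ℕ) :
                     Set (c ⊔ ℓ) where
    field
      invariant   : ∀ i → IsInvariant (η i)
      homogeneous : ∀ i → Homogeneous (e i) (η i)
      spanning    : ∀ f → IsInvariant f →
                    ∃ λ (P : Fin t → Poly (Fin m)) →
                      f ≈ₚ sumₚ λ i → η i *ₚ eval θ (P i)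
      independent : ∀ (P : Fin t → Poly (Fin m)) →
                    (sumₚ λ i → η i *ₚ eval θ (P i)) ≈ₚ 0ₚ →
                    ∀ i → eval θ (P i) ≈ₚ 0ₚ

  elementary : Fin (n C 2) → Poly (Pair n)
  elementary k = elementarySymmetric (suc (toℕ k)) (allPairs n)

  GeneratedInDegree≤ : ℕ → Set (c ⊔ ℓ)
  GeneratedInDegree≤ d =
    ∀ f → IsInvariant f →
    ∃ λ k → Σ (Fin k → Poly (Pair n)) λ g →
      (∀ i → IsInvariant (g i) × DegreeAtMost d (g i)) ×
      ∃ λ (P : Poly (Fin k)) → f ≈ₚ eval g P

  Isβ : ℕ → Set (c ⊔ ℓ)
  Isβ d = GeneratedInDegree≤ d × (∀ d′ → GeneratedInDegree≤ d′ → d ≤ d′)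

-- For odd n this is ⌈ 3 (n - 1) / 4 ⌉, with ⌈ a / 4 ⌉ written ⌊ (a + 3) / 4 ⌋.
μ : ℕ → ℕ
μ n = if does (2 ∣? n) then 0 else (3 * (n ∸ 1) + 3) / 4

{-# OPTIONS --safe #-}
-- Let S be the polynomial ring in the m = n C 2 variables, Δ the Vandermonde
-- product and K[θ] the ring of symmetric polynomials.  Antisymmetrizing over
-- the permutations of the variables and dividing by Δ gives a K[θ]-linear map
-- trace : S → K[θ], which lowers degrees by m C 2 and changes sign under each
-- transposition of variables.  Write the product of all x_j ⊗ 1 - 1 ⊗ x_i as
-- Σ b ⊗ c with monomials b and, up to sign, c.  A permutation τ ≠ 1 applied to
-- the left factor turns this product into 0 under multiplication, and hence
-- f = Σ trace (b f) c for every f.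
--
-- Averaging over 𝔖_n, every invariant f is a combination of the averages of
-- the c with coefficients trace (b f).  If n is odd and deg b < μ n, then b is
-- a multigraph fixed by a transposition of vertices, which is an odd
-- permutation of the pairs, so that trace (b f) = 0.  Only averages of degree
-- at most m C 2 - μ n remain, which bounds β and the degrees of the secondary
-- invariants.
--
-- The matrix trace of the Reynolds operator over K[θ] is the number t of
-- secondary invariants; computed from the expansion above, it is
-- trace Δ / n! = m! / n!.
--
-- Finally, let γ be a monomial of degree μ n whose stabilizer in 𝔖_n acts on
-- the pairs by even permutations.  If all secondary invariants had degree less
-- than m C 2 - μ n, then trace (γ f) would be 0 for every invariant f, so the
-- signed sum of the translates of γ would be orthogonal to S and thus 0; but
-- its coefficient at γ is the order of the stabilizer.

module Submission where

open import Defs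
open import Algebra.Apartness.Bundles using (HeytingField)
open import Algebra.Bundles using (CommutativeRing)
import Algebra.Properties.CommutativeSemigroup as CSProps
import Algebra.Properties.Monoid.Mult as Mult
import Algebra.Properties.Ring as RingProps
import Algebra.Properties.Semiring.Mult as SemiringMult
open import Data.Bool.Base using (true; false; if_then_else_)
open import Data.Empty using (⊥; ⊥-elim)
open import Data.Fin.Base as Fin using (Fin; zero; suc; toℕ)
open import Data.Fin.Patterns
open import Data.Fin.Permutation using (Permutation′)
import Data.Fin.Permutation.Components as PC
import Data.Fin.Permutation.Transposition.List as TL
import Data.Fin.Properties as Finₚ
open import Data.List.Base using (List; []; _∷_; _++_; map; foldr; length; replicate; reverse; _ʳ++_; allFin; tabulate; mapMaybe; concatMap; lookup)
import Data.List.Membership.DecPropositional as DecMembership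
open import Data.List.Membership.Propositional using (_∈_; _∉_)
open import Data.List.Membership.Propositional.Properties using (∈-∃++; ∈-map⁺; ∈-map⁻; ∈-++⁺ˡ; ∈-++⁺ʳ; ∈-++⁻; ∈-allFin; ∈-lookup)
open import Data.List.Properties using (length-++; map-++; length-map; map-id; map-cong; map-∘; ++-assoc; ++-identityʳ; map-replicate; reverse-involutive; ʳ++-defn; length-tabulate; map-tabulate; concatMap-cong; concatMap-map; map-concatMap)
open import Data.List.Relation.Binary.Permutation.Propositional as ↭ using (_↭_; ↭-refl; ↭-trans; ↭-sym; ↭-reflexive; prep; swap)
import Data.List.Relation.Binary.Permutation.Propositional.Properties as ↭ₚ
import Data.List.Relation.Binary.Permutation.Setoid.Properties as ↭ₛ
open import Data.List.Relation.Unary.All as All using (All; []; _∷_)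
import Data.List.Relation.Unary.All.Properties as Allₚ
open import Data.List.Relation.Unary.AllPairs using ([]; _∷_)
open import Data.List.Relation.Unary.Any using (here; there; index)
open import Data.List.Relation.Unary.Any.Properties using (lookup-index)
open import Data.List.Relation.Unary.Unique.Propositional using (Unique)
import Data.List.Relation.Unary.Unique.Propositional.Properties as Uniqueₚ
open import Data.Maybe.Base as Maybe using (Maybe; just; nothing)
open import Data.Nat.Base as ℕ using (ℕ; zero; suc; z≤n; s≤s; _!; _∸_; _≤_; _<_; _/_)
open import Data.Nat.Combinatorics using (_C_; nC1≡n; nCk+nC[k+1]≡[n+1]C[k+1])
open import Data.Nat.DivMod using (m/n*n≤m; m<n*o⇒m/o<n; m*n/n≡m; /-monoˡ-≤)
open import Data.Nat.Divisibility using (_∣_; _∣?_; ∣m+n∣m⇒∣n; ∣⇒≤; m∣m*n)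
open import Data.Nat.Properties as ℕₚ using (_!≢0)
import Data.Nat.Solver as ℕSolver
open import Data.Product.Base using (∃; _×_; _,_; proj₁; proj₂; ∃₂; Σ)
open import Data.Sum.Base as Sum using (_⊎_; inj₁; inj₂)
import Data.Vec.Functional as Vector
open import Function.Base using (_∘_; id; case_of_; _∋_)
open import Function.Bundles using (_↔_; Inverse; mk↔ₛ′)
open import Function.Construct.Composition using (_↔-∘_)
open import Function.Construct.Identity using (↔-id)
open import Function.Construct.Symmetry using (↔-sym)
open import Level using (_⊔_) renaming (suc to lsuc)
open import Relation.Binary.Definitions using (DecidableEquality; tri<; tri≈; tri>)
open import Relation.Binary.PropositionalEquality as ≡ using (_≡_; _≢_; refl; cong; cong₂; subst; sym; trans)
open import Relation.Nullary using (¬_; Dec; yes; no; does; contradiction)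
open import Relation.Nullary.Decidable using (dec-true; dec-false; dec⇒maybe; _→-dec_; _×-dec_; ¬?; from-yes)

open Inverse using (to; from)

-- Equality in the field is undecidable, so Δ is not divided out by factoring polynomials. Artin's
-- reduction rewrites a polynomial, variable by variable, with bounded exponents over the symmetric
-- functions. Of the monomials obtained, only the staircase survives antisymmetrization. Its
-- alternant divides Δ and hence can be cancelled; a degree count then identifies the two. For odd n
-- ≥ 5, μ n = ⌊3n/4⌋ is the least number of edges of a multigraph on n vertices with no
-- transposition among its automorphisms: at most one vertex is isolated, no two leaves are
-- adjacent, and no two leaves share a neighbour. The parity of n enters because a transposition of
-- vertices acts on the pairs as n - 2 transpositions. In the extremal graphs leaves are matched
-- with vertices of higher degree. Every automorphism is then a product in which each factor occurs
-- twice, hence even, whatever the signs of the factors. In the count of secondary invariants, a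
-- vertex permutation σ contributes the trace of a product of differences of variables. It contains
-- the factor 0 unless σ = 1, because the action on pairs is faithful.

-- The ring of formal sums of monomials, studied through linear functionals

module PolynomialRing {c ℓ} (R : CommutativeRing c ℓ) {X : Set} (_≟_ : DecidableEquality X) where

  open CommutativeRing R hiding (refl; zero) renaming (sym to ≈-sym; trans to ≈-trans)
  open CommutativeRing R using () renaming (refl to ≈-refl)
  open RingProps ring
  open CSProps +-commutativeSemigroup using (interchange)
  open CSProps *-commutativeSemigroup using (x∙yz≈y∙xz)
  open import Relation.Binary.Reasoning.Setoid setoid
  open Polynomials R
  open Coefficients _≟_

  Respects↭ : (Monomial X → Carrier) → Set ℓ
  Respects↭ φ = ∀ {β γ} → β ↭ γ → φ β ≈ φ γ

  -- Formal sums are compared by testing them against linear functionals. Those satisfying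
  -- `Respects↭` are well defined modulo `≈ₚ`, and products and renamings unfold under `lin`.
  lin : (Monomial X → Carrier) → Poly X → Carrier
  lin φ []            = 0#
  lin φ ((r , β) ∷ p) = r * φ β + lin φ p

  lin-cong : ∀ {φ ψ} → (∀ β → φ β ≈ ψ β) → ∀ p → lin φ p ≈ lin ψ p
  lin-cong φ≈ψ []            = ≈-refl
  lin-cong φ≈ψ ((r , β) ∷ p) = +-cong (*-congˡ (φ≈ψ β)) (lin-cong φ≈ψ p)

  lin-0 : ∀ {φ} → (∀ β → φ β ≈ 0#) → ∀ p → lin φ p ≈ 0#
  lin-0 φ≈0 []            = ≈-refl
  lin-0 φ≈0 ((r , β) ∷ p) =
    ≈-trans (+-cong (≈-trans (*-congˡ (φ≈0 β)) (zeroʳ r)) (lin-0 φ≈0 p)) (+-identityˡ 0#)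

  lin-++ : ∀ φ p q → lin φ (p ++ q) ≈ lin φ p + lin φ q
  lin-++ φ []            q = ≈-sym (+-identityˡ _)
  lin-++ φ ((r , β) ∷ p) q = ≈-trans (+-congˡ (lin-++ φ p q)) (≈-sym (+-assoc _ _ _))

  lin-+ : ∀ φ ψ p → lin (λ β → φ β + ψ β) p ≈ lin φ p + lin ψ p
  lin-+ φ ψ []            = ≈-sym (+-identityˡ _)
  lin-+ φ ψ ((r , β) ∷ p) =
    ≈-trans (+-cong (distribˡ r _ _) (lin-+ φ ψ p)) (interchange _ _ _ _)

  lin-*ˡ : ∀ s φ p → lin (λ β → s * φ β) p ≈ s * lin φ p
  lin-*ˡ s φ []            = ≈-sym (zeroʳ s)
  lin-*ˡ s φ ((r , β) ∷ p) =
    ≈-trans (+-cong (x∙yz≈y∙xz r s _) (lin-*ˡ s φ p)) (≈-sym (distribˡ s _ _))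

  lin-swap : ∀ (φ : Monomial X → Monomial X → Carrier) p q →
             lin (λ β → lin (φ β) q) p ≈ lin (λ γ → lin (λ β → φ β γ) p) q
  lin-swap φ []            q = ≈-sym (lin-0 (λ _ → ≈-refl) q)
  lin-swap φ ((r , β) ∷ p) q = begin
    r * lin (φ β) q + lin (λ β → lin (φ β) q) p                   ≈⟨ +-cong (≈-sym (lin-*ˡ r (φ β) q)) (lin-swap φ p q) ⟩
    lin (λ γ → r * φ β γ) q + lin (λ γ → lin (λ β → φ β γ) p) q   ≈⟨ lin-+ _ _ q ⟨
    lin (λ γ → r * φ β γ + lin (λ β → φ β γ) p) q                 ∎

  -ₚ_ : Poly X → Poly X
  -ₚ_ = map (λ (r , β) → - r , β)

  lin-neg : ∀ φ p → lin φ (-ₚ p) ≈ - lin φ p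
  lin-neg φ []            = ≈-sym -0#≈0#
  lin-neg φ ((r , β) ∷ p) =
    ≈-trans (+-cong (≈-sym (-‿distribˡ-* r _)) (lin-neg φ p)) (-‿+-comm _ _)

  𝟙[_≈_] : Monomial X → Monomial X → Carrier
  𝟙[ β ≈ α ] = if does (_↭?_ _≟_ β α) then 1# else 0#

  𝟙-yes : ∀ β α → β ↭ α → 𝟙[ β ≈ α ] ≡ 1#
  𝟙-yes β α p rewrite dec-true (_↭?_ _≟_ β α) p = refl

  𝟙-no : ∀ β α → ¬ (β ↭ α) → 𝟙[ β ≈ α ] ≡ 0#
  𝟙-no β α ¬p rewrite dec-false (_↭?_ _≟_ β α) ¬p = refl

  𝟙-resp : ∀ α → Respects↭ (λ β → 𝟙[ β ≈ α ])
  𝟙-resp α {β} {γ} β↭γ with _↭?_ _≟_ γ α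
  ... | yes γ↭α = reflexive (𝟙-yes β α (↭-trans β↭γ γ↭α))
  ... | no ¬γ↭α = reflexive (𝟙-no β α λ β↭α → ¬γ↭α (↭-trans (↭-sym β↭γ) β↭α))

  coeff≈lin : ∀ α p → coeff α p ≈ lin (λ β → 𝟙[ β ≈ α ]) p
  coeff≈lin α []            = ≈-refl
  coeff≈lin α ((r , β) ∷ p) with does (_↭?_ _≟_ β α)
  ... | true  = +-cong (≈-sym (*-identityʳ r)) (coeff≈lin α p)
  ... | false = +-cong (≈-sym (zeroʳ r)) (coeff≈lin α p)

  coeff-resp : ∀ p → Respects↭ (λ α → coeff α p)
  coeff-resp []            _ = ≈-refl
  coeff-resp ((r , β) ∷ p) {α} {α′} α↭α′ = +-cong (reflexive (cong (if_then r else 0#) eq)) (coeff-resp p α↭α′)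
    where
    eq : does (_↭?_ _≟_ β α) ≡ does (_↭?_ _≟_ β α′)
    eq with _↭?_ _≟_ β α′
    ... | yes q = dec-true (_↭?_ _≟_ β α) (↭-trans q (↭-sym α↭α′))
    ... | no ¬q = dec-false (_↭?_ _≟_ β α) λ q → ¬q (↭-trans q α↭α′)

  private
    -- Removes the whole permutation class of `β` and not just one term: a sum that is `≈ₚ 0ₚ` keeps
    -- this property while it becomes shorter.
    delete : Monomial X → Poly X → Poly X
    delete β []            = []
    delete β ((s , γ) ∷ p) = if does (_↭?_ _≟_ γ β) then delete β p else (s , γ) ∷ delete β p

    delete-length : ∀ β p → length (delete β p) ℕ.≤ length p
    delete-length β []            = z≤n
    delete-length β ((s , γ) ∷ p) with does (_↭?_ _≟_ γ β)
    ... | true  = ℕₚ.m≤n⇒m≤1+n (delete-length β p)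
    ... | false = s≤s (delete-length β p)

    lin-delete : ∀ {φ} → Respects↭ φ → ∀ β p → lin φ p ≈ coeff β p * φ β + lin φ (delete β p)
    lin-delete φ-resp β [] = ≈-sym (≈-trans (+-identityʳ _) (zeroˡ _))
    lin-delete {φ} φ-resp β ((s , γ) ∷ p) with _↭?_ _≟_ γ β
    ... | yes γ↭β = begin
      s * φ γ + lin φ p                                       ≈⟨ +-cong (*-congˡ (φ-resp γ↭β)) (lin-delete φ-resp β p) ⟩
      s * φ β + (coeff β p * φ β + lin φ (delete β p))        ≈⟨ +-assoc _ _ _ ⟨
      s * φ β + coeff β p * φ β + lin φ (delete β p)          ≈⟨ +-congʳ (distribʳ (φ β) s (coeff β p)) ⟨
      (s + coeff β p) * φ β + lin φ (delete β p)              ∎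
    ... | no _ = begin
      s * φ γ + lin φ p                                       ≈⟨ +-congˡ (lin-delete φ-resp β p) ⟩
      s * φ γ + (coeff β p * φ β + lin φ (delete β p))        ≈⟨ +-assoc _ _ _ ⟨
      s * φ γ + coeff β p * φ β + lin φ (delete β p)          ≈⟨ +-congʳ (+-comm _ _) ⟩
      coeff β p * φ β + s * φ γ + lin φ (delete β p)          ≈⟨ +-assoc _ _ _ ⟩
      coeff β p * φ β + (s * φ γ + lin φ (delete β p))        ≈⟨ +-congʳ (*-congʳ (+-identityˡ _)) ⟨
      (0# + coeff β p) * φ β + (s * φ γ + lin φ (delete β p)) ∎

    coeff-delete-≈ : ∀ β p → p ≈ₚ 0ₚ → delete β p ≈ₚ 0ₚ
    coeff-delete-≈ β p p≈0 α with _↭?_ _≟_ α β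
    ... | yes α↭β = zero-at p
      where
      zero-at : ∀ p → coeff α (delete β p) ≈ 0#
      zero-at []            = ≈-refl
      zero-at ((s , γ) ∷ p) with _↭?_ _≟_ γ β
      ... | yes _ = zero-at p
      ... | no ¬γ↭β rewrite dec-false (_↭?_ _≟_ γ α) (λ γ↭α → ¬γ↭β (↭-trans γ↭α α↭β)) =
        ≈-trans (+-identityˡ _) (zero-at p)
    ... | no ¬α↭β = ≈-trans (same-at p) (p≈0 α)
      where
      same-at : ∀ p → coeff α (delete β p) ≈ coeff α p
      same-at []            = ≈-refl
      same-at ((s , γ) ∷ p) with _↭?_ _≟_ γ β
      ... | yes γ↭β rewrite dec-false (_↭?_ _≟_ γ α) (λ γ↭α → ¬α↭β (↭-trans (↭-sym γ↭α) γ↭β)) =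
        ≈-trans (same-at p) (≈-sym (+-identityˡ _))
      ... | no _ = +-congˡ (same-at p)

    -- The class of the first monomial contributes its total coefficient, which is 0, and is
    -- deleted. The bound `k` drives the recursion, since the result of `delete` is not a subterm.
    lin-≈0 : ∀ {φ} → Respects↭ φ → ∀ k p → length p ℕ.≤ k → p ≈ₚ 0ₚ → lin φ p ≈ 0#
    lin-≈0 φ-resp k []            _         p≈0 = ≈-refl
    lin-≈0 {φ} φ-resp (suc k) ((r , β) ∷ p) (s≤s ∣p∣≤k) p≈0 = begin
      lin φ ((r , β) ∷ p)                                               ≈⟨ lin-delete φ-resp β ((r , β) ∷ p) ⟩
      coeff β ((r , β) ∷ p) * φ β + lin φ (delete β ((r , β) ∷ p))      ≈⟨ +-cong (≈-trans (*-congʳ (p≈0 β)) (zeroˡ _)) tail≈0 ⟩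
      0# + 0#                                                           ≈⟨ +-identityˡ _ ⟩
      0#                                                                ∎
      where
      drop-head : delete β ((r , β) ∷ p) ≡ delete β p
      drop-head rewrite dec-true (_↭?_ _≟_ β β) ↭-refl = refl

      tail≈0 : lin φ (delete β ((r , β) ∷ p)) ≈ 0#
      tail≈0 =
        lin-≈0 φ-resp k (delete β ((r , β) ∷ p))
          (subst (λ q → length q ℕ.≤ k) (≡.sym drop-head) (ℕₚ.≤-trans (delete-length β p) ∣p∣≤k))
          (coeff-delete-≈ β ((r , β) ∷ p) p≈0)

  coeff-++ : ∀ α p q → coeff α (p ++ q) ≈ coeff α p + coeff α q
  coeff-++ α p q = begin
    coeff α (p ++ q)                                               ≈⟨ coeff≈lin α (p ++ q) ⟩
    lin _ (p ++ q)                                                 ≈⟨ lin-++ _ p q ⟩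
    lin _ p + lin _ q                                              ≈⟨ +-cong (coeff≈lin α p) (coeff≈lin α q) ⟨
    coeff α p + coeff α q                                          ∎

  coeff-neg : ∀ α p → coeff α (-ₚ p) ≈ - coeff α p
  coeff-neg α p = begin
    coeff α (-ₚ p)   ≈⟨ coeff≈lin α (-ₚ p) ⟩
    lin _ (-ₚ p)     ≈⟨ lin-neg _ p ⟩
    - lin _ p        ≈⟨ -‿cong (coeff≈lin α p) ⟨
    - coeff α p      ∎

  -- The universal property of the free module on monomials up to permutation.
  lin-resp : ∀ {φ} → Respects↭ φ → ∀ {p q} → p ≈ₚ q → lin φ p ≈ lin φ q
  lin-resp {φ} φ-resp {p} {q} p≈q = x-y≈0⇒x≈y (begin
    lin φ p - lin φ q        ≈⟨ +-congˡ (lin-neg φ q) ⟨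
    lin φ p + lin φ (-ₚ q)   ≈⟨ lin-++ φ p (-ₚ q) ⟨
    lin φ (p ++ -ₚ q)        ≈⟨ lin-≈0 φ-resp _ (p ++ -ₚ q) ℕₚ.≤-refl p-q≈0 ⟩
    0#                       ∎)
    where
    x-y≈0⇒x≈y : ∀ {x y} → x - y ≈ 0# → x ≈ y
    x-y≈0⇒x≈y {x} {y} eq = x∙y⁻¹≈ε⇒x≈y x y eq

    p-q≈0 : (p ++ -ₚ q) ≈ₚ 0ₚ
    p-q≈0 α = begin
      coeff α (p ++ -ₚ q)             ≈⟨ coeff-++ α p (-ₚ q) ⟩
      coeff α p + coeff α (-ₚ q)      ≈⟨ +-cong (p≈q α) (coeff-neg α q) ⟩
      coeff α q - coeff α q           ≈⟨ -‿inverseʳ _ ⟩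
      0#                              ∎

  -- Coefficients are themselves functionals, given by the indicators `𝟙[_≈_]`. Each ring law
  -- thereby reduces to a law of lists up to permutation.
  ≈ₚ-ext : ∀ p q → (∀ {φ} → Respects↭ φ → lin φ p ≈ lin φ q) → p ≈ₚ q
  ≈ₚ-ext p q eq α =
    ≈-trans (coeff≈lin α p) (≈-trans (eq (𝟙-resp α)) (≈-sym (coeff≈lin α q)))

  lin-map : ∀ (φ : Monomial X → Carrier) r β q →
            lin φ (map (λ (s , γ) → r * s , β ++ γ) q) ≈ r * lin (λ γ → φ (β ++ γ)) q
  lin-map φ r β []            = ≈-sym (zeroʳ r)
  lin-map φ r β ((s , γ) ∷ q) =
    ≈-trans (+-cong (*-assoc r s _) (lin-map φ r β q)) (≈-sym (distribˡ r _ _))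

  lin-* : ∀ φ p q → lin φ (p *ₚ q) ≈ lin (λ β → lin (λ γ → φ (β ++ γ)) q) p
  lin-* φ []            q = ≈-refl
  lin-* φ ((r , β) ∷ p) q =
    ≈-trans (lin-++ φ (map _ q) (p *ₚ q)) (+-cong (lin-map φ r β q) (lin-* φ p q))

  lin-rename : ∀ φ (f : X → X) p → lin φ (rename f p) ≈ lin (φ ∘ map f) p
  lin-rename φ f []            = ≈-refl
  lin-rename φ f ((r , β) ∷ p) = +-congˡ (lin-rename φ f p)

  private
    shiftˡ : ∀ {φ} → Respects↭ φ → ∀ β → Respects↭ (λ γ → φ (β ++ γ))
    shiftˡ φ-resp β γ↭γ′ = φ-resp (↭ₚ.++⁺ˡ β γ↭γ′)

    shift : ∀ {φ} → Respects↭ φ → ∀ q → Respects↭ (λ β → lin (λ γ → φ (β ++ γ)) q)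
    shift φ-resp q β↭β′ = lin-cong (λ γ → φ-resp (↭ₚ.++⁺ʳ γ β↭β′)) q

  *ₚ-cong : ∀ {p p′ q q′} → p ≈ₚ p′ → q ≈ₚ q′ → (p *ₚ q) ≈ₚ (p′ *ₚ q′)
  *ₚ-cong {p} {p′} {q} {q′} p≈p′ q≈q′ = ≈ₚ-ext (p *ₚ q) (p′ *ₚ q′) λ {φ} φ-resp → begin
    lin φ (p *ₚ q)                               ≈⟨ lin-* φ p q ⟩
    lin (λ β → lin (λ γ → φ (β ++ γ)) q) p       ≈⟨ lin-resp (shift φ-resp q) {p} {p′} p≈p′ ⟩
    lin (λ β → lin (λ γ → φ (β ++ γ)) q) p′      ≈⟨ lin-cong (λ β → lin-resp (shiftˡ φ-resp β) {q} {q′} q≈q′) p′ ⟩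
    lin (λ β → lin (λ γ → φ (β ++ γ)) q′) p′     ≈⟨ lin-* φ p′ q′ ⟨
    lin φ (p′ *ₚ q′)                             ∎

  *ₚ-comm : ∀ p q → (p *ₚ q) ≈ₚ (q *ₚ p)
  *ₚ-comm p q = ≈ₚ-ext (p *ₚ q) (q *ₚ p) λ {φ} φ-resp → begin
    lin φ (p *ₚ q)                               ≈⟨ lin-* φ p q ⟩
    lin (λ β → lin (λ γ → φ (β ++ γ)) q) p       ≈⟨ lin-swap (λ β γ → φ (β ++ γ)) p q ⟩
    lin (λ γ → lin (λ β → φ (β ++ γ)) p) q       ≈⟨ lin-cong (λ γ → lin-cong (λ β → φ-resp (↭ₚ.++-comm β γ)) p) q ⟩
    lin (λ γ → lin (λ β → φ (γ ++ β)) p) q       ≈⟨ lin-* φ q p ⟨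
    lin φ (q *ₚ p)                               ∎

  *ₚ-assoc : ∀ p q s → ((p *ₚ q) *ₚ s) ≈ₚ (p *ₚ (q *ₚ s))
  *ₚ-assoc p q s = ≈ₚ-ext ((p *ₚ q) *ₚ s) (p *ₚ (q *ₚ s)) λ {φ} φ-resp → begin
    lin φ ((p *ₚ q) *ₚ s)                                              ≈⟨ lin-* φ (p *ₚ q) s ⟩
    lin (λ β → lin (λ γ → φ (β ++ γ)) s) (p *ₚ q)                      ≈⟨ lin-* _ p q ⟩
    lin (λ α → lin (λ β → lin (λ γ → φ ((α ++ β) ++ γ)) s) q) p        ≈⟨ lin-cong (λ α → lin-cong (λ β → lin-cong (λ γ → φ-resp (↭ₚ.++-assoc α β γ)) s) q) p ⟩
    lin (λ α → lin (λ β → lin (λ γ → φ (α ++ (β ++ γ))) s) q) p        ≈⟨ lin-cong (λ α → lin-* _ q s) p ⟨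
    lin (λ α → lin (λ β → φ (α ++ β)) (q *ₚ s)) p                      ≈⟨ lin-* φ p (q *ₚ s) ⟨
    lin φ (p *ₚ (q *ₚ s))                                              ∎

  *ₚ-identityˡ : ∀ p → (1ₚ *ₚ p) ≈ₚ p
  *ₚ-identityˡ p = ≈ₚ-ext (1ₚ *ₚ p) p λ {φ} φ-resp → begin
    lin φ (1ₚ *ₚ p)              ≈⟨ lin-* φ 1ₚ p ⟩
    1# * lin φ p + 0#            ≈⟨ +-identityʳ _ ⟩
    1# * lin φ p                 ≈⟨ *-identityˡ _ ⟩
    lin φ p                      ∎

  *ₚ-distribʳ : ∀ p q s → ((q ++ s) *ₚ p) ≈ₚ ((q *ₚ p) ++ (s *ₚ p))
  *ₚ-distribʳ p q s = ≈ₚ-ext ((q ++ s) *ₚ p) ((q *ₚ p) ++ (s *ₚ p)) λ {φ} φ-resp → begin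
    lin φ ((q ++ s) *ₚ p)                     ≈⟨ lin-* φ (q ++ s) p ⟩
    lin _ (q ++ s)                            ≈⟨ lin-++ _ q s ⟩
    lin _ q + lin _ s                         ≈⟨ +-cong (lin-* φ q p) (lin-* φ s p) ⟨
    lin φ (q *ₚ p) + lin φ (s *ₚ p)           ≈⟨ lin-++ φ (q *ₚ p) (s *ₚ p) ⟨
    lin φ ((q *ₚ p) ++ (s *ₚ p))              ∎

  polynomialRing : CommutativeRing c ℓ
  polynomialRing = record
    { Carrier = Poly X ; _≈_ = _≈ₚ_ ; _+_ = _+ₚ_ ; _*_ = _*ₚ_ ; -_ = -ₚ_ ; 0# = 0ₚ ; 1# = 1ₚ
    ; isCommutativeRing = record
      { isRing = record
        { +-isAbelianGroup = record
          { isGroup = record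
            { isMonoid = record
              { isSemigroup = record
                { isMagma = record
                  { isEquivalence = record
                    { refl  = λ α → ≈-refl
                    ; sym   = λ p≈q α → ≈-sym (p≈q α)
                    ; trans = λ p≈q q≈s α → ≈-trans (p≈q α) (q≈s α) }
                  ; ∙-cong = λ {p} {p′} {q} {q′} p≈p′ q≈q′ α →
                      ≈-trans (coeff-++ α p q) (≈-trans (+-cong (p≈p′ α) (q≈q′ α)) (≈-sym (coeff-++ α p′ q′))) }
                ; assoc = λ p q s α → reflexive (cong (coeff α) (++-assoc p q s)) }
              ; identity = (λ p α → ≈-refl) , (λ p α → reflexive (cong (coeff α) (++-identityʳ p))) }
            ; inverse = (λ p α → ≈-trans (coeff-++ α (-ₚ p) p) (≈-trans (+-congʳ (coeff-neg α p)) (-‿inverseˡ _)))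
                      , (λ p α → ≈-trans (coeff-++ α p (-ₚ p)) (≈-trans (+-congˡ (coeff-neg α p)) (-‿inverseʳ _)))
            ; ⁻¹-cong = λ {p} {q} p≈q α →
                ≈-trans (coeff-neg α p) (≈-trans (-‿cong (p≈q α)) (≈-sym (coeff-neg α q))) }
          ; comm = λ p q α → ≈-trans (coeff-++ α p q) (≈-trans (+-comm _ _) (≈-sym (coeff-++ α q p))) }
        ; *-cong = λ {p} {p′} {q} {q′} → *ₚ-cong {p} {p′} {q} {q′}
        ; *-assoc = *ₚ-assoc
        ; *-identity = *ₚ-identityˡ , λ p α → ≈-trans (*ₚ-comm p 1ₚ α) (*ₚ-identityˡ p α)
        ; distrib = (λ p q s α → ≈-trans (*ₚ-comm p (q ++ s) α) (≈-trans (*ₚ-distribʳ p q s α)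
                       (≈-trans (coeff-++ α (q *ₚ p) (s *ₚ p))
                         (≈-trans (+-cong (*ₚ-comm q p α) (*ₚ-comm s p α)) (≈-sym (coeff-++ α (p *ₚ q) (p *ₚ s)))))))
                  , *ₚ-distribʳ }
      ; *-comm = *ₚ-comm } }


to-injective : ∀ {X Y : Set} (τ : X ↔ Y) {x y} → to τ x ≡ to τ y → x ≡ y
to-injective τ {x} {y} eq = ≡.trans (≡.sym (Inverse.strictlyInverseʳ τ x))
  (≡.trans (cong (from τ) eq) (Inverse.strictlyInverseʳ τ y))

-- Signed sums over symmetric groups

module ListSums {c ℓ} (S : CommutativeRing c ℓ) where

  open CommutativeRing S hiding (refl; zero) renaming (sym to ≈-sym; trans to ≈-trans)
  open CommutativeRing S using () renaming (refl to ≈-refl)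
  open CSProps +-commutativeSemigroup using (interchange; x∙yz≈y∙xz)

  module _ {a} {Y : Set a} where

    sumL : (Y → Carrier) → List Y → Carrier
    sumL f []       = 0#
    sumL f (y ∷ ys) = f y + sumL f ys

    sumL-cong-∈ : ∀ {f g} ys → (∀ y → y ∈ ys → f y ≈ g y) → sumL f ys ≈ sumL g ys
    sumL-cong-∈ []       f≈g = ≈-refl
    sumL-cong-∈ (y ∷ ys) f≈g = +-cong (f≈g y (here refl)) (sumL-cong-∈ ys λ z z∈ys → f≈g z (there z∈ys))

    sumL-cong : ∀ {f g} ys → (∀ y → f y ≈ g y) → sumL f ys ≈ sumL g ys
    sumL-cong ys f≈g = sumL-cong-∈ ys λ y _ → f≈g y

    sumL-0 : ∀ ys → sumL (λ _ → 0#) ys ≈ 0#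
    sumL-0 []       = ≈-refl
    sumL-0 (y ∷ ys) = ≈-trans (+-identityˡ _) (sumL-0 ys)

    sumL-+ : ∀ f g ys → sumL (λ y → f y + g y) ys ≈ sumL f ys + sumL g ys
    sumL-+ f g []       = ≈-sym (+-identityˡ 0#)
    sumL-+ f g (y ∷ ys) = ≈-trans (+-congˡ (sumL-+ f g ys)) (interchange _ _ _ _)

    sumL-*ˡ : ∀ s f ys → sumL (λ y → s * f y) ys ≈ s * sumL f ys
    sumL-*ˡ s f []       = ≈-sym (zeroʳ s)
    sumL-*ˡ s f (y ∷ ys) = ≈-trans (+-congˡ (sumL-*ˡ s f ys)) (≈-sym (distribˡ s _ _))

    sumL-*ʳ : ∀ s f ys → sumL (λ y → f y * s) ys ≈ sumL f ys * s
    sumL-*ʳ s f []       = ≈-sym (zeroˡ s)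
    sumL-*ʳ s f (y ∷ ys) = ≈-trans (+-congˡ (sumL-*ʳ s f ys)) (≈-sym (distribʳ s _ _))

    sumL-++ : ∀ f ys zs → sumL f (ys ++ zs) ≈ sumL f ys + sumL f zs
    sumL-++ f []       zs = ≈-sym (+-identityˡ _)
    sumL-++ f (y ∷ ys) zs = ≈-trans (+-congˡ (sumL-++ f ys zs)) (≈-sym (+-assoc _ _ _))

    sumL-↭ : ∀ f {ys zs} → ys ↭ zs → sumL f ys ≈ sumL f zs
    sumL-↭ f ↭.refl         = ≈-refl
    sumL-↭ f (prep y p)     = +-congˡ (sumL-↭ f p)
    sumL-↭ f (swap y z p)   = ≈-trans (x∙yz≈y∙xz _ _ _) (+-congˡ (+-congˡ (sumL-↭ f p)))
    sumL-↭ f (↭.trans p q)  = ≈-trans (sumL-↭ f p) (sumL-↭ f q)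

  sumL-map : ∀ {a b} {Y : Set a} {Z : Set b} (f : Z → Carrier) (g : Y → Z) ys → sumL f (map g ys) ≈ sumL (f ∘ g) ys
  sumL-map f g []       = ≈-refl
  sumL-map f g (y ∷ ys) = +-congˡ (sumL-map f g ys)

  sumL-swap : ∀ {a b} {Y : Set a} {Z : Set b} (f : Y → Z → Carrier) ys zs →
              sumL (λ y → sumL (f y) zs) ys ≈ sumL (λ z → sumL (λ y → f y z) ys) zs
  sumL-swap f []       zs = ≈-sym (sumL-0 zs)
  sumL-swap f (y ∷ ys) zs = ≈-trans (+-congˡ (sumL-swap f ys zs)) (≈-sym (sumL-+ _ _ zs))

module Swaps {X : Set} (_≟_ : DecidableEquality X) where

  swapTo : X → X → X → X
  swapTo x y z with z ≟ x
  ... | yes _ = y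
  ... | no _ with z ≟ y
  ...   | yes _ = x
  ...   | no _  = z

  swapTo-x : ∀ x y → swapTo x y x ≡ y
  swapTo-x x y with x ≟ x
  ... | yes _  = refl
  ... | no x≢x = contradiction refl x≢x

  swapTo-y : ∀ x y → swapTo x y y ≡ x
  swapTo-y x y with y ≟ x
  ... | yes y≡x = y≡x
  ... | no _ with y ≟ y
  ...   | yes _  = refl
  ...   | no y≢y = contradiction refl y≢y

  swapTo-z : ∀ {x y z} → z ≢ x → z ≢ y → swapTo x y z ≡ z
  swapTo-z {x} {y} {z} z≢x z≢y with z ≟ x
  ... | yes z≡x = contradiction z≡x z≢x
  ... | no _ with z ≟ y
  ...   | yes z≡y = contradiction z≡y z≢y
  ...   | no _    = refl

  data SwapView (x y z : X) : Set where
    at-x  : z ≡ x → SwapView x y z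
    at-y  : z ≢ x → z ≡ y → SwapView x y z
    other : z ≢ x → z ≢ y → SwapView x y z

  swapView : ∀ x y z → SwapView x y z
  swapView x y z with z ≟ x
  ... | yes z≡x = at-x z≡x
  ... | no z≢x with z ≟ y
  ...   | yes z≡y = at-y z≢x z≡y
  ...   | no z≢y  = other z≢x z≢y

  swapTo-involutive : ∀ x y z → swapTo x y (swapTo x y z) ≡ z
  swapTo-involutive x y z with swapView x y z
  ... | at-x refl   = ≡.trans (cong (swapTo x y) (swapTo-x x y)) (swapTo-y x y)
  ... | at-y _ refl = ≡.trans (cong (swapTo x y) (swapTo-y x y)) (swapTo-x x y)
  ... | other p q   = ≡.trans (cong (swapTo x y) (swapTo-z p q)) (swapTo-z p q)

  swapPerm : X → X → X ↔ X
  swapPerm x y = mk↔ₛ′ (swapTo x y) (swapTo x y) (swapTo-involutive x y) (swapTo-involutive x y)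

  swapTo-comm : ∀ x y z → swapTo x y z ≡ swapTo y x z
  swapTo-comm x y z with swapView x y z
  ... | at-x refl   = ≡.trans (swapTo-x x y) (≡.sym (swapTo-y y x))
  ... | at-y _ refl = ≡.trans (swapTo-y x y) (≡.sym (swapTo-x y x))
  ... | other p q   = ≡.trans (swapTo-z p q) (≡.sym (swapTo-z q p))

  swapTo-refl : ∀ x z → swapTo x x z ≡ z
  swapTo-refl x z with swapView x x z
  ... | at-x refl   = swapTo-x x x
  ... | at-y _ refl = swapTo-x x x
  ... | other p q   = swapTo-z p q

  swapTo-conj : ∀ (τ : X ↔ X) x y z → to τ (swapTo x y z) ≡ swapTo (to τ x) (to τ y) (to τ z)
  swapTo-conj τ x y z with swapView x y z
  ... | at-x refl   = ≡.trans (cong (to τ) (swapTo-x x y)) (≡.sym (swapTo-x _ _))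
  ... | at-y _ refl = ≡.trans (cong (to τ) (swapTo-y x y)) (≡.sym (swapTo-y _ _))
  ... | other p q   = ≡.trans (cong (to τ) (swapTo-z p q))
                        (≡.sym (swapTo-z (p ∘ to-injective τ) (q ∘ to-injective τ)))

  -- In cycle notation (x y)(x k) = (k y)(x y): conjugating (x k) by (x y) gives (y k).
  swapTo-product : ∀ {x y k} → x ≢ y → x ≢ k → y ≢ k → ∀ z →
                   swapTo x y (swapTo x k z) ≡ swapTo k y (swapTo x y z)
  swapTo-product {x} {y} {k} x≢y x≢k y≢k z =
    ≡.trans (swapTo-conj (swapPerm x y) x k z)
      (≡.trans (cong (λ a → swapTo a (swapTo x y k) (swapTo x y z)) (swapTo-x x y))
        (≡.trans (cong (λ a → swapTo y a (swapTo x y z)) (swapTo-z (x≢k ∘ ≡.sym) (y≢k ∘ ≡.sym)))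
          (swapTo-comm y k _)))

  map-swapTo-∉ : ∀ {x y} zs → x ∉ zs → y ∉ zs → map (swapTo x y) zs ≡ zs
  map-swapTo-∉ []       _    _    = refl
  map-swapTo-∉ (z ∷ zs) x∉zs y∉zs = cong₂ _∷_
    (swapTo-z (λ z≡x → x∉zs (here (≡.sym z≡x))) (λ z≡y → y∉zs (here (≡.sym z≡y))))
    (map-swapTo-∉ zs (x∉zs ∘ there) (y∉zs ∘ there))

module UniqueLists {X : Set} where

  ∈-extract : ∀ {x : X} {xs} → x ∈ xs → ∃ λ ys → xs ↭ x ∷ ys
  ∈-extract {x} x∈xs with ∈-∃++ x∈xs
  ... | us , vs , refl = us ++ vs , ↭ₚ.shift x us vs

  unique-∉ : ∀ {x : X} {xs} → Unique (x ∷ xs) → x ∉ xs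
  unique-∉ (x≢ ∷ _) x∈xs = All.lookup x≢ x∈xs refl

  unique-tail : ∀ {x : X} {xs} → Unique (x ∷ xs) → Unique xs
  unique-tail (_ ∷ u) = u

  unique-↭ : ∀ {xs ys : List X} → xs ↭ ys → Unique xs → Unique ys
  unique-↭ p = ↭ₛ.Unique-resp-↭ (≡.setoid X) (↭.↭⇒↭ₛ p)

open UniqueLists public

module _ {X : Set} (_≟_ : DecidableEquality X) where

  open Swaps _≟_

  map-swapTo-↭ : ∀ {i k xs} → i ≢ k → Unique xs → i ∈ xs → k ∈ xs → map (swapTo i k) xs ↭ xs
  map-swapTo-↭ {i} {k} {xs} i≢k u i∈xs k∈xs with ∈-extract i∈xs
  ... | ys , xs↭i∷ys with ∈-extract k∈ys
    where
    k∈ys : k ∈ ys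
    k∈ys with ↭ₚ.∈-resp-↭ xs↭i∷ys k∈xs
    ... | here k≡i   = contradiction (≡.sym k≡i) i≢k
    ... | there k∈ys = k∈ys
  ...   | zs , ys↭k∷zs =
    ↭-trans (↭ₚ.map⁺ (swapTo i k) xs↭i∷k∷zs)
      (↭-trans (↭-reflexive (cong₂ _∷_ (swapTo-x i k) (cong₂ _∷_ (swapTo-y i k) (map-swapTo-∉ zs i∉zs k∉zs))))
        (↭-trans (swap k i ↭-refl) (↭-sym xs↭i∷k∷zs)))
    where
    xs↭i∷k∷zs : xs ↭ i ∷ k ∷ zs
    xs↭i∷k∷zs = ↭-trans xs↭i∷ys (prep i ys↭k∷zs)
    u′ : Unique (i ∷ k ∷ zs)
    u′ = unique-↭ xs↭i∷k∷zs u
    i∉zs : i ∉ zs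
    i∉zs = unique-∉ u′ ∘ there
    k∉zs : k ∉ zs
    k∉zs = unique-∉ (unique-tail u′)

module SymmetricSum {c ℓ} (S : CommutativeRing c ℓ) (ε : CommutativeRing.Carrier S)
                    {X : Set} (_≟_ : DecidableEquality X) where

  open CommutativeRing S hiding (refl; zero) renaming (sym to ≈-sym; trans to ≈-trans)
  open CommutativeRing S using () renaming (refl to ≈-refl)
  open CSProps +-commutativeSemigroup using (x∙yz≈y∙xz)
  open CSProps *-commutativeSemigroup using () renaming (x∙yz≈y∙xz to x*yz≈y*xz)
  open Mult +-monoid using () renaming (_×_ to _×′_; ×-congʳ to ×′-congʳ; ×-assocˡ to ×′-assocˡ)
  open import Relation.Binary.Reasoning.Setoid setoid
  open ListSums S
  open Swaps _≟_

  -- Coset decomposition: for a list without repetitions, a permutation of `x ∷ xs` is uniquely a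
  -- permutation of `xs`, possibly preceded by the transposition of `x` with its preimage `y`. Each
  -- such transposition contributes a factor `ε`, so that `ε` = 1 gives the plain sum and `ε` = -1
  -- the signed one.
  symSum : List X → ((X ↔ X) → Carrier) → Carrier
  symSum []       F = F (↔-id X)
  symSum (x ∷ xs) F = symSum xs F + ε * sumL (λ y → symSum xs (λ π → F (π ↔-∘ swapPerm x y))) xs

  FixesOutside : List X → (X ↔ X) → Set
  FixesOutside xs τ = ∀ z → z ∉ xs → to τ z ≡ z

  private
    weaken : ∀ {x xs τ} → FixesOutside xs τ → FixesOutside (x ∷ xs) τ
    weaken fix z z∉ = fix z (z∉ ∘ there)

    extend : ∀ {x y xs τ} → y ∈ xs → FixesOutside xs τ → FixesOutside (x ∷ xs) (τ ↔-∘ swapPerm x y)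
    extend {x} {y} {xs} {τ} y∈xs fix z z∉ =
      ≡.trans (cong (to τ) (swapTo-z (λ z≡x → z∉ (here z≡x)) (λ z≡y → z∉ (there (subst (_∈ xs) (≡.sym z≡y) y∈xs)))))
        (fix z (z∉ ∘ there))

  -- Only permutations fixing every point outside `xs` occur in the sum, which is what identifies
  -- the moved point in `symSum-identity`.
  symSum-cong-fix : ∀ xs {F G} → (∀ τ → FixesOutside xs τ → F τ ≈ G τ) → symSum xs F ≈ symSum xs G
  symSum-cong-fix []       F≈G = F≈G (↔-id X) λ _ _ → refl
  symSum-cong-fix (x ∷ xs) F≈G = +-cong
    (symSum-cong-fix xs λ τ fix → F≈G τ (weaken {x} {xs} {τ} fix))
    (*-congˡ (sumL-cong-∈ xs λ y y∈xs → symSum-cong-fix xs λ τ fix →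
      F≈G (τ ↔-∘ swapPerm x y) (extend {x} {y} {xs} {τ} y∈xs fix)))

  symSum-cong : ∀ xs {F G} → (∀ τ → F τ ≈ G τ) → symSum xs F ≈ symSum xs G
  symSum-cong xs F≈G = symSum-cong-fix xs λ τ _ → F≈G τ

  symSum-*ˡ : ∀ s xs F → symSum xs (λ τ → s * F τ) ≈ s * symSum xs F
  symSum-*ˡ s []       F = ≈-refl
  symSum-*ˡ s (x ∷ xs) F = begin
    symSum xs (λ τ → s * F τ) + ε * sumL (λ y → symSum xs (λ π → s * F (π ↔-∘ swapPerm x y))) xs
      ≈⟨ +-cong (symSum-*ˡ s xs F) (*-congˡ (≈-trans (sumL-cong xs λ y → symSum-*ˡ s xs _) (sumL-*ˡ s _ xs))) ⟩
    s * symSum xs F + ε * (s * sumL _ xs)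
      ≈⟨ +-congˡ (x*yz≈y*xz ε s _) ⟩
    s * symSum xs F + s * (ε * sumL _ xs)
      ≈⟨ distribˡ s _ _ ⟨
    s * symSum (x ∷ xs) F ∎

  symSum-0 : ∀ xs → symSum xs (λ _ → 0#) ≈ 0#
  symSum-0 xs = ≈-trans (symSum-cong xs λ _ → ≈-sym (zeroˡ 0#)) (≈-trans (symSum-*ˡ 0# xs _) (zeroˡ _))

  symSum-+ : ∀ xs F G → symSum xs (λ τ → F τ + G τ) ≈ symSum xs F + symSum xs G
  symSum-+ []       F G = ≈-refl
  symSum-+ (x ∷ xs) F G = begin
    symSum xs (λ τ → F τ + G τ) + ε * sumL (λ y → symSum xs (λ π → F (π ↔-∘ swapPerm x y) + G (π ↔-∘ swapPerm x y))) xs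
      ≈⟨ +-cong (symSum-+ xs F G) (*-congˡ (≈-trans (sumL-cong xs λ y → symSum-+ xs _ _) (sumL-+ _ _ xs))) ⟩
    (symSum xs F + symSum xs G) + ε * (sumL _ xs + sumL _ xs)
      ≈⟨ +-congˡ (distribˡ ε _ _) ⟩
    (symSum xs F + symSum xs G) + (ε * sumL _ xs + ε * sumL _ xs)
      ≈⟨ interchange _ _ _ _ ⟩
    symSum (x ∷ xs) F + symSum (x ∷ xs) G ∎
    where open CSProps +-commutativeSemigroup using (interchange)

  symSum-sumL : ∀ {a} {Y : Set a} xs (F : Y → (X ↔ X) → Carrier) ys →
                symSum xs (λ τ → sumL (λ y → F y τ) ys) ≈ sumL (λ y → symSum xs (F y)) ys
  symSum-sumL xs F []       = symSum-0 xs
  symSum-sumL xs F (y ∷ ys) = ≈-trans (symSum-+ xs _ _) (+-congˡ (symSum-sumL xs F ys))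

  -- A summand π ∘ (x y) sends `y` to `x`, because π fixes `x`. Thus it moves `y` and contributes 0.
  symSum-identity : ∀ xs {F} → Unique xs → (∀ τ z → to τ z ≢ z → F τ ≈ 0#) → symSum xs F ≈ F (↔-id X)
  symSum-identity []       _ _ = ≈-refl
  symSum-identity (x ∷ xs) {F} u moves = begin
    symSum xs F + ε * sumL (λ y → symSum xs (λ π → F (π ↔-∘ swapPerm x y))) xs
      ≈⟨ +-cong (symSum-identity xs (unique-tail u) moves) (*-congˡ (sumL-cong-∈ xs vanish)) ⟩
    F (↔-id X) + ε * sumL (λ _ → 0#) xs
      ≈⟨ +-congˡ (≈-trans (*-congˡ (sumL-0 xs)) (zeroʳ ε)) ⟩
    F (↔-id X) + 0#
      ≈⟨ +-identityʳ _ ⟩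
    F (↔-id X) ∎
    where
    vanish : ∀ y → y ∈ xs → symSum xs (λ π → F (π ↔-∘ swapPerm x y)) ≈ 0#
    vanish y y∈xs = ≈-trans
      (symSum-cong-fix xs λ π fix → moves (π ↔-∘ swapPerm x y) y λ eq →
        unique-∉ u (subst (_∈ xs) (≡.trans (≡.sym eq) (≡.trans (cong (to π) (swapTo-y x y)) (fix x (unique-∉ u)))) y∈xs))
      (symSum-0 xs)

  Respects : ((X ↔ X) → Carrier) → Set ℓ
  Respects F = ∀ σ τ → (∀ z → to σ z ≡ to τ z) → F σ ≈ F τ

  -- The factor `ε` of a coset meets the one from the equivariance of `H`; their product is 1, so
  -- all cosets contribute alike.
  symSum-constant : ∀ xs {H} → Unique xs → ε * ε ≈ 1# →
                    (∀ τ x y → x ≢ y → H (τ ↔-∘ swapPerm x y) ≈ ε * H τ) →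
                    symSum xs H ≈ (length xs !) ×′ H (↔-id X)
  symSum-constant []       _ _ _ = ≈-sym (+-identityʳ _)
  symSum-constant (x ∷ xs) {H} u εε≈1 equiv = begin
    symSum xs H + ε * sumL (λ y → symSum xs (λ π → H (π ↔-∘ swapPerm x y))) xs
      ≈⟨ +-congˡ (*-congˡ (sumL-cong-∈ xs λ y y∈xs → ≈-trans
           (symSum-cong xs λ π → equiv π x y λ x≡y → unique-∉ u (subst (_∈ xs) (≡.sym x≡y) y∈xs))
           (symSum-*ˡ ε xs H))) ⟩
    symSum xs H + ε * sumL (λ _ → ε * symSum xs H) xs
      ≈⟨ +-congˡ (*-congˡ (sumL-*ˡ ε _ xs)) ⟩
    symSum xs H + ε * (ε * sumL (λ _ → symSum xs H) xs)
      ≈⟨ +-congˡ (≈-trans (≈-sym (*-assoc _ _ _)) (≈-trans (*-congʳ εε≈1) (*-identityˡ _))) ⟩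
    symSum xs H + sumL (λ _ → symSum xs H) xs
      ≈⟨ +-congˡ (sumL-const xs) ⟩
    suc (length xs) ×′ symSum xs H
      ≈⟨ ×′-congʳ (suc (length xs)) (symSum-constant xs (unique-tail u) εε≈1 equiv) ⟩
    suc (length xs) ×′ ((length xs !) ×′ H (↔-id X))
      ≈⟨ ×′-assocˡ _ (suc (length xs)) (length xs !) ⟩
    (suc (length xs) !) ×′ H (↔-id X) ∎
    where
    sumL-const : ∀ ys → sumL (λ _ → symSum xs H) ys ≈ length ys ×′ symSum xs H
    sumL-const []       = ≈-refl
    sumL-const (_ ∷ ys) = +-congˡ (sumL-const ys)

  -- Right translation permutes the cosets. If `x` is not involved, (x y)(i k) = (i k)(x y′) with y′
  -- the image of `y`. If `i` is `x`, the coset of `k` trades places with the trivial one, and any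
  -- other (x y)(x k) becomes (k y)(x y), where induction supplies the factor `ε`.
  symSum-swap : ∀ xs {F} → Unique xs → ε * ε ≈ 1# → Respects F →
                ∀ {i k} → i ≢ k → i ∈ xs → k ∈ xs →
                symSum xs (λ τ → F (τ ↔-∘ swapPerm i k)) ≈ ε * symSum xs F
  symSum-swap (x ∷ xs) {F} u εε≈1 F-resp = λ where
      i≢k (here refl)  (here refl)  → contradiction refl i≢k
      i≢k (here refl)  (there k∈xs) → at-head k∈xs
      i≢k (there i∈xs) (here refl)  → ≈-trans
        (symSum-cong (x ∷ xs) λ τ → F-resp _ _ λ z → cong (to τ) (swapTo-comm _ _ z))
        (at-head i∈xs)
      i≢k (there i∈xs) (there k∈xs) → in-tail i≢k i∈xs k∈xs
    where
    G : X → (X ↔ X) → Carrier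
    G y π = F (π ↔-∘ swapPerm x y)

    G-resp : ∀ y → Respects (G y)
    G-resp y σ τ σ≈τ = F-resp _ _ λ z → σ≈τ (swapTo x y z)

    in-tail : ∀ {i k} → i ≢ k → i ∈ xs → k ∈ xs →
              symSum (x ∷ xs) (λ τ → F (τ ↔-∘ swapPerm i k)) ≈ ε * symSum (x ∷ xs) F
    in-tail {i} {k} i≢k i∈xs k∈xs = begin
      symSum xs (λ τ → F (τ ↔-∘ swapPerm i k)) + ε * sumL (λ y → symSum xs (λ π → F ((π ↔-∘ swapPerm x y) ↔-∘ swapPerm i k))) xs
        ≈⟨ +-cong (symSum-swap xs (unique-tail u) εε≈1 F-resp i≢k i∈xs k∈xs) (*-congˡ (sumL-cong xs λ y →
             ≈-trans (symSum-cong xs λ π → F-resp _ _ λ z → cong (to π) (conj y z))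
               (symSum-swap xs (unique-tail u) εε≈1 (G-resp (swapTo i k y)) i≢k i∈xs k∈xs))) ⟩
      ε * symSum xs F + ε * sumL (λ y → ε * symSum xs (G (swapTo i k y))) xs
        ≈⟨ distribˡ ε _ _ ⟨
      ε * (symSum xs F + sumL (λ y → ε * symSum xs (G (swapTo i k y))) xs)
        ≈⟨ *-congˡ (+-congˡ (sumL-*ˡ ε _ xs)) ⟩
      ε * (symSum xs F + ε * sumL (λ y → symSum xs (G (swapTo i k y))) xs)
        ≈⟨ *-congˡ (+-congˡ (*-congˡ (≈-trans (≈-sym (sumL-map (λ y → symSum xs (G y)) (swapTo i k) xs))
             (sumL-↭ _ (map-swapTo-↭ _≟_ i≢k (unique-tail u) i∈xs k∈xs))))) ⟩
      ε * symSum (x ∷ xs) F ∎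
      where
      x≢i : x ≢ i
      x≢i x≡i = unique-∉ u (subst (_∈ xs) (≡.sym x≡i) i∈xs)
      x≢k : x ≢ k
      x≢k x≡k = unique-∉ u (subst (_∈ xs) (≡.sym x≡k) k∈xs)
      conj : ∀ y z → swapTo x y (swapTo i k z) ≡ swapTo i k (swapTo x (swapTo i k y) z)
      conj y z = ≡.sym (≡.trans (swapTo-conj (swapPerm i k) x (swapTo i k y) z)
        (cong₂ (λ a b → swapTo a b (swapTo i k z)) (swapTo-z x≢i x≢k) (swapTo-involutive i k y)))

    at-head : ∀ {k} → k ∈ xs → symSum (x ∷ xs) (λ τ → F (τ ↔-∘ swapPerm x k)) ≈ ε * symSum (x ∷ xs) F
    at-head {k} k∈xs with ∈-extract k∈xs
    ... | ys , xs↭k∷ys = begin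
      g k + ε * sumL h xs
        ≈⟨ +-congˡ (*-congˡ (sumL-↭ h xs↭k∷ys)) ⟩
      g k + ε * (h k + sumL h ys)
        ≈⟨ +-congˡ (*-congˡ (+-cong h-k (≈-trans (sumL-cong-∈ ys h-y) (sumL-*ˡ ε g ys)))) ⟩
      g k + ε * (symSum xs F + ε * sumL g ys)
        ≈⟨ +-congˡ (distribˡ ε _ _) ⟩
      g k + (ε * symSum xs F + ε * (ε * sumL g ys))
        ≈⟨ +-congˡ (+-congˡ (ε-cancel _)) ⟩
      g k + (ε * symSum xs F + sumL g ys)
        ≈⟨ x∙yz≈y∙xz _ _ _ ⟩
      ε * symSum xs F + (g k + sumL g ys)
        ≈⟨ +-congˡ (≈-trans (ε-cancel _) (sumL-↭ g xs↭k∷ys)) ⟨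
      ε * symSum xs F + ε * (ε * sumL g xs)
        ≈⟨ distribˡ ε _ _ ⟨
      ε * symSum (x ∷ xs) F ∎
      where
      g h : X → Carrier
      g y = symSum xs (G y)
      h y = symSum xs (λ π → F ((π ↔-∘ swapPerm x y) ↔-∘ swapPerm x k))

      ε-cancel : ∀ s → ε * (ε * s) ≈ s
      ε-cancel s = ≈-trans (≈-sym (*-assoc _ _ _)) (≈-trans (*-congʳ εε≈1) (*-identityˡ _))

      h-k : h k ≈ symSum xs F
      h-k = symSum-cong xs λ π → F-resp _ _ λ z → cong (to π) (swapTo-involutive x k z)

      u′ : Unique (k ∷ ys)
      u′ = unique-↭ xs↭k∷ys (unique-tail u)

      h-y : ∀ y → y ∈ ys → h y ≈ ε * g y
      h-y y y∈ys = ≈-trans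
        (symSum-cong xs λ π → F-resp _ _ λ z → cong (to π) (swapTo-product x≢y x≢k y≢k z))
        (symSum-swap xs (unique-tail u) εε≈1 (G-resp y) (y≢k ∘ ≡.sym) k∈xs y∈xs)
        where
        y∈xs : y ∈ xs
        y∈xs = ↭ₚ.∈-resp-↭ (↭-sym xs↭k∷ys) (there y∈ys)
        x≢y : x ≢ y
        x≢y x≡y = unique-∉ u (subst (_∈ xs) (≡.sym x≡y) y∈xs)
        x≢k : x ≢ k
        x≢k x≡k = unique-∉ u (subst (_∈ xs) (≡.sym x≡k) k∈xs)
        y≢k : y ≢ k
        y≢k y≡k = unique-∉ u′ (subst (_∈ ys) y≡k y∈ys)


module _ {X : Set} where

  unique-⊆-↭ : ∀ {xs ys : List X} → Unique xs → Unique ys →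
               (∀ {z} → z ∈ xs → z ∈ ys) → (∀ {z} → z ∈ ys → z ∈ xs) → xs ↭ ys
  unique-⊆-↭ {[]}     {[]}     _ _ _ _ = ↭-refl
  unique-⊆-↭ {[]}     {y ∷ ys} _ _ _ ys⊆xs with () ← ys⊆xs (here refl)
  unique-⊆-↭ {x ∷ xs} {ys} u v xs⊆ys ys⊆xs with ∈-extract (xs⊆ys (here refl))
  ... | zs , ys↭x∷zs = ↭-trans (prep x (unique-⊆-↭ (unique-tail u) (unique-tail v′) fwd bwd)) (↭-sym ys↭x∷zs)
    where
    v′ : Unique (x ∷ zs)
    v′ = unique-↭ ys↭x∷zs v
    fwd : ∀ {z} → z ∈ xs → z ∈ zs
    fwd z∈xs with ↭ₚ.∈-resp-↭ ys↭x∷zs (xs⊆ys (there z∈xs))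
    ... | here refl   = contradiction z∈xs (unique-∉ u)
    ... | there z∈zs  = z∈zs
    bwd : ∀ {z} → z ∈ zs → z ∈ xs
    bwd z∈zs with ys⊆xs (↭ₚ.∈-resp-↭ (↭-sym ys↭x∷zs) (there z∈zs))
    ... | here refl   = contradiction z∈zs (unique-∉ v′)
    ... | there z∈xs  = z∈xs

-- Subalgebras, and the axioms of a graded polynomial ring

module Subalgebra {c ℓ k} (S : CommutativeRing c ℓ) {K : Set k} (κ : K → CommutativeRing.Carrier S) where

  open CommutativeRing S

  data Generated {g} (G : Carrier → Set g) : Carrier → Set (c ⊔ ℓ ⊔ k ⊔ g) where
    gen  : ∀ {p} → G p → Generated G p
    con  : ∀ r → Generated G (κ r)
    _⊕_  : ∀ {p q} → Generated G p → Generated G q → Generated G (p + q)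
    _⊗_  : ∀ {p q} → Generated G p → Generated G q → Generated G (p * q)
    resp : ∀ {p q} → p ≈ q → Generated G p → Generated G q

-- A polynomial ring, kept abstract so that nothing unfolds to lists of terms.
record GradedVariables {c ℓ} (R : CommutativeRing c ℓ) (X : Set) (S : CommutativeRing c ℓ) : Set (lsuc (c ⊔ ℓ)) where
  private module R = CommutativeRing R
  open CommutativeRing S

  field
    κ       : R.Carrier → Carrier
    κ-cong  : ∀ {r s} → r R.≈ s → κ r ≈ κ s
    κ-+     : ∀ r s → κ (r R.+ s) ≈ κ r + κ s
    κ-*     : ∀ r s → κ (r R.* s) ≈ κ r * κ s
    κ-1     : κ R.1# ≈ 1#
    var     : X → Carrier

  Regular : Carrier → Set (c ⊔ ℓ)
  Regular p = ∀ q → p * q ≈ 0# → q ≈ 0#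

  field
    generated   : ∀ p → Subalgebra.Generated S κ (λ q → ∃ λ x → q ≈ var x) p
    var-regular : ∀ {x y} → x ≢ y → Regular (var x - var y)

    act      : (X → X) → Carrier → Carrier
    act-cong : ∀ f {p q} → p ≈ q → act f p ≈ act f q
    act-+    : ∀ f p q → act f (p + q) ≈ act f p + act f q
    act-*    : ∀ f p q → act f (p * q) ≈ act f p * act f q
    act-κ    : ∀ f r → act f (κ r) ≈ κ r
    act-var  : ∀ f x → act f (var x) ≈ var (f x)
    act-≗    : ∀ {f g} → (∀ x → f x ≡ g x) → ∀ p → act f p ≈ act g p
    act-∘    : ∀ f g p → act f (act g p) ≈ act (f ∘ g) p
    act-id   : ∀ p → act id p ≈ p

    Hom      : ℕ → Carrier → Set ℓ
    Hom-resp : ∀ {d p q} → p ≈ q → Hom d p → Hom d q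
    Hom-0    : ∀ d → Hom d 0#
    Hom-+    : ∀ {d p q} → Hom d p → Hom d q → Hom d (p + q)
    Hom-*    : ∀ {d e p q} → Hom d p → Hom e q → Hom (d ℕ.+ e) (p * q)
    Hom-κ    : ∀ r → Hom 0 (κ r)
    Hom-var  : ∀ x → Hom 1 (var x)
    Hom-act  : ∀ f {d p} → Hom d p → Hom d (act f p)

    coefficient       : List X → Carrier → R.Carrier
    coefficient-cong  : ∀ γ {p q} → p ≈ q → coefficient γ p R.≈ coefficient γ q
    coefficient-+     : ∀ γ p q → coefficient γ (p + q) R.≈ coefficient γ p R.+ coefficient γ q
    coefficient-same  : ∀ {β γ} → β ↭ γ → coefficient γ (foldr (λ x → var x *_) 1# β) R.≈ R.1#
    coefficient-other : ∀ {β γ} → ¬ (β ↭ γ) → coefficient γ (foldr (λ x → var x *_) 1# β) R.≈ R.0#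

    -- The augmentation: it carries identities between integers from the polynomial ring to the
    -- coefficient ring and discards everything of positive degree.
    const-coeff      : Carrier → R.Carrier
    const-coeff-cong : ∀ {p q} → p ≈ q → const-coeff p R.≈ const-coeff q
    const-coeff-+    : ∀ p q → const-coeff (p + q) R.≈ const-coeff p R.+ const-coeff q
    const-coeff-*    : ∀ p q → const-coeff (p * q) R.≈ const-coeff p R.* const-coeff q
    const-coeff-κ    : ∀ r → const-coeff (κ r) R.≈ r

    -- Degree theory for quotients: the component of `q` in degree k lands in degree D + k of the
    -- product, hence vanishes unless D + k = d.
    Hom-cancel       : ∀ {D d p q} → Regular p → Hom D p → Hom d (p * q) → d ℕ.< D → q ≈ 0#
    Hom-cancel-const : ∀ {D d p q} → Regular p → Hom D p → Hom d (p * q) → d ≢ D → const-coeff q R.≈ R.0#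

-- The trace obtained from antisymmetrization over the variables

module Pairs {X : Set} where

  before : List X → List (X × X)
  before []       = []
  before (x ∷ xs) = map (x ,_) xs ++ before xs

  -- The exponents r - 1, ..., 1, 0 of the leading monomial of the Vandermonde product in r
  -- variables.
  staircase : List X → List X
  staircase []       = []
  staircase (x ∷ xs) = replicate (length xs) x ++ staircase xs

  proj₁-before : ∀ xs → map proj₁ (before xs) ≡ staircase xs
  proj₁-before []       = refl
  proj₁-before (x ∷ xs) = ≡.trans (map-++ proj₁ (map (x ,_) xs) (before xs)) (cong₂ _++_ (firsts xs) (proj₁-before xs))
    where
    firsts : ∀ ys → map proj₁ (map (x ,_) ys) ≡ replicate (length ys) x
    firsts []       = refl
    firsts (_ ∷ ys) = cong (x ∷_) (firsts ys)

  before-≢ : ∀ {xs} → Unique xs → ∀ {i j} → (i , j) ∈ before xs → i ≢ j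
  before-≢ {x ∷ xs} u ij∈ i≡j with ∈-++⁻ (map (x ,_) xs) ij∈
  ... | inj₂ ij∈xs = before-≢ (unique-tail u) ij∈xs i≡j
  ... | inj₁ ij∈x with ∈-map⁻ (x ,_) ij∈x
  ...   | y , y∈xs , refl = unique-∉ u (subst (_∈ xs) (≡.sym i≡j) y∈xs)

  module _ (_≟_ : DecidableEquality X) where

    open DecMembership _≟_ using (_∈?_)

    -- The first element that τ moves is sent to a later one.
    moved-forward : ∀ xs → Unique xs → (τ : X ↔ X) → (∀ z → z ∉ xs → to τ z ≡ z) →
                    ∀ {z} → to τ z ≢ z → ∃ λ x → (x , to τ x) ∈ before xs
    moved-forward []       u τ fix {z} moved = contradiction (fix z λ ()) moved
    moved-forward (x ∷ xs) u τ fix {z} moved with to τ x ≟ x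
    ... | yes τx≡x with moved-forward xs (unique-tail u) τ fix′ moved
      where
      fix′ : ∀ z → z ∉ xs → to τ z ≡ z
      fix′ z z∉xs with z ≟ x
      ... | yes refl = τx≡x
      ... | no z≢x   = fix z λ { (here z≡x) → z≢x z≡x ; (there z∈xs) → z∉xs z∈xs }
    ...   | y , y∈ = y , ∈-++⁺ʳ (map (x ,_) xs) y∈
    moved-forward (x ∷ xs) u τ fix {z} moved | no τx≢x with to τ x ∈? (x ∷ xs)
    ... | yes (here τx≡x)   = contradiction τx≡x τx≢x
    ... | yes (there τx∈xs) = x , ∈-++⁺ˡ (∈-map⁺ (x ,_) τx∈xs)
    ... | no τx∉            = contradiction (to-injective τ (fix (to τ x) τx∉)) τx≢x

module Antisymmetrization {c ℓ} (R : CommutativeRing c ℓ)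
    (half : CommutativeRing.Carrier R)
    (half-2 : CommutativeRing._≈_ R (CommutativeRing._+_ R half half) (CommutativeRing.1# R))
    {X : Set} (_≟_ : DecidableEquality X)
    (all : List X) (all-unique : Unique all) (all-complete : ∀ x → x ∈ all)
    (S : CommutativeRing c ℓ) (V : GradedVariables R X S) where

  private module R = CommutativeRing R
  open GradedVariables V
  open Subalgebra S κ
  open CommutativeRing S hiding (zero) renaming (sym to ≈-sym; trans to ≈-trans; refl to ≈-refl)
  open RingProps ring
  open CSProps *-commutativeSemigroup using (x∙yz≈y∙xz)
  open SemiringMult semiring using (×-assoc-*; ×-comm-*) renaming (_×_ to _×′_; ×-congʳ to ×′-congʳ)
  open import Relation.Binary.Reasoning.Setoid setoid
  open import Algebra.Solver.Ring.NaturalCoefficients.Default commutativeSemiring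
    using (solve; _:=_; _:*_; _:+_)
  open ListSums S
  open Swaps _≟_
  open Pairs {X}
  open SymmetricSum S (- 1#) _≟_

  private
    Perm : Set
    Perm = X ↔ X

  -1*-1≈1 : - 1# * - 1# ≈ 1#
  -1*-1≈1 = ≈-trans (-1*x≈-x (- 1#)) (-‿involutive 1#)

  κ-0 : κ R.0# ≈ 0#
  κ-0 = +-identityʳ-unique (κ R.0#) (κ R.0#) (≈-trans (≈-sym (κ-+ _ _)) (κ-cong (R.+-identityʳ _)))

  κ-neg : ∀ r → κ (R.- r) ≈ - κ r
  κ-neg r = +-inverseˡ-unique (κ (R.- r)) (κ r) (≈-trans (≈-sym (κ-+ _ _)) (≈-trans (κ-cong (R.-‿inverseˡ r)) κ-0))

  double≈0 : ∀ {p} → p + p ≈ 0# → p ≈ 0#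
  double≈0 {p} p+p≈0 = begin
    p                           ≈⟨ *-identityˡ p ⟨
    1# * p                      ≈⟨ *-congʳ (≈-trans (≈-sym κ-1) (≈-trans (κ-cong (R.sym half-2)) (κ-+ half half))) ⟩
    (κ half + κ half) * p       ≈⟨ solve 2 (λ h q → (h :+ h) :* q := h :* (q :+ q)) ≈-refl (κ half) p ⟩
    κ half * (p + p)            ≈⟨ *-congˡ p+p≈0 ⟩
    κ half * 0#                 ≈⟨ zeroʳ _ ⟩
    0#                          ∎

  act-1 : ∀ f → act f 1# ≈ 1#
  act-1 f = ≈-trans (act-cong f (≈-sym κ-1)) (≈-trans (act-κ f R.1#) κ-1)

  act-0 : ∀ f → act f 0# ≈ 0#
  act-0 f = ≈-trans (act-cong f (≈-sym κ-0)) (≈-trans (act-κ f R.0#) κ-0)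

  act-neg : ∀ f p → act f (- p) ≈ - act f p
  act-neg f p = +-inverseˡ-unique _ _ (≈-trans (≈-sym (act-+ f _ _)) (≈-trans (act-cong f (-‿inverseˡ p)) (act-0 f)))

  evalMon : (X → Carrier) → List X → Carrier
  evalMon u = foldr (λ x → u x *_) 1#

  mon : List X → Carrier
  mon = evalMon var

  mon-++ : ∀ α β → mon (α ++ β) ≈ mon α * mon β
  mon-++ []      β = ≈-sym (*-identityˡ _)
  mon-++ (x ∷ α) β = ≈-trans (*-congˡ (mon-++ α β)) (≈-sym (*-assoc _ _ _))

  mon-↭ : ∀ {α β} → α ↭ β → mon α ≈ mon β
  mon-↭ ↭.refl        = ≈-refl
  mon-↭ (prep x p)    = *-congˡ (mon-↭ p)
  mon-↭ (swap x y p)  = ≈-trans (x∙yz≈y∙xz _ _ _) (*-congˡ (*-congˡ (mon-↭ p)))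
  mon-↭ (↭.trans p q) = ≈-trans (mon-↭ p) (mon-↭ q)

  act-mon : ∀ f α → act f (mon α) ≈ evalMon (var ∘ f) α
  act-mon f []      = act-1 f
  act-mon f (x ∷ α) = ≈-trans (act-* f _ _) (*-cong (act-var f x) (act-mon f α))

  evalMon-map : ∀ f α → evalMon (var ∘ f) α ≡ mon (map f α)
  evalMon-map f []      = refl
  evalMon-map f (x ∷ α) = cong (var (f x) *_) (evalMon-map f α)

  act-mon-map : ∀ f α → act f (mon α) ≈ mon (map f α)
  act-mon-map f α = ≈-trans (act-mon f α) (reflexive (evalMon-map f α))

  Hom-1 : Hom 0 1#
  Hom-1 = Hom-resp κ-1 (Hom-κ R.1#)

  Hom-mon : ∀ α → Hom (length α) (mon α)
  Hom-mon []      = Hom-1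
  Hom-mon (x ∷ α) = Hom-* (Hom-var x) (Hom-mon α)

  Invariant : Carrier → Set ℓ
  Invariant s = ∀ (τ : Perm) → act (to τ) s ≈ s

  antisym : Carrier → Carrier
  antisym f = symSum all (λ τ → act (to τ) f)

  antisym-cong : ∀ {f g} → f ≈ g → antisym f ≈ antisym g
  antisym-cong f≈g = symSum-cong all λ τ → act-cong (to τ) f≈g

  antisym-+ : ∀ f g → antisym (f + g) ≈ antisym f + antisym g
  antisym-+ f g = ≈-trans (symSum-cong all λ τ → act-+ (to τ) f g) (symSum-+ all _ _)

  antisym-*ˡ : ∀ {s} f → Invariant s → antisym (s * f) ≈ s * antisym f
  antisym-*ˡ {s} f s-inv =
    ≈-trans (symSum-cong all λ τ → ≈-trans (act-* (to τ) s f) (*-congʳ (s-inv τ))) (symSum-*ˡ s all _)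

  antisym-swap : ∀ {x y} f → x ≢ y → antisym (act (swapTo x y) f) ≈ - antisym f
  antisym-swap {x} {y} f x≢y = begin
    symSum all (λ τ → act (to τ) (act (swapTo x y) f))     ≈⟨ symSum-cong all (λ τ → act-∘ (to τ) (swapTo x y) f) ⟩
    symSum all (λ τ → act (to (τ ↔-∘ swapPerm x y)) f)     ≈⟨ symSum-swap all all-unique -1*-1≈1 (λ σ τ σ≗τ → act-≗ σ≗τ f) x≢y (all-complete x) (all-complete y) ⟩
    - 1# * antisym f                                       ≈⟨ -1*x≈-x _ ⟩
    - antisym f                                            ∎

  antisym-fixed : ∀ {x y} f → x ≢ y → act (swapTo x y) f ≈ f → antisym f ≈ 0#
  antisym-fixed {x} {y} f x≢y fixed = double≈0 (≈-trans (+-congˡ eq) (-‿inverseʳ _))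
    where
    eq : antisym f ≈ - antisym f
    eq = ≈-trans (antisym-cong (≈-sym fixed)) (antisym-swap f x≢y)

  -- On a translate of `f`, `antisym` returns `antisym f` with the sign of the translation, which
  -- the outer signed sum cancels.
  antisym-antisym : ∀ f → antisym (antisym f) ≈ (length all !) ×′ antisym f
  antisym-antisym f = begin
    antisym (antisym f)                                   ≈⟨ antisym-symSum all (λ τ → act (to τ) f) ⟩
    symSum all (λ τ → antisym (act (to τ) f))             ≈⟨ symSum-constant all all-unique -1*-1≈1 equivariant ⟩
    (length all !) ×′ antisym (act id f)                  ≈⟨ ×′-congʳ (length all !) (antisym-cong (act-id f)) ⟩
    (length all !) ×′ antisym f                           ∎
    where
    antisym-neg : ∀ f → antisym (- 1# * f) ≈ - 1# * antisym f
    antisym-neg f = antisym-*ˡ f λ τ → ≈-trans (act-neg (to τ) 1#) (-‿cong (act-1 (to τ)))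

    antisym-0 : antisym 0# ≈ 0#
    antisym-0 = ≈-trans (symSum-cong all λ τ → act-0 (to τ)) (symSum-0 all)

    antisym-sumL : ∀ (g : X → Carrier) ys → antisym (sumL g ys) ≈ sumL (antisym ∘ g) ys
    antisym-sumL g []       = antisym-0
    antisym-sumL g (y ∷ ys) = ≈-trans (antisym-+ _ _) (+-congˡ (antisym-sumL g ys))

    antisym-symSum : ∀ xs F → antisym (symSum xs F) ≈ symSum xs (antisym ∘ F)
    antisym-symSum []       F = ≈-refl
    antisym-symSum (x ∷ xs) F = ≈-trans (antisym-+ _ _) (+-cong (antisym-symSum xs F)
      (≈-trans (antisym-neg _) (*-congˡ (≈-trans (antisym-sumL _ xs) (sumL-cong xs λ y → antisym-symSum xs _)))))

    equivariant : ∀ τ x y → x ≢ y → antisym (act (to (τ ↔-∘ swapPerm x y)) f) ≈ - 1# * antisym (act (to τ) f)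
    equivariant τ x y x≢y = begin
      antisym (act (to τ ∘ swapTo x y) f)                            ≈⟨ antisym-cong (act-≗ (swapTo-conj τ x y) f) ⟩
      antisym (act (swapTo (to τ x) (to τ y) ∘ to τ) f)              ≈⟨ antisym-cong (act-∘ _ (to τ) f) ⟨
      antisym (act (swapTo (to τ x) (to τ y)) (act (to τ) f))        ≈⟨ antisym-swap _ (x≢y ∘ to-injective τ) ⟩
      - antisym (act (to τ) f)                                       ≈⟨ -1*x≈-x _ ⟨
      - 1# * antisym (act (to τ) f)                                  ∎

  Hom-antisym : ∀ {d f} → Hom d f → Hom d (antisym f)
  Hom-antisym {d} hom = Hom-symSum all λ τ → Hom-act (to τ) hom
    where
    Hom-neg : ∀ {p} → Hom d p → Hom d (- 1# * p)
    Hom-neg h = Hom-* (Hom-resp (≈-trans (κ-neg R.1#) (-‿cong κ-1)) (Hom-κ (R.- R.1#))) h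

    Hom-sumL : ∀ {g : X → Carrier} ys → (∀ y → Hom d (g y)) → Hom d (sumL g ys)
    Hom-sumL []       h = Hom-0 d
    Hom-sumL (y ∷ ys) h = Hom-+ (h y) (Hom-sumL ys h)

    Hom-symSum : ∀ xs {F} → (∀ τ → Hom d (F τ)) → Hom d (symSum xs F)
    Hom-symSum []       h = h (↔-id X)
    Hom-symSum (x ∷ xs) h =
      Hom-+ (Hom-symSum xs h) (Hom-neg (Hom-sumL xs λ y → Hom-symSum xs λ π → h (π ↔-∘ swapPerm x y)))

  factors : (X → Carrier) → (X → Carrier) → List (X × X) → Carrier
  factors u v = foldr (λ (j , i) → (u j - v i) *_) 1#

  Term : Set c
  Term = List X × R.Carrier × List X

  -- The terms of the product of the  x j ⊗ 1 - 1 ⊗ x i  over the given (j , i).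
  kernel : List (X × X) → List Term
  kernel []             = ([] , R.1# , []) ∷ []
  kernel ((j , i) ∷ ps) = map (λ (b , r , c) → j ∷ b , r , c) (kernel ps) ++
                          map (λ (b , r , c) → b , R.- r , i ∷ c) (kernel ps)

  kernel-factors : ∀ u v ps → sumL (λ (b , r , c) → evalMon u b * (κ r * evalMon v c)) (kernel ps) ≈ factors u v ps
  kernel-factors u v [] = ≈-trans (+-identityʳ _) (≈-trans (*-identityˡ _) (≈-trans (*-identityʳ _) κ-1))
  kernel-factors u v ((j , i) ∷ ps) = begin
    sumL term (map f (kernel ps) ++ map g (kernel ps))                       ≈⟨ sumL-++ term (map f (kernel ps)) _ ⟩
    sumL term (map f (kernel ps)) + sumL term (map g (kernel ps))            ≈⟨ +-cong (sumL-map term f (kernel ps)) (sumL-map term g (kernel ps)) ⟩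
    sumL (term ∘ f) (kernel ps) + sumL (term ∘ g) (kernel ps)                ≈⟨ +-cong
      (≈-trans (sumL-cong (kernel ps) λ (b , r , c) → *-assoc (u j) _ _) (sumL-*ˡ (u j) term (kernel ps)))
      (≈-trans (sumL-cong (kernel ps) λ (b , r , c) → negated b r c) (sumL-*ˡ (- v i) term (kernel ps))) ⟩
    u j * sumL term (kernel ps) + - v i * sumL term (kernel ps)              ≈⟨ distribʳ _ (u j) (- v i) ⟨
    (u j - v i) * sumL term (kernel ps)                                      ≈⟨ *-congˡ (kernel-factors u v ps) ⟩
    (u j - v i) * factors u v ps                                             ∎
    where
    term : Term → Carrier
    term (b , r , c) = evalMon u b * (κ r * evalMon v c)
    f g : Term → Term
    f (b , r , c) = j ∷ b , r , c
    g (b , r , c) = b , R.- r , i ∷ c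
    negated : ∀ b r c → term (g (b , r , c)) ≈ - v i * term (b , r , c)
    negated b r c = begin
      evalMon u b * (κ (R.- r) * (v i * evalMon v c))       ≈⟨ *-congˡ (*-congʳ (κ-neg r)) ⟩
      evalMon u b * (- κ r * (v i * evalMon v c))           ≈⟨ *-congˡ (≈-sym (-‿distribˡ-* _ _)) ⟩
      evalMon u b * - (κ r * (v i * evalMon v c))           ≈⟨ -‿distribʳ-* _ _ ⟨
      - (evalMon u b * (κ r * (v i * evalMon v c)))         ≈⟨ -‿cong (solve 4 (λ a k w e → a :* (k :* (w :* e)) := w :* (a :* (k :* e))) ≈-refl (evalMon u b) (κ r) (v i) (evalMon v c)) ⟩
      - (v i * term (b , r , c))                            ≈⟨ -‿distribˡ-* _ _ ⟩
      - v i * term (b , r , c)                              ∎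

  kernel-length : ∀ ps → All (λ (b , _ , c) → length b ℕ.+ length c ≡ length ps) (kernel ps)
  kernel-length []             = refl ∷ []
  kernel-length ((j , i) ∷ ps) = Allₚ.++⁺
    (Allₚ.map⁺ (All.map (cong suc) (kernel-length ps)))
    (Allₚ.map⁺ (All.map (λ {(b , _ , c)} eq → ≡.trans (ℕₚ.+-suc (length b) (length c)) (cong suc eq)) (kernel-length ps)))

  -- The first term takes the left variable in every factor and is the only one whose left part
  -- reaches full degree. `quotient≈1` rests on this.
  kernel-head : ∀ ps → ∃ λ ts → kernel ps ≡ (map proj₁ ps , R.1# , []) ∷ ts × All (λ (b , _ , _) → length b ℕ.< length ps) ts
  kernel-head []             = [] , refl , []
  kernel-head ((j , i) ∷ ps) with kernel-head ps
  ... | ts , eq , ts< rewrite eq = _ , refl , Allₚ.++⁺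
    (Allₚ.map⁺ (All.map s≤s ts<))
    (s≤s (ℕₚ.≤-reflexive (length-map proj₁ ps)) ∷ Allₚ.map⁺ (All.map ℕₚ.m≤n⇒m≤1+n ts<))

  factors-zero : ∀ u v {j i} ps → (j , i) ∈ ps → u j ≈ v i → factors u v ps ≈ 0#
  factors-zero u v (_ ∷ ps) (here refl) uj≈vi =
    ≈-trans (*-congʳ (≈-trans (+-congʳ uj≈vi) (-‿inverseʳ _))) (zeroˡ _)
  factors-zero u v (_ ∷ ps) (there ji∈) uj≈vi =
    ≈-trans (*-congˡ (factors-zero u v ps ji∈ uj≈vi)) (zeroʳ _)

  terms : List Term
  terms = kernel (before all)

  degree : ℕ
  degree = length (before all)

  vandermonde : Carrier
  vandermonde = factors var var (before all)

  -- Some `x` has its image later in the list, and the factor for this pair is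
  -- `var (to τ x) - var (to τ x)`.
  factors-moved : ∀ (τ : Perm) z → to τ z ≢ z → factors (var ∘ to τ) var (before all) ≈ 0#
  factors-moved τ z moved with moved-forward _≟_ all all-unique τ (λ z z∉ → contradiction (all-complete z) z∉) moved
  ... | x , x∈ = factors-zero-at (before all) x∈
    where
    factors-zero-at : ∀ ps → (x , to τ x) ∈ ps → factors (var ∘ to τ) var ps ≈ 0#
    factors-zero-at ps x∈ = factors-zero (var ∘ to τ) var ps x∈ ≈-refl

  regular-* : ∀ {p q} → Regular p → Regular q → Regular (p * q)
  regular-* p-reg q-reg s eq = q-reg s (p-reg _ (≈-trans (≈-sym (*-assoc _ _ _)) eq))

  vandermonde-regular : Regular vandermonde
  vandermonde-regular = go (before all) (before-≢ all-unique)
    where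
    go : ∀ ps → (∀ {i j} → (i , j) ∈ ps → i ≢ j) → Regular (factors var var ps)
    go []             _    q eq = ≈-trans (≈-sym (*-identityˡ q)) eq
    go ((i , j) ∷ ps) i≢j = regular-* (var-regular (i≢j (here refl))) (go ps (i≢j ∘ there))

  -- Applying τ to the left tensor factor of the kernel gives a product which
  -- vanishes unless τ is the identity.
  kernel-expansion : ∀ f → sumL (λ (b , r , c) → antisym (mon b * f) * (κ r * mon c)) terms ≈ vandermonde * f
  kernel-expansion f = begin
    sumL (λ (b , r , c) → antisym (mon b * f) * (κ r * mon c)) terms
      ≈⟨ sumL-cong terms (λ (b , r , c) → ≈-trans (*-comm _ _) (≈-trans (≈-sym (symSum-*ˡ (κ r * mon c) all _))
           (symSum-cong all λ τ → rearrange τ b r c))) ⟩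
    sumL (λ (b , r , c) → symSum all (λ τ → act (to τ) f * (evalMon (var ∘ to τ) b * (κ r * mon c)))) terms
      ≈⟨ symSum-sumL all _ terms ⟨
    symSum all (λ τ → sumL (λ (b , r , c) → act (to τ) f * (evalMon (var ∘ to τ) b * (κ r * mon c))) terms)
      ≈⟨ symSum-cong all (λ τ → ≈-trans (sumL-*ˡ (act (to τ) f) _ terms) (*-congˡ (kernel-factors (var ∘ to τ) var (before all)))) ⟩
    symSum all (λ τ → act (to τ) f * factors (var ∘ to τ) var (before all))
      ≈⟨ symSum-identity all all-unique (λ τ z moved → ≈-trans (*-congˡ (factors-moved τ z moved)) (zeroʳ _)) ⟩
    act id f * vandermonde
      ≈⟨ ≈-trans (*-congʳ (act-id f)) (*-comm _ _) ⟩
    vandermonde * f ∎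
    where
    rearrange : ∀ (τ : Perm) b r c →
                (κ r * mon c) * act (to τ) (mon b * f) ≈ act (to τ) f * (evalMon (var ∘ to τ) b * (κ r * mon c))
    rearrange τ b r c = begin
      (κ r * mon c) * act (to τ) (mon b * f)                      ≈⟨ *-congˡ (≈-trans (act-* (to τ) _ _) (*-congʳ (act-mon (to τ) b))) ⟩
      (κ r * mon c) * (evalMon (var ∘ to τ) b * act (to τ) f)     ≈⟨ solve 3 (λ k e a → k :* (e :* a) := a :* (e :* k)) ≈-refl (κ r * mon c) (evalMon (var ∘ to τ) b) (act (to τ) f) ⟩
      act (to τ) f * (evalMon (var ∘ to τ) b * (κ r * mon c))     ∎

  -- Elementary symmetric functions, and Artin's reduction of powers modulo them

  e : ℕ → List X → Carrier
  e zero    xs       = 1#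
  e (suc k) []       = 0#
  e (suc k) (x ∷ xs) = var x * e k xs + e (suc k) xs

  e-vanish : ∀ {k} xs → length xs ℕ.< k → e k xs ≈ 0#
  e-vanish {suc k} []       _           = ≈-refl
  e-vanish {suc k} (x ∷ xs) (s≤s ∣xs∣<k) =
    ≈-trans (+-cong (≈-trans (*-congˡ (e-vanish xs ∣xs∣<k)) (zeroʳ _)) (e-vanish xs (ℕₚ.m≤n⇒m≤1+n ∣xs∣<k))) (+-identityʳ 0#)

  e-↭ : ∀ k {xs ys} → xs ↭ ys → e k xs ≈ e k ys
  e-↭ zero    _             = ≈-refl
  e-↭ (suc k) ↭.refl        = ≈-refl
  e-↭ (suc k) (prep x p)    = +-cong (*-congˡ (e-↭ k p)) (e-↭ (suc k) p)
  e-↭ (suc k) (↭.trans p q) = ≈-trans (e-↭ (suc k) p) (e-↭ (suc k) q)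
  e-↭ (suc zero) (swap {xs = xs} x y p) = ≈-trans
    (solve 3 (λ a b s → a :+ (b :+ s) := b :+ (a :+ s)) ≈-refl (var x * 1#) (var y * 1#) (e 1 xs))
    (+-congˡ (+-congˡ (e-↭ 1 p)))
  e-↭ (suc (suc k)) (swap {xs = xs} x y p) = ≈-trans
    (solve 5 (λ a b s t u → a :* (b :* s :+ t) :+ (b :* t :+ u) := b :* (a :* s :+ t) :+ (a :* t :+ u)) ≈-refl
      (var x) (var y) (e k xs) (e (suc k) xs) (e (suc (suc k)) xs))
    (+-cong (*-congˡ (+-cong (*-congˡ (e-↭ k p)) (e-↭ (suc k) p))) (+-cong (*-congˡ (e-↭ (suc k) p)) (e-↭ (suc (suc k)) p)))

  act-e : ∀ f k xs → act f (e k xs) ≈ e k (map f xs)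
  act-e f zero    xs       = act-1 f
  act-e f (suc k) []       = act-0 f
  act-e f (suc k) (x ∷ xs) = ≈-trans (act-+ f _ _)
    (+-cong (≈-trans (act-* f _ _) (*-cong (act-var f x) (act-e f k xs))) (act-e f (suc k) xs))

  map-all-↭ : ∀ (τ : Perm) → map (to τ) all ↭ all
  map-all-↭ τ = unique-⊆-↭ (Uniqueₚ.map⁺ (to-injective τ) all-unique) all-unique
    (λ _ → all-complete _)
    (λ {z} _ → subst (_∈ map (to τ) all) (Inverse.strictlyInverseˡ τ z) (∈-map⁺ (to τ) (all-complete (from τ z))))

  e-invariant : ∀ k → Invariant (e k all)
  e-invariant k τ = ≈-trans (act-e (to τ) k all) (e-↭ k (map-all-↭ τ))

  Symmetric : Carrier → Set (c ⊔ ℓ)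
  Symmetric = Generated (λ p → ∃ λ k → p ≈ e k all)

  -- Classically the ring of invariants of the permutations of the variables outside `xs`. It is
  -- given by generators so that Artin's reduction can recurse on membership.
  PartlySymmetric : List X → Carrier → Set (c ⊔ ℓ)
  PartlySymmetric xs = Generated (λ p → (∃ λ k → p ≈ e k all) ⊎ (∃ λ x → x ∈ xs × p ≈ var x))

  generated-map : ∀ {g h} {G : Carrier → Set g} {H : Carrier → Set h} →
                  (∀ {p} → G p → Generated H p) → ∀ {p} → Generated G p → Generated H p
  generated-map G⇒H (gen g)     = G⇒H g
  generated-map G⇒H (con r)     = con r
  generated-map G⇒H (g ⊕ h)     = generated-map G⇒H g ⊕ generated-map G⇒H h
  generated-map G⇒H (g ⊗ h)     = generated-map G⇒H g ⊗ generated-map G⇒H h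
  generated-map G⇒H (resp eq g) = resp eq (generated-map G⇒H g)

  generated-0 : ∀ {g} {G : Carrier → Set g} → Generated G 0#
  generated-0 = resp κ-0 (con R.0#)

  generated-1 : ∀ {g} {G : Carrier → Set g} → Generated G 1#
  generated-1 = resp κ-1 (con R.1#)

  generated-neg : ∀ {g} {G : Carrier → Set g} {p} → Generated G p → Generated G (- p)
  generated-neg g = resp (≈-trans (*-congʳ (≈-trans (κ-neg R.1#) (-‿cong κ-1))) (-1*x≈-x _)) (con (R.- R.1#) ⊗ g)

  symmetric-invariant : ∀ {p} → Symmetric p → Invariant p
  symmetric-invariant (gen (k , p≈e)) τ = ≈-trans (act-cong (to τ) p≈e) (≈-trans (e-invariant k τ) (≈-sym p≈e))
  symmetric-invariant (con r)         τ = act-κ (to τ) r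
  symmetric-invariant (g ⊕ h)         τ = ≈-trans (act-+ (to τ) _ _) (+-cong (symmetric-invariant g τ) (symmetric-invariant h τ))
  symmetric-invariant (g ⊗ h)         τ = ≈-trans (act-* (to τ) _ _) (*-cong (symmetric-invariant g τ) (symmetric-invariant h τ))
  symmetric-invariant (resp eq g)     τ = ≈-trans (act-cong (to τ) (≈-sym eq)) (≈-trans (symmetric-invariant g τ) eq)

  partlySymmetric-fixed : ∀ {xs x y p} → x ∉ xs → y ∉ xs → PartlySymmetric xs p → act (swapTo x y) p ≈ p
  partlySymmetric-fixed {xs} {x} {y} x∉ y∉ (gen (inj₁ k)) = symmetric-invariant (gen k) (swapPerm x y)
  partlySymmetric-fixed {xs} {x} {y} x∉ y∉ (gen (inj₂ (z , z∈xs , p≈z))) =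
    ≈-trans (act-cong _ p≈z) (≈-trans (act-var _ z)
      (≈-trans (reflexive (cong var (swapTo-z (λ z≡x → x∉ (subst (_∈ xs) z≡x z∈xs)) (λ z≡y → y∉ (subst (_∈ xs) z≡y z∈xs))))) (≈-sym p≈z)))
  partlySymmetric-fixed x∉ y∉ (con r)     = act-κ _ r
  partlySymmetric-fixed x∉ y∉ (g ⊕ h)     = ≈-trans (act-+ _ _ _) (+-cong (partlySymmetric-fixed x∉ y∉ g) (partlySymmetric-fixed x∉ y∉ h))
  partlySymmetric-fixed x∉ y∉ (g ⊗ h)     = ≈-trans (act-* _ _ _) (*-cong (partlySymmetric-fixed x∉ y∉ g) (partlySymmetric-fixed x∉ y∉ h))
  partlySymmetric-fixed x∉ y∉ (resp eq g) = ≈-trans (act-cong _ (≈-sym eq)) (≈-trans (partlySymmetric-fixed x∉ y∉ g) eq)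

  partlySymmetric-weaken : ∀ {x xs p} → PartlySymmetric xs p → PartlySymmetric (x ∷ xs) p
  partlySymmetric-weaken = generated-map λ where
    (inj₁ k)              → gen (inj₁ k)
    (inj₂ (z , z∈ , p≈z)) → gen (inj₂ (z , there z∈ , p≈z))

  -- The recursion of `e` on `x ∷ suf` is solved for its last summand. With the reversed append,
  -- moving `x` from the suffix to the prefix holds by definition.
  partlySymmetric-e : ∀ pre {suf} → pre ʳ++ suf ≡ all → ∀ k → PartlySymmetric pre (e k suf)
  partlySymmetric-e []        eq k       = gen (inj₁ (k , reflexive (cong (e k) eq)))
  partlySymmetric-e (x ∷ pre) eq zero    = generated-1
  partlySymmetric-e (x ∷ pre) {suf} eq (suc k) = resp difference
    (partlySymmetric-weaken (partlySymmetric-e pre eq (suc k)) ⊕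
      generated-neg (gen (inj₂ (x , here refl , ≈-refl)) ⊗ partlySymmetric-e (x ∷ pre) eq k))
    where
    difference : (var x * e k suf + e (suc k) suf) - var x * e k suf ≈ e (suc k) suf
    difference = ≈-trans (+-assoc _ _ _) (≈-trans (+-comm _ _) (≈-trans (+-assoc _ _ _)
      (≈-trans (+-congˡ (-‿inverseˡ _)) (+-identityʳ _))))

  power : X → ℕ → Carrier
  power x k = mon (replicate k x)

  -- Presentations as a polynomial in `x` of degree at most the index, with coefficients in
  -- `PartlySymmetric pre`, leading term first.
  data DegreeInAtMost (pre : List X) (x : X) : ℕ → Carrier → Set (c ⊔ ℓ) where
    base : ∀ {p} → PartlySymmetric pre p → DegreeInAtMost pre x 0 p
    step : ∀ {d p q s} → PartlySymmetric pre p → DegreeInAtMost pre x d q →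
           s ≈ power x (suc d) * p + q → DegreeInAtMost pre x (suc d) s

  module _ {pre : List X} {x : X} where

    private
      Low : ℕ → Carrier → Set (c ⊔ ℓ)
      Low = DegreeInAtMost pre x

    low-resp : ∀ {d p q} → p ≈ q → Low d p → Low d q
    low-resp p≈q (base b)      = base (resp p≈q b)
    low-resp p≈q (step b l eq) = step b l (≈-trans (≈-sym p≈q) eq)

    low-suc : ∀ {d p} → Low d p → Low (suc d) p
    low-suc l = step generated-0 l (≈-sym (≈-trans (+-congʳ (zeroʳ _)) (+-identityˡ _)))

    low-partlySymmetric : ∀ d {p} → PartlySymmetric pre p → Low d p
    low-partlySymmetric zero    b = base b
    low-partlySymmetric (suc d) b = low-suc (low-partlySymmetric d b)

    low-+ : ∀ {d p q} → Low d p → Low d q → Low d (p + q)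
    low-+ (base b)      (base b′)       = base (b ⊕ b′)
    low-+ (step b l eq) (step b′ l′ eq′) = step (b ⊕ b′) (low-+ l l′) (≈-trans (+-cong eq eq′)
      (solve 5 (λ w p q p′ q′ → (w :* p :+ q) :+ (w :* p′ :+ q′) := w :* (p :+ p′) :+ (q :+ q′)) ≈-refl _ _ _ _ _))

    low-*ˡ : ∀ {d p q} → PartlySymmetric pre p → Low d q → Low d (p * q)
    low-*ˡ a (base b)      = base (a ⊗ b)
    low-*ˡ a (step b l eq) = step (a ⊗ b) (low-*ˡ a l) (≈-trans (*-congˡ eq)
      (solve 4 (λ s w p q → s :* (w :* p :+ q) := w :* (s :* p) :+ s :* q) ≈-refl _ _ _ _))

    low-var : ∀ {d p} → Low d p → Low (suc d) (var x * p)
    low-var (base b) = step b (base generated-0) (≈-trans (*-congʳ (≈-sym (*-identityʳ _))) (≈-sym (+-identityʳ _)))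
    low-var (step b l eq) = step b (low-var l) (≈-trans (*-congˡ eq)
      (≈-trans (distribˡ _ _ _) (+-congʳ (≈-sym (*-assoc _ _ _)))))

  sign : ℕ → R.Carrier
  sign zero    = R.1#
  sign (suc k) = R.- sign k

  κ-sign-square : ∀ k → κ (sign k) * κ (sign k) ≈ 1#
  κ-sign-square zero    = ≈-trans (*-cong κ-1 κ-1) (*-identityˡ 1#)
  κ-sign-square (suc k) = begin
    κ (R.- sign k) * κ (R.- sign k)     ≈⟨ *-cong (κ-neg _) (κ-neg _) ⟩
    - κ (sign k) * - κ (sign k)         ≈⟨ -‿distribˡ-* _ _ ⟨
    - (κ (sign k) * - κ (sign k))       ≈⟨ -‿cong (≈-sym (-‿distribʳ-* _ _)) ⟩
    - - (κ (sign k) * κ (sign k))       ≈⟨ -‿involutive _ ⟩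
    κ (sign k) * κ (sign k)             ≈⟨ κ-sign-square k ⟩
    1#                                  ∎

  module _ (pre : List X) (x : X) (suf : List X) (split : pre ʳ++ (x ∷ suf) ≡ all) where

    private
      Low : ℕ → Carrier → Set (c ⊔ ℓ)
      Low = DegreeInAtMost pre x

    -- From e 1 suf = e 1 (x ∷ suf) - x on, each step e (k + 2) suf = e (k + 2) (x ∷ suf) - x · e (k
    -- + 1) suf raises the degree in `x` by one and flips the leading sign.
    e-leading : ∀ k → ∃ λ h → Low k h × e (suc k) suf ≈ h + κ (sign (suc k)) * power x (suc k)
    e-leading zero = e 1 (x ∷ suf) , base (partlySymmetric-e pre split 1) , ≈-sym (begin
      (var x * 1# + e 1 suf) + κ (R.- R.1#) * (var x * 1#)  ≈⟨ +-congˡ (≈-trans (*-congʳ (≈-trans (κ-neg R.1#) (-‿cong κ-1))) (-1*x≈-x _)) ⟩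
      (var x * 1# + e 1 suf) - var x * 1#                   ≈⟨ +-congʳ (+-comm _ _) ⟩
      (e 1 suf + var x * 1#) - var x * 1#                   ≈⟨ +-assoc _ _ _ ⟩
      e 1 suf + (var x * 1# - var x * 1#)                   ≈⟨ +-congˡ (-‿inverseʳ _) ⟩
      e 1 suf + 0#                                          ≈⟨ +-identityʳ _ ⟩
      e 1 suf                                               ∎)
    e-leading (suc k) with e-leading k
    ... | h , low-h , eq = e (suc (suc k)) (x ∷ suf) + κ (R.- R.1#) * (var x * h) ,
      low-+ (low-partlySymmetric (suc k) (partlySymmetric-e pre split (suc (suc k)))) (low-*ˡ (con (R.- R.1#)) (low-var low-h)) ,
      ≈-sym (begin
        (var x * e (suc k) suf + E + κ (R.- R.1#) * (var x * h)) + κ (R.- sign (suc k)) * (var x * w)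
          ≈⟨ +-cong (+-congˡ (≈-trans (*-congʳ (≈-trans (κ-neg R.1#) (-‿cong κ-1))) (-1*x≈-x _)))
               (≈-trans (*-congʳ (κ-neg _)) (≈-sym (-‿distribˡ-* _ _))) ⟩
        (var x * e (suc k) suf + E - var x * h) - κ (sign (suc k)) * (var x * w)
          ≈⟨ +-assoc _ _ _ ⟩
        (var x * e (suc k) suf + E) + (- (var x * h) - κ (sign (suc k)) * (var x * w))
          ≈⟨ +-cong (+-comm _ _) (-‿+-comm _ _) ⟩
        (E + var x * e (suc k) suf) - (var x * h + κ (sign (suc k)) * (var x * w))
          ≈⟨ +-congˡ (-‿cong (≈-trans (+-congˡ (x∙yz≈y∙xz _ _ _)) (≈-trans (≈-sym (distribˡ _ _ _)) (*-congˡ (≈-sym eq))))) ⟩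
        (E + var x * e (suc k) suf) - var x * e (suc k) suf
          ≈⟨ ≈-trans (+-assoc _ _ _) (≈-trans (+-congˡ (-‿inverseʳ _)) (+-identityʳ _)) ⟩
        E ∎)
      where
      E w : Carrier
      E = e (suc (suc k)) suf
      w = power x (suc k)

    -- The elementary symmetric function of index `suc (length suf)` vanishes on `suf`, so that
    -- `e-leading` becomes an equation for `x` which is monic up to sign.
    low-power : Low (length suf) (power x (suc (length suf)))
    low-power with e-leading (length suf)
    ... | h , low-h , eq = low-resp power≈ (low-*ˡ (con (sign r)) (low-*ˡ (con (R.- R.1#)) low-h))
      where
      r : ℕ
      r = suc (length suf)
      power≈ : κ (sign r) * (κ (R.- R.1#) * h) ≈ power x r
      power≈ = begin
        κ (sign r) * (κ (R.- R.1#) * h)             ≈⟨ *-congˡ (≈-trans (*-congʳ (≈-trans (κ-neg R.1#) (-‿cong κ-1))) (-1*x≈-x _)) ⟩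
        κ (sign r) * - h                            ≈⟨ *-congˡ (+-inverseʳ-unique h _ (≈-trans (≈-sym eq) (e-vanish suf ℕₚ.≤-refl))) ⟨
        κ (sign r) * (κ (sign r) * power x r)       ≈⟨ *-assoc _ _ _ ⟨
        κ (sign r) * κ (sign r) * power x r         ≈⟨ *-congʳ (κ-sign-square r) ⟩
        1# * power x r                              ≈⟨ *-identityˡ _ ⟩
        power x r                                   ∎

    low-reduce : ∀ {p} → Low (suc (length suf)) p → Low (length suf) p
    low-reduce (step b l eq) = low-resp (≈-sym (≈-trans eq (+-congʳ (*-comm _ _)))) (low-+ (low-*ˡ b low-power) l)

    low-closed : ∀ {p q} → PartlySymmetric (x ∷ pre) p → Low (length suf) q → Low (length suf) (p * q)
    low-closed (gen (inj₁ k)) l = low-*ˡ (gen (inj₁ k)) l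
    low-closed (gen (inj₂ (_ , here refl , p≈x))) l = low-resp (*-congʳ (≈-sym p≈x)) (low-reduce (low-var l))
    low-closed (gen (inj₂ (z , there z∈ , p≈z))) l = low-*ˡ (gen (inj₂ (z , z∈ , p≈z))) l
    low-closed (con r)     l = low-*ˡ (con r) l
    low-closed (g ⊕ h)     l = low-resp (≈-sym (distribʳ _ _ _)) (low-+ (low-closed g l) (low-closed h l))
    low-closed (g ⊗ h)     l = low-resp (≈-sym (*-assoc _ _ _)) (low-closed g (low-closed h l))
    low-closed (resp eq g) l = low-resp (*-congʳ eq) (low-closed g l)

    -- A root x of the monic polynomial of degree suc (length suf) whose
    -- coefficients are partly symmetric needs only that many powers.
    low-all : ∀ {p} → PartlySymmetric (x ∷ pre) p → Low (length suf) p
    low-all g = low-resp (*-identityʳ _) (low-closed g (low-partlySymmetric (length suf) generated-1))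

  -- The exponents in the staircase of `xs` run through all numbers below `length xs`, so some `y`
  -- shares the exponent `k` with `x`, and exchanging the two fixes the monomial.
  staircase-swap : ∀ {x} xs {k} → x ∉ xs → Unique xs → k ℕ.< length xs →
                   ∃ λ y → y ∈ xs × map (swapTo x y) (replicate k x ++ staircase xs) ↭ replicate k x ++ staircase xs
  staircase-swap {x} (y ∷ ys) {k} x∉ u k<1+∣ys∣ with k ℕₚ.≟ length ys
  ... | yes refl = y , here refl ,
      ↭-trans (↭-reflexive swapped) (↭-trans (↭-reflexive (≡.sym (++-assoc y^k x^k (staircase ys))))
        (↭-trans (↭ₚ.++⁺ʳ (staircase ys) (↭ₚ.++-comm y^k x^k)) (↭-reflexive (++-assoc x^k y^k (staircase ys)))))
    where
    x^k y^k : List X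
    x^k = replicate (length ys) x
    y^k = replicate (length ys) y
    swapped : map (swapTo x y) (x^k ++ y^k ++ staircase ys) ≡ y^k ++ x^k ++ staircase ys
    swapped = ≡.trans (map-++ _ x^k _) (cong₂ _++_ (≡.trans (map-replicate _ (length ys) x) (cong (replicate (length ys)) (swapTo-x x y)))
      (≡.trans (map-++ _ y^k _) (cong₂ _++_ (≡.trans (map-replicate _ (length ys) y) (cong (replicate (length ys)) (swapTo-y x y)))
        (map-swapTo-∉ (staircase ys) (x∉ ∘ there ∘ staircase-∈ ys) (unique-∉ u ∘ staircase-∈ ys)))))
      where
      replicate-∈ : ∀ {z w : X} n → z ∈ replicate n w → z ≡ w
      replicate-∈ (suc n) (here z≡w) = z≡w
      replicate-∈ (suc n) (there z∈) = replicate-∈ n z∈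
      staircase-∈ : ∀ zs {z} → z ∈ staircase zs → z ∈ zs
      staircase-∈ (w ∷ zs) z∈ with ∈-++⁻ (replicate (length zs) w) z∈
      ... | inj₁ z∈w  = here (replicate-∈ (length zs) z∈w)
      ... | inj₂ z∈zs = there (staircase-∈ zs z∈zs)
  ... | no k≢∣ys∣ with staircase-swap ys {k} (x∉ ∘ there) (unique-tail u) (ℕₚ.≤∧≢⇒< (ℕₚ.≤-pred k<1+∣ys∣) k≢∣ys∣)
  ...   | z , z∈ys , fixed = z , there z∈ys ,
      ↭-trans (↭ₚ.map⁺ (swapTo x z) (shuffle x^k y^r (staircase ys)))
        (↭-trans (↭-reflexive (map-++ _ y^r _))
          (↭-trans (↭ₚ.++⁺ (↭-reflexive (≡.trans (map-replicate _ (length ys) y) (cong (replicate (length ys)) y-fixed))) fixed)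
            (↭-sym (shuffle x^k y^r (staircase ys)))))
    where
    x^k y^r : List X
    x^k = replicate k x
    y^r = replicate (length ys) y
    y-fixed : swapTo x z y ≡ y
    y-fixed = swapTo-z (λ y≡x → x∉ (here (≡.sym y≡x))) (λ y≡z → unique-∉ u (subst (_∈ ys) (≡.sym y≡z) z∈ys))
    shuffle : ∀ as bs cs → as ++ bs ++ cs ↭ bs ++ as ++ cs
    shuffle as bs cs = ↭-trans (↭-reflexive (≡.sym (++-assoc as bs cs)))
      (↭-trans (↭ₚ.++⁺ʳ cs (↭ₚ.++-comm as bs)) (↭-reflexive (++-assoc bs as cs)))

  alternant : Carrier
  alternant = antisym (mon (staircase all))

  Divisible : Carrier → Set (c ⊔ ℓ)
  Divisible f = ∃ λ s → Symmetric s × antisym f ≈ alternant * s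

  divisible-resp : ∀ {f g} → f ≈ g → Divisible f → Divisible g
  divisible-resp f≈g (s , s-sym , eq) = s , s-sym , ≈-trans (antisym-cong (≈-sym f≈g)) eq

  divisible-+ : ∀ {f g} → Divisible f → Divisible g → Divisible (f + g)
  divisible-+ (s , s-sym , eq) (s′ , s′-sym , eq′) =
    s + s′ , s-sym ⊕ s′-sym , ≈-trans (antisym-+ _ _) (≈-trans (+-cong eq eq′) (≈-sym (distribˡ _ _ _)))

  -- Induction on the variables not yet reduced. A power of `x` below `length suf` repeats an
  -- exponent of the staircase and antisymmetrizes to 0; the power `length suf` extends the
  -- staircase by `x`. Once `pre` is empty, `g` is symmetric and can be pulled out of the alternant.
  staircase-divisible : ∀ pre suf → pre ʳ++ suf ≡ all → ∀ {g} → PartlySymmetric pre g → Divisible (mon (staircase suf) * g)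
  staircase-divisible [] suf refl {g} g-sym = g , symmetric , ≈-trans (antisym-cong (*-comm _ _))
      (≈-trans (antisym-*ˡ _ (symmetric-invariant symmetric)) (*-comm _ _))
    where
    symmetric : Symmetric g
    symmetric = generated-map (λ { (inj₁ k) → gen k }) g-sym
  staircase-divisible (x ∷ pre) suf split {g} g-sym = low-divisible (length suf) ℕₚ.≤-refl (low-all pre x suf split g-sym)
    where
    split-unique : Unique (x ∷ suf)
    split-unique = unique-suffix (reverse pre) (subst Unique (≡.trans (≡.sym split) (ʳ++-defn pre)) all-unique)
      where
      unique-suffix : ∀ xs {ys} → Unique (xs ++ ys) → Unique ys
      unique-suffix []       u = u
      unique-suffix (_ ∷ xs) u = unique-suffix xs (unique-tail u)

    disjoint : ∀ {y} → y ∈ x ∷ suf → y ∉ pre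
    disjoint {y} y∈ y∈pre = separate (reverse pre) (subst Unique (≡.trans (≡.sym split) (ʳ++-defn pre)) all-unique)
      (↭ₚ.∈-resp-↭ (↭-sym (↭ₚ.↭-reverse pre)) y∈pre) y∈
      where
      separate : ∀ xs {ys} → Unique (xs ++ ys) → y ∈ xs → y ∉ ys
      separate (_ ∷ xs) u (here refl)  y∈ys = unique-∉ u (∈-++⁺ʳ xs y∈ys)
      separate (_ ∷ xs) u (there y∈xs) y∈ys = separate xs (unique-tail u) y∈xs y∈ys

    power-divisible : ∀ k → k ℕ.≤ length suf → ∀ {p} → PartlySymmetric pre p →
                      Divisible (mon (staircase suf) * (power x k * p))
    power-divisible k k≤r {p} p-sym with k ℕₚ.≟ length suf
    ... | yes refl = divisible-resp
      (≈-trans (*-congʳ (≈-trans (mon-++ (replicate (length suf) x) _) (*-comm _ _))) (*-assoc _ _ _))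
      (staircase-divisible pre (x ∷ suf) split p-sym)
    ... | no k≢r with staircase-swap suf (unique-∉ split-unique) (unique-tail split-unique) (ℕₚ.≤∧≢⇒< k≤r k≢r)
    ...   | y , y∈suf , fixed = 0# , generated-0 , ≈-trans (antisym-fixed _ x≢y invariant) (≈-sym (zeroʳ _))
      where
      x≢y : x ≢ y
      x≢y x≡y = unique-∉ split-unique (subst (_∈ suf) (≡.sym x≡y) y∈suf)
      merge : mon (staircase suf) * (power x k * p) ≈ mon (replicate k x ++ staircase suf) * p
      merge = ≈-trans (≈-sym (*-assoc _ _ _)) (*-congʳ (≈-trans (*-comm _ _) (≈-sym (mon-++ (replicate k x) _))))
      invariant : act (swapTo x y) (mon (staircase suf) * (power x k * p)) ≈ mon (staircase suf) * (power x k * p)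
      invariant = ≈-trans (act-cong _ merge) (≈-trans (act-* _ _ _) (≈-trans
        (*-cong (≈-trans (act-mon-map _ (replicate k x ++ staircase suf)) (mon-↭ fixed)) (partlySymmetric-fixed (disjoint (here refl)) (disjoint (there y∈suf)) p-sym))
        (≈-sym merge)))

    low-divisible : ∀ d → d ℕ.≤ length suf → ∀ {p} → DegreeInAtMost pre x d p → Divisible (mon (staircase suf) * p)
    low-divisible zero    _   (base b)      = divisible-resp (*-congˡ (*-identityˡ _)) (power-divisible 0 z≤n b)
    low-divisible (suc d) d<r (step b l eq) = divisible-resp
      (≈-trans (≈-sym (distribˡ _ _ _)) (*-congˡ (≈-sym eq)))
      (divisible-+ (power-divisible (suc d) d<r b) (low-divisible d (ℕₚ.<⇒≤ d<r) l))

  abstract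
    divisible : ∀ f → Divisible f
    divisible f = divisible-resp (*-identityˡ f)
      (staircase-divisible (reverse all) [] (reverse-involutive all) (generated-map variable-in (generated f)))
      where
      variable-in : ∀ {p} → (∃ λ x → p ≈ var x) → PartlySymmetric (reverse all) p
      variable-in (x , p≈x) = gen (inj₂ (x , ↭ₚ.∈-resp-↭ (↭-sym (↭ₚ.↭-reverse all)) (all-complete x) , p≈x))

  -- The quotient of the antisymmetrization by the Vandermonde product: the
  -- symmetrizing trace of the ring over its symmetric elements.
  trace : Carrier → Carrier
  trace f = proj₁ (divisible f)

  trace-symmetric : ∀ f → Symmetric (trace f)
  trace-symmetric f = proj₁ (proj₂ (divisible f))

  private
    antisym≈ : ∀ f → antisym f ≈ alternant * trace f
    antisym≈ f = proj₂ (proj₂ (divisible f))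

    quotient : Carrier
    quotient = sumL (λ (b , r , c) → trace (mon b * 1#) * (κ r * mon c)) terms

    expand : ∀ f → alternant * sumL (λ (b , r , c) → trace (mon b * f) * (κ r * mon c)) terms ≈ vandermonde * f
    expand f = begin
      alternant * sumL (λ (b , r , c) → trace (mon b * f) * (κ r * mon c)) terms          ≈⟨ sumL-*ˡ alternant _ terms ⟨
      sumL (λ (b , r , c) → alternant * (trace (mon b * f) * (κ r * mon c))) terms        ≈⟨ sumL-cong terms (λ (b , r , c) → ≈-trans (≈-sym (*-assoc _ _ _)) (*-congʳ (≈-sym (antisym≈ _)))) ⟩
      sumL (λ (b , r , c) → antisym (mon b * f) * (κ r * mon c)) terms                    ≈⟨ kernel-expansion f ⟩
      vandermonde * f                                                                     ∎

    -- By `expand` at 1 the alternant divides the Vandermonde product, all of whose factors are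
    -- regular.
    alternant-regular : Regular alternant
    alternant-regular p eq = vandermonde-regular p (begin
      vandermonde * p                  ≈⟨ *-congʳ (≈-trans (≈-sym (*-identityʳ _)) (≈-sym (expand 1#))) ⟩
      alternant * quotient * p         ≈⟨ solve 3 (λ a q s → a :* q :* s := q :* (a :* s)) ≈-refl alternant quotient p ⟩
      quotient * (alternant * p)       ≈⟨ *-congˡ eq ⟩
      quotient * 0#                    ≈⟨ zeroʳ _ ⟩
      0#                               ∎)

    cancel : ∀ {p q} → alternant * p ≈ alternant * q → p ≈ q
    cancel {p} {q} eq = x∙y⁻¹≈ε⇒x≈y p q (alternant-regular (p - q) (begin
      alternant * (p - q)              ≈⟨ distribˡ _ _ _ ⟩
      alternant * p + alternant * - q  ≈⟨ +-cong eq (≈-sym (-‿distribʳ-* _ _)) ⟩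
      alternant * q - alternant * q    ≈⟨ -‿inverseʳ _ ⟩
      0#                               ∎))

    length-staircase : length (staircase all) ≡ degree
    length-staircase = ≡.trans (cong length (≡.sym (proj₁-before all))) (length-map proj₁ (before all))

    Hom-alternant : Hom degree alternant
    Hom-alternant = subst (λ d → Hom d alternant) length-staircase (Hom-antisym (Hom-mon (staircase all)))

    Hom-product : ∀ {d f} → Hom d f → Hom d (alternant * trace f)
    Hom-product {f = f} hom = Hom-resp (antisym≈ f) (Hom-antisym hom)

  trace-low : ∀ {d f} → Hom d f → d ℕ.< degree → trace f ≈ 0#
  trace-low hom d<D = Hom-cancel alternant-regular Hom-alternant (Hom-product hom) d<D

  trace-const : ∀ {d f} → Hom d f → d ≢ degree → const-coeff (trace f) R.≈ R.0#
  trace-const hom d≢D = Hom-cancel-const alternant-regular Hom-alternant (Hom-product hom) d≢D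

  trace-cong : ∀ {f g} → f ≈ g → trace f ≈ trace g
  trace-cong f≈g = cancel (≈-trans (≈-sym (antisym≈ _)) (≈-trans (antisym-cong f≈g) (antisym≈ _)))

  trace-+ : ∀ f g → trace (f + g) ≈ trace f + trace g
  trace-+ f g = cancel (≈-trans (≈-sym (antisym≈ _)) (≈-trans (antisym-+ f g)
    (≈-trans (+-cong (antisym≈ f) (antisym≈ g)) (≈-sym (distribˡ _ _ _)))))

  trace-*ˡ : ∀ {s} f → Invariant s → trace (s * f) ≈ s * trace f
  trace-*ˡ f s-inv = cancel (≈-trans (≈-sym (antisym≈ _)) (≈-trans (antisym-*ˡ f s-inv)
    (≈-trans (*-congˡ (antisym≈ f)) (x∙yz≈y∙xz _ _ _))))

  trace-swap : ∀ {x y} f → x ≢ y → trace (act (swapTo x y) f) ≈ - trace f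
  trace-swap f x≢y = cancel (≈-trans (≈-sym (antisym≈ _)) (≈-trans (antisym-swap f x≢y)
    (≈-trans (-‿cong (antisym≈ f)) (-‿distribʳ-* _ _))))

  trace-0 : trace 0# ≈ 0#
  trace-0 = ≈-trans (trace-cong (≈-sym (zeroˡ 0#))) (≈-trans (trace-*ˡ 0# λ τ → act-0 (to τ)) (zeroˡ _))

  private
    -- By degree only the first term of the kernel survives; its left part is the staircase
    -- monomial, whose trace is 1. The Vandermonde determinant formula follows without any
    -- comparison of signs.
    quotient≈1 : quotient ≈ 1#
    quotient≈1 with kernel-head (before all)
    ... | ts , eq , ts< = begin
      quotient                                                               ≈⟨ reflexive (cong (sumL term) eq) ⟩
      term (map proj₁ (before all) , R.1# , []) + sumL term ts               ≈⟨ +-cong head≈1 (vanishing ts ts<) ⟩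
      1# + 0#                                                                ≈⟨ +-identityʳ 1# ⟩
      1#                                                                     ∎
      where
      term : Term → Carrier
      term (b , r , c) = trace (mon b * 1#) * (κ r * mon c)
      vanishing : ∀ ts → All (λ (b , _ , _) → length b ℕ.< degree) ts → sumL term ts ≈ 0#
      vanishing []                 []        = ≈-refl
      vanishing ((b , r , c) ∷ ts) (b< ∷ ts<) = ≈-trans (+-cong
        (≈-trans (*-congʳ (trace-low (Hom-resp (≈-sym (*-identityʳ _)) (Hom-mon b)) b<)) (zeroˡ _)) (vanishing ts ts<)) (+-identityˡ 0#)
      head≈1 : term (map proj₁ (before all) , R.1# , []) ≈ 1#
      head≈1 = ≈-trans (*-cong (cancel (≈-trans (≈-sym (antisym≈ _)) (≈-trans
        (antisym-cong (≈-trans (*-identityʳ _) (reflexive (cong mon (proj₁-before all))))) (≈-sym (*-identityʳ _)))))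
        (≈-trans (*-identityʳ _) κ-1)) (*-identityˡ 1#)

    alternant≈vandermonde : alternant ≈ vandermonde
    alternant≈vandermonde = ≈-trans (≈-sym (*-identityʳ _)) (≈-trans (*-congˡ (≈-sym quotient≈1)) (≈-trans (expand 1#) (*-identityʳ _)))

  trace-expansion : ∀ f → sumL (λ (b , r , c) → trace (mon b * f) * (κ r * mon c)) terms ≈ f
  trace-expansion f = cancel (≈-trans (expand f) (*-congʳ (≈-sym alternant≈vandermonde)))

  -- The Vandermonde product is itself an antisymmetrization, and on those `antisym` multiplies by
  -- the order of the group.
  trace-vandermonde : trace vandermonde ≈ (length all !) ×′ 1#
  trace-vandermonde = cancel (begin
    alternant * trace vandermonde                ≈⟨ antisym≈ _ ⟨
    antisym vandermonde                          ≈⟨ antisym-cong (≈-sym alternant≈vandermonde) ⟩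
    antisym alternant                            ≈⟨ antisym-antisym _ ⟩
    (length all !) ×′ alternant                  ≈⟨ ×′-congʳ (length all !) (≈-sym (*-identityʳ _)) ⟩
    (length all !) ×′ (alternant * 1#)           ≈⟨ ×-comm-* (length all !) _ _ ⟨
    alternant * (length all !) ×′ 1#             ∎)

-- Pairs of vertices and the action of vertex permutations on them

open Pair

Pair-≡ : ∀ {n} {e f : Pair n} → lo e ≡ lo f → hi e ≡ hi f → e ≡ f
Pair-≡ {e = mkPair _ _ p} {mkPair _ _ q} refl refl = cong (mkPair _ _) (ℕₚ.<-irrelevant p q)

shiftPair : ∀ {n} → Pair n → Pair (suc n)
shiftPair (mkPair i j i<j) = mkPair (suc i) (suc j) (s≤s i<j)

shiftPair-injective : ∀ {n} {e f : Pair n} → shiftPair e ≡ shiftPair f → e ≡ f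
shiftPair-injective {e = e} {f} eq = Pair-≡ {e = e} {f} (Finₚ.suc-injective (cong lo eq)) (Finₚ.suc-injective (cong hi eq))

pairZero : ∀ {n} → Fin n → Pair (suc n)
pairZero j = mkPair zero (suc j) (s≤s z≤n)

private
  candidate : ∀ {n} → Fin n → Fin n → Maybe (Pair n)
  candidate i j = Maybe.map (mkPair i j) (dec⇒maybe (i Finₚ.<? j))

  candidate-zero : ∀ {n} (j : Fin n) → candidate zero (suc j) ≡ just (pairZero j)
  candidate-zero {n} j with Fin.zero {n} Finₚ.<? suc j
  ... | yes _  = cong just (Pair-≡ refl refl)
  ... | no ¬0< = contradiction (s≤s z≤n) ¬0<

  candidate-suc : ∀ {n} (i j : Fin n) → candidate (suc i) (suc j) ≡ Maybe.map shiftPair (candidate i j)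
  candidate-suc i j with suc i Finₚ.<? suc j | i Finₚ.<? j
  ... | yes _       | yes _  = cong just (Pair-≡ refl refl)
  ... | no _        | no _   = refl
  ... | yes (s≤s p) | no ¬p  = contradiction p ¬p
  ... | no ¬p       | yes p  = contradiction (s≤s p) ¬p

  mapMaybe-just : ∀ {A B C : Set} {f : B → Maybe C} {g : A → B} {h : A → C} →
                  (∀ x → f (g x) ≡ just (h x)) → ∀ xs → mapMaybe f (map g xs) ≡ map h xs
  mapMaybe-just eq []       = refl
  mapMaybe-just eq (x ∷ xs) rewrite eq x = cong (_ ∷_) (mapMaybe-just eq xs)

  mapMaybe-natural : ∀ {A B C D : Set} {f : B → Maybe D} {f′ : A → Maybe C} {g : A → B} {h : C → D} →
                     (∀ x → f (g x) ≡ Maybe.map h (f′ x)) → ∀ xs → mapMaybe f (map g xs) ≡ map h (mapMaybe f′ xs)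
  mapMaybe-natural eq [] = refl
  mapMaybe-natural {f′ = f′} eq (x ∷ xs) rewrite eq x with f′ x
  ... | just _  = cong (_ ∷_) (mapMaybe-natural eq xs)
  ... | nothing = mapMaybe-natural eq xs

  allFin-suc : ∀ n → allFin (suc n) ≡ zero ∷ map suc (allFin n)
  allFin-suc n = cong (zero ∷_) (sym (map-tabulate id suc))

-- Separates the pairs containing vertex 0, which makes length, completeness and uniqueness
-- accessible to induction.
allPairs-suc : ∀ n → allPairs (suc n) ≡ map pairZero (allFin n) ++ map shiftPair (allPairs n)
allPairs-suc n = trans (cong (λ fs → concatMap (λ i → mapMaybe (candidate i) fs) fs) (allFin-suc n))
  (cong₂ _++_ (mapMaybe-just candidate-zero (allFin n))
    (trans (concatMap-map _ suc (allFin n))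
      (trans (concatMap-cong (λ i → mapMaybe-natural (candidate-suc i) (allFin n)) (allFin n))
        (sym (map-concatMap shiftPair _ (allFin n))))))

length-allPairs : ∀ n → length (allPairs n) ≡ n C 2
length-allPairs zero    = refl
length-allPairs (suc n) = begin
  length (allPairs (suc n))                                                     ≡⟨ cong length (allPairs-suc n) ⟩
  length (map pairZero (allFin n) ++ map shiftPair (allPairs n))                ≡⟨ length-++ (map pairZero (allFin n)) ⟩
  length (map pairZero (allFin n)) ℕ.+ length (map shiftPair (allPairs n))      ≡⟨ cong₂ ℕ._+_ (trans (length-map pairZero (allFin n)) (length-tabulate id)) (trans (length-map shiftPair (allPairs n)) (length-allPairs n)) ⟩
  n ℕ.+ n C 2                                                                   ≡⟨ cong (ℕ._+ n C 2) (nC1≡n n) ⟨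
  n C 1 ℕ.+ n C 2                                                               ≡⟨ nCk+nC[k+1]≡[n+1]C[k+1] n 1 ⟩
  suc n C 2                                                                     ∎
  where open ≡.≡-Reasoning

allPairs-complete : ∀ {n} (e : Pair n) → e ∈ allPairs n
allPairs-complete {suc n} (mkPair zero (suc j) p) = subst (mkPair zero (suc j) p ∈_) (sym (allPairs-suc n))
  (∈-++⁺ˡ (subst (_∈ map pairZero (allFin n)) (Pair-≡ {e = pairZero j} {mkPair zero (suc j) p} refl refl) (∈-map⁺ pairZero (∈-allFin j))))
allPairs-complete {suc n} (mkPair (suc i) (suc j) (s≤s p)) = subst (mkPair (suc i) (suc j) (s≤s p) ∈_) (sym (allPairs-suc n))
  (∈-++⁺ʳ (map pairZero (allFin n)) (∈-map⁺ shiftPair (allPairs-complete (mkPair i j p))))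

allPairs-unique : ∀ n → Unique (allPairs n)
allPairs-unique zero    = []
allPairs-unique (suc n) = subst Unique (sym (allPairs-suc n))
  (Uniqueₚ.++⁺ (Uniqueₚ.map⁺ (Finₚ.suc-injective ∘ cong hi) (Uniqueₚ.allFin⁺ n))
    (Uniqueₚ.map⁺ shiftPair-injective (allPairs-unique n)) disjoint)
  where
  disjoint : ∀ {e} → e ∈ map pairZero (allFin n) × e ∈ map shiftPair (allPairs n) → ⊥
  disjoint (e∈₀ , e∈ₛ) with ∈-map⁻ pairZero e∈₀ | ∈-map⁻ shiftPair e∈ₛ
  ... | _ , _ , refl | _ , _ , ()

module _ {n : ℕ} where

  infix 4 _∈ᵉ_ _∈ᵉ?_

  data _∈ᵉ_ (v : Fin n) (e : Pair n) : Set where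
    at-lo : v ≡ lo e → v ∈ᵉ e
    at-hi : v ≡ hi e → v ∈ᵉ e

  _∈ᵉ?_ : ∀ v e → Dec (v ∈ᵉ e)
  v ∈ᵉ? e with v Finₚ.≟ lo e | v Finₚ.≟ hi e
  ... | yes p | _     = yes (at-lo p)
  ... | no _  | yes q = yes (at-hi q)
  ... | no ¬p | no ¬q = no λ { (at-lo p) → ¬p p ; (at-hi q) → ¬q q }

  lo≢hi : ∀ (e : Pair n) → lo e ≢ hi e
  lo≢hi e = Finₚ.<⇒≢ (lo<hi e)

  unordered-ends : ∀ (i j : Fin n) (i≢j : i ≢ j) →
                   (lo (unordered i j i≢j) ≡ i × hi (unordered i j i≢j) ≡ j) ⊎
                   (lo (unordered i j i≢j) ≡ j × hi (unordered i j i≢j) ≡ i)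
  unordered-ends i j i≢j with Finₚ.<-cmp i j
  ... | tri< _ _ _   = inj₁ (refl , refl)
  ... | tri≈ _ i≡j _ = contradiction i≡j i≢j
  ... | tri> _ _ _   = inj₂ (refl , refl)

  ∈-unorderedˡ : ∀ (i j : Fin n) (i≢j : i ≢ j) → i ∈ᵉ unordered i j i≢j
  ∈-unorderedˡ i j i≢j with unordered-ends i j i≢j
  ... | inj₁ (p , _) = at-lo (sym p)
  ... | inj₂ (_ , q) = at-hi (sym q)

  ∈-unorderedʳ : ∀ (i j : Fin n) (i≢j : i ≢ j) → j ∈ᵉ unordered i j i≢j
  ∈-unorderedʳ i j i≢j with unordered-ends i j i≢j
  ... | inj₁ (_ , q) = at-hi (sym q)
  ... | inj₂ (p , _) = at-lo (sym p)

  ∈-unordered⁻ : ∀ {v} (i j : Fin n) (i≢j : i ≢ j) → v ∈ᵉ unordered i j i≢j → v ≡ i ⊎ v ≡ j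
  ∈-unordered⁻ i j i≢j v∈ with unordered-ends i j i≢j | v∈
  ... | inj₁ (p , _) | at-lo v≡ = inj₁ (trans v≡ p)
  ... | inj₁ (_ , q) | at-hi v≡ = inj₂ (trans v≡ q)
  ... | inj₂ (p , _) | at-lo v≡ = inj₂ (trans v≡ p)
  ... | inj₂ (_ , q) | at-hi v≡ = inj₁ (trans v≡ q)

  pair-unique : ∀ {i j : Fin n} {e f} → i ≢ j → i ∈ᵉ e → j ∈ᵉ e → i ∈ᵉ f → j ∈ᵉ f → e ≡ f
  pair-unique {e = e} {f} i≢j (at-lo refl) (at-lo refl) _ _ = contradiction refl i≢j
  pair-unique {e = e} {f} i≢j (at-hi refl) (at-hi refl) _ _ = contradiction refl i≢j
  pair-unique {e = e} {f} i≢j (at-lo refl) (at-hi refl) (at-lo p) (at-hi q) = Pair-≡ p q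
  pair-unique {e = e} {f} i≢j (at-hi refl) (at-lo refl) (at-hi p) (at-lo q) = Pair-≡ q p
  pair-unique {e = e} {f} i≢j (at-lo refl) (at-hi refl) (at-hi p) (at-lo q) =
    contradiction (ℕₚ.<-trans (lo<hi f) (≡.subst₂ Fin._<_ p q (lo<hi e))) (ℕₚ.<-irrefl refl)
  pair-unique {e = e} {f} i≢j (at-hi refl) (at-lo refl) (at-lo p) (at-hi q) =
    contradiction (ℕₚ.<-trans (lo<hi f) (≡.subst₂ Fin._<_ q p (lo<hi e))) (ℕₚ.<-irrefl refl)
  pair-unique {e = e} {f} i≢j _ _ (at-lo refl) (at-lo refl) = contradiction refl i≢j
  pair-unique {e = e} {f} i≢j _ _ (at-hi refl) (at-hi refl) = contradiction refl i≢j

  other-end : ∀ {v : Fin n} {e} → v ∈ᵉ e → ∃ λ w → w ≢ v × w ∈ᵉ e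
  other-end {e = e} (at-lo refl) = hi e , lo≢hi e ∘ sym , at-hi refl
  other-end {e = e} (at-hi refl) = lo e , lo≢hi e , at-lo refl

  third-end : ∀ {u v w : Fin n} {e} → u ∈ᵉ e → v ∈ᵉ e → u ≢ v → w ∈ᵉ e → w ≡ u ⊎ w ≡ v
  third-end (at-lo refl) (at-lo refl) u≢v _        = contradiction refl u≢v
  third-end (at-hi refl) (at-hi refl) u≢v _        = contradiction refl u≢v
  third-end (at-lo refl) (at-hi refl) _ (at-lo eq)  = inj₁ eq
  third-end (at-lo refl) (at-hi refl) _ (at-hi eq)  = inj₂ eq
  third-end (at-hi refl) (at-lo refl) _ (at-lo eq)  = inj₂ eq
  third-end (at-hi refl) (at-lo refl) _ (at-hi eq)  = inj₁ eq

  ∈-· : ∀ (σ : Permutation′ n) {v e} → v ∈ᵉ e → to σ v ∈ᵉ (σ · e)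
  ∈-· σ {e = e} (at-lo refl) = ∈-unorderedˡ (to σ (lo e)) (to σ (hi e)) _
  ∈-· σ {e = e} (at-hi refl) = ∈-unorderedʳ (to σ (lo e)) (to σ (hi e)) _

  -- Two distinct vertices determine a pair, so identities of the action are checked on endpoints,
  -- without deciding which image is the smaller one.
  ·-unique : ∀ (σ : Permutation′ n) e f → to σ (lo e) ∈ᵉ f → to σ (hi e) ∈ᵉ f → σ · e ≡ f
  ·-unique σ e f lo∈ hi∈ =
    pair-unique (lo≢hi e ∘ to-injective σ) (∈-· σ {e = e} (at-lo refl)) (∈-· σ {e = e} (at-hi refl)) lo∈ hi∈

  ·-cong : ∀ (σ τ : Permutation′ n) → (∀ v → to σ v ≡ to τ v) → ∀ e → σ · e ≡ τ · e
  ·-cong σ τ σ≗τ e = ·-unique σ e (τ · e)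
    (subst (_∈ᵉ (τ · e)) (sym (σ≗τ (lo e))) (∈-· τ {e = e} (at-lo refl)))
    (subst (_∈ᵉ (τ · e)) (sym (σ≗τ (hi e))) (∈-· τ {e = e} (at-hi refl)))

  ·-id : ∀ e → ↔-id (Fin n) · e ≡ e
  ·-id e = ·-unique (↔-id (Fin n)) e e (at-lo refl) (at-hi refl)

  ·-∘ : ∀ (σ τ : Permutation′ n) e → (σ ↔-∘ τ) · e ≡ σ · (τ · e)
  ·-∘ σ τ e = ·-unique (σ ↔-∘ τ) e (σ · (τ · e)) (∈-· σ {e = τ · e} (∈-· τ {e = e} (at-lo refl))) (∈-· σ {e = τ · e} (∈-· τ {e = e} (at-hi refl)))

  ·-fix : ∀ (σ : Permutation′ n) e → to σ (lo e) ≡ lo e → to σ (hi e) ≡ hi e → σ · e ≡ e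
  ·-fix σ e p q = ·-unique σ e e (at-lo p) (at-hi q)

  pairPerm : Permutation′ n → Pair n ↔ Pair n
  pairPerm σ = mk↔ₛ′ (σ ·_) (↔-sym σ ·_)
    (λ e → trans (sym (·-∘ σ (↔-sym σ) e)) (trans (·-cong (σ ↔-∘ ↔-sym σ) (↔-id _) (Inverse.strictlyInverseˡ σ) e) (·-id e)))
    (λ e → trans (sym (·-∘ (↔-sym σ) σ e)) (trans (·-cong (↔-sym σ ↔-∘ σ) (↔-id _) (Inverse.strictlyInverseʳ σ) e) (·-id e)))

  -- Choose u different from the moved vertex v and from its image. The image of the pair of v and u
  -- contains the image of v, which is neither v nor u.
  ·-faithful : 3 ℕ.≤ n → ∀ (σ : Permutation′ n) {v} → to σ v ≢ v → ∃ λ e → σ · e ≢ e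
  ·-faithful 3≤n σ {v} moved with avoid 3≤n v (to σ v)
    where
    avoid : ∀ {n} → 3 ℕ.≤ n → (v w : Fin n) → ∃ λ u → u ≢ v × u ≢ w
    avoid (s≤s (s≤s (s≤s _))) zero          zero          = suc zero , (λ ()) , λ ()
    avoid (s≤s (s≤s (s≤s _))) zero          (suc zero)    = suc (suc zero) , (λ ()) , λ ()
    avoid (s≤s (s≤s (s≤s _))) zero          (suc (suc w)) = suc zero , (λ ()) , λ ()
    avoid (s≤s (s≤s (s≤s _))) (suc zero)    zero          = suc (suc zero) , (λ ()) , λ ()
    avoid (s≤s (s≤s (s≤s _))) (suc (suc v)) zero          = suc zero , (λ ()) , λ ()
    avoid (s≤s (s≤s (s≤s _))) (suc v)       (suc w)       = zero , (λ ()) , λ ()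
  ... | u , u≢v , u≢w = e , λ σe≡e →
    case ∈-unordered⁻ v u (u≢v ∘ sym) (subst (to σ v ∈ᵉ_) σe≡e (∈-· σ {e = e} (∈-unorderedˡ v u _))) of λ where
      (inj₁ σv≡v) → moved σv≡v
      (inj₂ σv≡u) → u≢w (sym σv≡u)
    where
    e : Pair n
    e = unordered v u (u≢v ∘ sym)

  open Swaps (Finₚ._≟_ {n})
  open Swaps (_≟ᴾ_ {n}) using () renaming (swapTo to pairSwapTo; swapTo-x to pairSwapTo-x; swapTo-y to pairSwapTo-y; swapTo-z to pairSwapTo-z)

  module _ (i k : Fin n) (i≢k : i ≢ k) where

    Avoids : Fin n → Set
    Avoids u = i ≢ u × k ≢ u

    pairSwaps : ∀ us → All Avoids us → Pair n → Pair n
    pairSwaps []       []             = id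
    pairSwaps (u ∷ us) ((p , q) ∷ ps) = pairSwapTo (unordered i u p) (unordered k u q) ∘ pairSwaps us ps

    pairSwaps-fix : ∀ us ps e → (∀ {u} → u ∈ us → ¬ (u ∈ᵉ e) ⊎ (¬ (i ∈ᵉ e) × ¬ (k ∈ᵉ e))) → pairSwaps us ps e ≡ e
    pairSwaps-fix []       []             e _     = refl
    pairSwaps-fix (u ∷ us) ((p , q) ∷ ps) e avoid
      rewrite pairSwaps-fix us ps e (avoid ∘ there) = pairSwapTo-z e≢iu e≢ku
      where
      e≢iu : e ≢ unordered i u p
      e≢iu refl with avoid (here refl)
      ... | inj₁ u∉      = u∉ (∈-unorderedʳ i u p)
      ... | inj₂ (i∉ , _) = i∉ (∈-unorderedˡ i u p)
      e≢ku : e ≢ unordered k u q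
      e≢ku refl with avoid (here refl)
      ... | inj₁ u∉      = u∉ (∈-unorderedʳ k u q)
      ... | inj₂ (_ , k∉) = k∉ (∈-unorderedˡ k u q)

    pairSwaps-i : ∀ us ps → Unique us → ∀ {u} → u ∈ us → ∀ {e f} → i ∈ᵉ e → u ∈ᵉ e → k ∈ᵉ f → u ∈ᵉ f → pairSwaps us ps e ≡ f
    pairSwaps-i (u ∷ us) ((p , q) ∷ ps) uniq (here refl) {e} {f} i∈e u∈e k∈f u∈f
      with refl ← pair-unique p i∈e u∈e (∈-unorderedˡ i u p) (∈-unorderedʳ i u p)
         | refl ← pair-unique q k∈f u∈f (∈-unorderedˡ k u q) (∈-unorderedʳ k u q)
      rewrite pairSwaps-fix us ps (unordered i u p) (λ {w} w∈us → inj₁ λ w∈ → case ∈-unordered⁻ i u p w∈ of λ where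
        (inj₁ refl) → proj₁ (All.lookup ps w∈us) refl
        (inj₂ refl) → unique-∉ uniq w∈us) = pairSwapTo-x (unordered i u p) (unordered k u q)
    pairSwaps-i (u′ ∷ us) ((p , q) ∷ ps) uniq {u} (there u∈us) {e} {f} i∈e u∈e k∈f u∈f
      rewrite pairSwaps-i us ps (unique-tail uniq) u∈us i∈e u∈e k∈f u∈f = pairSwapTo-z
        (λ { refl → case ∈-unordered⁻ i u′ p k∈f of λ where
               (inj₁ k≡i)  → i≢k (sym k≡i)
               (inj₂ k≡u′) → q k≡u′ })
        (λ { refl → case ∈-unordered⁻ k u′ q u∈f of λ where
               (inj₁ refl) → proj₂ (All.lookup ps u∈us) refl
               (inj₂ refl) → unique-∉ uniq u∈us })

    pairSwaps-k : ∀ us ps → Unique us → ∀ {u} → u ∈ us → ∀ {e f} → k ∈ᵉ e → u ∈ᵉ e → i ∈ᵉ f → u ∈ᵉ f → pairSwaps us ps e ≡ f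
    pairSwaps-k (u ∷ us) ((p , q) ∷ ps) uniq (here refl) {e} {f} k∈e u∈e i∈f u∈f
      with refl ← pair-unique q k∈e u∈e (∈-unorderedˡ k u q) (∈-unorderedʳ k u q)
         | refl ← pair-unique p i∈f u∈f (∈-unorderedˡ i u p) (∈-unorderedʳ i u p)
      rewrite pairSwaps-fix us ps (unordered k u q) (λ {w} w∈us → inj₁ λ w∈ → case ∈-unordered⁻ k u q w∈ of λ where
        (inj₁ refl) → proj₂ (All.lookup ps w∈us) refl
        (inj₂ refl) → unique-∉ uniq w∈us) = pairSwapTo-y (unordered i u p) (unordered k u q)
    pairSwaps-k (u′ ∷ us) ((p , q) ∷ ps) uniq {u} (there u∈us) {e} {f} k∈e u∈e i∈f u∈f
      rewrite pairSwaps-k us ps (unique-tail uniq) u∈us k∈e u∈e i∈f u∈f = pairSwapTo-z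
        (λ { refl → case ∈-unordered⁻ i u′ p u∈f of λ where
               (inj₁ refl) → proj₁ (All.lookup ps u∈us) refl
               (inj₂ refl) → unique-∉ uniq u∈us })
        (λ { refl → case ∈-unordered⁻ k u′ q i∈f of λ where
               (inj₁ i≡k)  → i≢k i≡k
               (inj₂ i≡u′) → p i≡u′ })

    -- For each third vertex u the pairs {i, u} and {k, u} are exchanged, while {i, k} and the pairs
    -- containing neither `i` nor `k` stay fixed. The number of exchanges gives the sign of a vertex
    -- transposition on the pairs.
    transposition-pairSwaps : ∀ us ps → Unique us → (∀ v → i ≢ v → k ≢ v → v ∈ us) →
                              ∀ e → swapPerm i k · e ≡ pairSwaps us ps e
    transposition-pairSwaps us ps uniq complete e with i ∈ᵉ? e | k ∈ᵉ? e
    ... | no i∉ | no k∉ = trans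
      (·-fix (swapPerm i k) e (swapTo-z (λ p → i∉ (at-lo (sym p))) (λ p → k∉ (at-lo (sym p)))) (swapTo-z (λ p → i∉ (at-hi (sym p))) (λ p → k∉ (at-hi (sym p)))))
      (sym (pairSwaps-fix us ps e λ _ → inj₂ (i∉ , k∉)))
    ... | yes i∈ | yes k∈ = trans
      (pair-unique i≢k (subst (_∈ᵉ (swapPerm i k · e)) (swapTo-y i k) (∈-· (swapPerm i k) {e = e} k∈))
                       (subst (_∈ᵉ (swapPerm i k · e)) (swapTo-x i k) (∈-· (swapPerm i k) {e = e} i∈)) i∈ k∈)
      (sym (pairSwaps-fix us ps e λ w∈us → inj₁ λ w∈ → case third-end i∈ k∈ i≢k w∈ of λ where
        (inj₁ refl) → proj₁ (All.lookup ps w∈us) refl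
        (inj₂ refl) → proj₂ (All.lookup ps w∈us) refl))
    ... | yes i∈ | no k∉ with other-end i∈
    ...   | u , u≢i , u∈ = sym (pairSwaps-i us ps uniq (complete u (u≢i ∘ sym) k≢u) i∈ u∈
      (subst (_∈ᵉ (swapPerm i k · e)) (swapTo-x i k) (∈-· (swapPerm i k) {e = e} i∈))
      (subst (_∈ᵉ (swapPerm i k · e)) (swapTo-z u≢i (k≢u ∘ sym)) (∈-· (swapPerm i k) {e = e} u∈)))
      where
      k≢u : k ≢ u
      k≢u refl = k∉ u∈
    transposition-pairSwaps us ps uniq complete e | no i∉ | yes k∈ with other-end k∈
    ...   | u , u≢k , u∈ = sym (pairSwaps-k us ps uniq (complete u i≢u (u≢k ∘ sym)) k∈ u∈
      (subst (_∈ᵉ (swapPerm i k · e)) (swapTo-y i k) (∈-· (swapPerm i k) {e = e} k∈))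
      (subst (_∈ᵉ (swapPerm i k · e)) (swapTo-z (i≢u ∘ sym) u≢k) (∈-· (swapPerm i k) {e = e} u∈)))
      where
      i≢u : i ≢ u
      i≢u refl = i∉ u∈

  private
    transpose≡swapTo : ∀ (i k v : Fin n) → PC.transpose i k v ≡ swapTo i k v
    transpose≡swapTo i k v with v Finₚ.≟ i
    ... | yes _ = refl
    ... | no _ with v Finₚ.≟ k
    ...   | yes _ = refl
    ...   | no _  = refl

  -- Every permutation is a product of transpositions. Closure of `P` under pointwise equality is
  -- required because a permutation agrees with its decomposition only pointwise.
  permutation-induction : ∀ {p} (P : Permutation′ n → Set p) →
                          (∀ {σ τ} → (∀ v → to σ v ≡ to τ v) → P σ → P τ) →
                          P (↔-id (Fin n)) →
                          (∀ σ i k → i ≢ k → P σ → P (σ ↔-∘ swapPerm i k)) →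
                          ∀ σ → P σ
  permutation-induction P P-resp P-id P-swap σ = P-resp (TL.eval-decompose σ) (go (TL.decompose σ))
    where
    go : ∀ ts → P (TL.eval ts)
    go []             = P-id
    go ((i , k) ∷ ts) with i Finₚ.≟ k
    ... | yes refl = P-resp (λ v → cong (to (TL.eval ts)) (sym (trans (transpose≡swapTo i i v) (swapTo-refl i v)))) (go ts)
    ... | no i≢k   = P-resp (λ v → cong (to (TL.eval ts)) (sym (transpose≡swapTo i k v))) (P-swap (TL.eval ts) i k i≢k (go ts))

  from-≗ : ∀ (σ τ : Permutation′ n) → (∀ v → to σ v ≡ to τ v) → ∀ v → from σ v ≡ from τ v
  from-≗ σ τ σ≗τ v = to-injective σ (trans (Inverse.strictlyInverseˡ σ v)
    (sym (trans (σ≗τ (from τ v)) (Inverse.strictlyInverseˡ τ v))))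

module _ where

  open import Data.Nat.Base using (_+_; _*_)


  -- Multigraphs without a transposition among their automorphisms

  module _ {A : Set} where

    sumℕ : (A → ℕ) → List A → ℕ
    sumℕ f []       = 0
    sumℕ f (x ∷ xs) = f x + sumℕ f xs

    sumℕ-mono : ∀ {f g} → (∀ x → f x ≤ g x) → ∀ xs → sumℕ f xs ≤ sumℕ g xs
    sumℕ-mono f≤g []       = z≤n
    sumℕ-mono f≤g (x ∷ xs) = ℕₚ.+-mono-≤ (f≤g x) (sumℕ-mono f≤g xs)

    sumℕ-cong : ∀ {f g} → (∀ x → f x ≡ g x) → ∀ xs → sumℕ f xs ≡ sumℕ g xs
    sumℕ-cong f≡g []       = refl
    sumℕ-cong f≡g (x ∷ xs) = cong₂ _+_ (f≡g x) (sumℕ-cong f≡g xs)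

    sumℕ-+ : ∀ f g xs → sumℕ (λ x → f x + g x) xs ≡ sumℕ f xs + sumℕ g xs
    sumℕ-+ f g []       = refl
    sumℕ-+ f g (x ∷ xs) = trans (cong (f x + g x +_) (sumℕ-+ f g xs))
      (solve 4 (λ a b s t → a :+ b :+ (s :+ t) := a :+ s :+ (b :+ t)) refl (f x) (g x) _ _)
      where open ℕSolver.+-*-Solver

    sumℕ-* : ∀ k f xs → sumℕ (λ x → k * f x) xs ≡ k * sumℕ f xs
    sumℕ-* k f []       = sym (ℕₚ.*-zeroʳ k)
    sumℕ-* k f (x ∷ xs) = trans (cong (k * f x +_) (sumℕ-* k f xs)) (sym (ℕₚ.*-distribˡ-+ k (f x) _))

    sumℕ-const : ∀ k xs → sumℕ (λ _ → k) xs ≡ k * length xs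
    sumℕ-const k []       = sym (ℕₚ.*-zeroʳ k)
    sumℕ-const k (x ∷ xs) = trans (cong (k +_) (sumℕ-const k xs)) (sym (ℕₚ.*-suc k (length xs)))

    sumℕ-≡0 : ∀ {f} xs → (∀ {x} → x ∈ xs → f x ≡ 0) → sumℕ f xs ≡ 0
    sumℕ-≡0 []       f≡0 = refl
    sumℕ-≡0 (x ∷ xs) f≡0 rewrite f≡0 (here refl) = sumℕ-≡0 xs (f≡0 ∘ there)

    sumℕ-↭ : ∀ f {xs ys} → xs ↭ ys → sumℕ f xs ≡ sumℕ f ys
    sumℕ-↭ f ↭.refl        = refl
    sumℕ-↭ f (prep x p)    = cong (f x +_) (sumℕ-↭ f p)
    sumℕ-↭ f (swap x y p)  = trans (cong (λ s → f x + (f y + s)) (sumℕ-↭ f p))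
      (solve 3 (λ a b s → a :+ (b :+ s) := b :+ (a :+ s)) refl (f x) (f y) _)
      where open ℕSolver.+-*-Solver
    sumℕ-↭ f (↭.trans p q) = trans (sumℕ-↭ f p) (sumℕ-↭ f q)

    sumℕ-positive : ∀ f xs → 0 < sumℕ f xs → ∃₂ λ x ys → xs ↭ x ∷ ys × 0 < f x
    sumℕ-positive f (x ∷ xs) 0<s with f x in fx
    ... | suc _ = x , xs , ↭-refl , subst (0 <_) (sym fx) (s≤s z≤n)
    ... | zero with sumℕ-positive f xs 0<s
    ...   | y , ys , xs↭y∷ys , 0<fy = y , x ∷ ys , ↭-trans (prep x xs↭y∷ys) (swap x y ↭-refl) , 0<fy

    sumℕ-one : ∀ {f} {xs} → Unique xs → (∀ x → f x ≤ 1) →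
               (∀ {x y} → x ≢ y → f x ≡ 1 → f y ≢ 1) → sumℕ f xs ≤ 1
    sumℕ-one {f} {[]}     u f≤1 once = z≤n
    sumℕ-one {f} {x ∷ xs} u f≤1 once with f x in fx | f≤1 x
    ... | 0 | _ = sumℕ-one (unique-tail u) f≤1 once
    ... | 1 | _ rewrite sumℕ-≡0 {f} xs (λ {y} y∈xs → ℕₚ.n<1⇒n≡0
            (ℕₚ.≤∧≢⇒< (f≤1 y) (once (λ x≡y → unique-∉ u (subst (_∈ xs) (sym x≡y) y∈xs)) fx))) = ℕₚ.≤-refl
    ... | suc (suc _) | s≤s ()

  sumℕ-swap : ∀ {A B : Set} (f : A → B → ℕ) xs ys → sumℕ (λ x → sumℕ (f x) ys) xs ≡ sumℕ (λ y → sumℕ (λ x → f x y) xs) ys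
  sumℕ-swap f []       ys = sym (sumℕ-≡0 ys λ _ → refl)
  sumℕ-swap f (x ∷ xs) ys = trans (cong (sumℕ (f x) ys +_) (sumℕ-swap f xs ys)) (sym (sumℕ-+ (f x) _ ys))

  private
    is-0 is-1 : ℕ → ℕ
    is-0 0       = 1
    is-0 (suc _) = 0
    is-1 1       = 1
    is-1 _       = 0

    is-1⇒ : ∀ d → 0 < is-1 d → d ≡ 1
    is-1⇒ 1             _ = refl

    is-1≤1 : ∀ d → is-1 d ≤ 1
    is-1≤1 0             = z≤n
    is-1≤1 1             = ℕₚ.≤-refl
    is-1≤1 (suc (suc _)) = z≤n

    is-0⇒ : ∀ d → is-0 d ≡ 1 → d ≡ 0
    is-0⇒ 0 _ = refl

    is-0≤1 : ∀ d → is-0 d ≤ 1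
    is-0≤1 0       = ℕₚ.≤-refl
    is-0≤1 (suc _) = z≤n

    -- An edge hands 2 units to either end, so a vertex of degree `d` holds 2d. A leaf gains one
    -- more and an isolated vertex is granted 3; `q` is what a vertex passes on to its leaves. From
    -- degree 2 on, the 4 units cover 3 + `q`.
    charge : ∀ d q → (d ≡ 0 → q ≡ 0) → (d ≡ 1 → q ≡ 0) → q ≤ 1 → 3 + q ≤ 2 * d + is-1 d * d + 3 * is-0 d
    charge 0             q 0⇒ 1⇒ q≤1 rewrite 0⇒ refl = ℕₚ.≤-refl
    charge 1             q 0⇒ 1⇒ q≤1 rewrite 1⇒ refl = ℕₚ.≤-refl
    charge (suc (suc d)) q 0⇒ 1⇒ q≤1 = ℕₚ.≤-trans (ℕₚ.+-monoʳ-≤ 3 q≤1)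
      (ℕₚ.≤-trans (ℕₚ.*-monoʳ-≤ 2 (s≤s (s≤s (z≤n {d}))))
        (ℕₚ.≤-trans (ℕₚ.m≤m+n _ _) (ℕₚ.m≤m+n _ _)))

  module _ {n : ℕ} where

    private
      Vertex : Set
      Vertex = Fin n

    δ : Vertex → Vertex → ℕ
    δ v u = if does (v Finₚ.≟ u) then 1 else 0

    δ-refl : ∀ v → δ v v ≡ 1
    δ-refl v with v Finₚ.≟ v
    ... | yes _  = refl
    ... | no v≢v = contradiction refl v≢v

    δ-≢ : ∀ {v u} → v ≢ u → δ v u ≡ 0
    δ-≢ {v} {u} v≢u with v Finₚ.≟ u
    ... | yes v≡u = contradiction v≡u v≢u
    ... | no _    = refl

    sumℕ-δ : ∀ u k → sumℕ (λ v → δ v u * k) (allFin n) ≡ k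
    sumℕ-δ u k with ∈-extract (∈-allFin u)
    ... | vs , all↭u∷vs = trans (sumℕ-↭ _ all↭u∷vs)
      (trans (cong₂ _+_ (trans (cong (_* k) (δ-refl u)) (ℕₚ.*-identityˡ k)) (sumℕ-≡0 vs λ {v} v∈vs → cong (_* k) (δ-≢ (λ v≡u → u∉vs (subst (_∈ vs) v≡u v∈vs)))))
        (ℕₚ.+-identityʳ k))
      where
      u∉vs : u ∉ vs
      u∉vs = unique-∉ (unique-↭ all↭u∷vs (Uniqueₚ.allFin⁺ n))

    weight : (Pair n → ℕ) → (Pair n → ℕ) → Vertex → Pair n → ℕ
    weight p q v e = δ v (lo e) * p e + δ v (hi e) * q e

    -- An edge gives `p` to its smaller end and `q` to its larger one. Degrees, leaf ends and leaf
    -- neighbours are all tallies, and exchanging `p` with `q` preserves the total by `sum-tally`: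
    -- what the leaves gain is what their neighbours lose.
    tally : (Pair n → ℕ) → (Pair n → ℕ) → List (Pair n) → Vertex → ℕ
    tally p q α v = sumℕ (weight p q v) α

    sum-tally : ∀ p q α → sumℕ (tally p q α) (allFin n) ≡ sumℕ (λ e → p e + q e) α
    sum-tally p q α = trans (sumℕ-swap (weight p q) (allFin n) α)
      (sumℕ-cong (λ e → trans (sumℕ-+ _ _ (allFin n)) (cong₂ _+_ (sumℕ-δ (lo e) (p e)) (sumℕ-δ (hi e) (q e)))) α)

    deg : List (Pair n) → Vertex → ℕ
    deg = tally (λ _ → 1) (λ _ → 1)

    weight-∉ : ∀ p q v e → ¬ (v ∈ᵉ e) → weight p q v e ≡ 0
    weight-∉ p q v e v∉e rewrite δ-≢ (v∉e ∘ at-lo) | δ-≢ (v∉e ∘ at-hi) = refl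

    weight-1-∈ : ∀ v e → v ∈ᵉ e → weight (λ _ → 1) (λ _ → 1) v e ≡ 1
    weight-1-∈ v e (at-lo refl) rewrite δ-refl (lo e) | δ-≢ (lo≢hi e) = refl
    weight-1-∈ v e (at-hi refl) rewrite δ-refl (hi e) | δ-≢ (lo≢hi e ∘ sym) = refl

    deg-∷-∈ : ∀ {v e} α → v ∈ᵉ e → deg (e ∷ α) v ≡ suc (deg α v)
    deg-∷-∈ {v} {e} α v∈e = cong (_+ deg α v) (weight-1-∈ v e v∈e)

    deg-∷-∉ : ∀ {v e} α → ¬ (v ∈ᵉ e) → deg (e ∷ α) v ≡ deg α v
    deg-∷-∉ {v} {e} α v∉e = cong (_+ deg α v) (weight-∉ _ _ v e v∉e)

    deg-zero : ∀ v α → deg α v ≡ 0 → ∀ {e} → e ∈ α → ¬ (v ∈ᵉ e)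
    deg-zero v α deg≡0 {e} e∈α v∈e with ∈-extract e∈α
    ... | β , α↭e∷β with () ← trans (sym (trans (sumℕ-↭ _ α↭e∷β) (deg-∷-∈ β v∈e))) deg≡0

    deg-positive : ∀ {v} α → 0 < deg α v → ∃ λ e → e ∈ α × v ∈ᵉ e
    deg-positive {v} α 0<deg with sumℕ-positive _ α 0<deg
    ... | e , β , α↭e∷β , 0<w with v ∈ᵉ? e
    ...   | yes v∈e = e , ↭ₚ.∈-resp-↭ (↭-sym α↭e∷β) (here refl) , v∈e
    ...   | no v∉e  = contradiction (sym (weight-∉ _ _ v e v∉e)) (ℕₚ.<⇒≢ 0<w)

    open Swaps (Finₚ._≟_ {n})

    _fixedBy_ : List (Pair n) → Permutation′ n → Set
    α fixedBy σ = map (σ ·_) α ↭ α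

    fixedBy-↭ : ∀ {α β} σ → α ↭ β → β fixedBy σ → α fixedBy σ
    fixedBy-↭ σ α↭β fix = ↭-trans (↭ₚ.map⁺ (σ ·_) α↭β) (↭-trans fix (↭-sym α↭β))

    swap-avoids : ∀ i k α → deg α i ≡ 0 → deg α k ≡ 0 → map (swapPerm i k ·_) α ≡ α
    swap-avoids i k α i≡0 k≡0 = go α (deg-zero i α i≡0) (deg-zero k α k≡0)
      where
      go : ∀ β → (∀ {e} → e ∈ β → ¬ (i ∈ᵉ e)) → (∀ {e} → e ∈ β → ¬ (k ∈ᵉ e)) → map (swapPerm i k ·_) β ≡ β
      go []       _  _  = refl
      go (e ∷ β) i∉ k∉ = cong₂ _∷_
        (·-fix (swapPerm i k) e
          (swapTo-z (i∉ (here refl) ∘ at-lo ∘ sym) (k∉ (here refl) ∘ at-lo ∘ sym))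
          (swapTo-z (i∉ (here refl) ∘ at-hi ∘ sym) (k∉ (here refl) ∘ at-hi ∘ sym)))
        (go β (i∉ ∘ there) (k∉ ∘ there))

    deg-tail : ∀ v {e α β} → α ↭ e ∷ β → v ∈ᵉ e → deg α v ≡ 1 → deg β v ≡ 0
    deg-tail v {β = β} α↭e∷β v∈e deg≡1 =
      ℕₚ.suc-injective (trans (sym (deg-∷-∈ β v∈e)) (trans (sym (sumℕ-↭ _ α↭e∷β)) deg≡1))

    module _ (α : List (Pair n)) (asymmetric : ∀ i k → i ≢ k → ¬ (α fixedBy swapPerm i k)) where

      private
        isLeaf isolated : Vertex → ℕ
        isLeaf   = is-1 ∘ deg α
        isolated = is-0 ∘ deg α

        isLeaf⇒ : ∀ v → 0 < isLeaf v → deg α v ≡ 1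
        isLeaf⇒ v = is-1⇒ (deg α v)

        isLeaf≤1 : ∀ v → isLeaf v ≤ 1
        isLeaf≤1 = is-1≤1 ∘ deg α

        leafEdges leafNeighbours : List (Pair n) → Vertex → ℕ
        leafEdges      = tally (isLeaf ∘ lo) (isLeaf ∘ hi)
        leafNeighbours = tally (isLeaf ∘ hi) (isLeaf ∘ lo)

        leafEdges≡ : ∀ β v → leafEdges β v ≡ isLeaf v * deg β v
        leafEdges≡ []      v = sym (ℕₚ.*-zeroʳ (isLeaf v))
        leafEdges≡ (e ∷ β) v = trans (cong₂ _+_ edge (leafEdges≡ β v)) (sym (ℕₚ.*-distribˡ-+ (isLeaf v) _ (deg β v)))
          where
          at : ∀ u → δ v u * isLeaf u ≡ isLeaf v * (δ v u * 1)
          at u with v Finₚ.≟ u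
          ... | yes refl = ℕₚ.*-comm 1 (isLeaf v)
          ... | no _     = sym (ℕₚ.*-zeroʳ (isLeaf v))
          edge : weight (isLeaf ∘ lo) (isLeaf ∘ hi) v e ≡ isLeaf v * weight (λ _ → 1) (λ _ → 1) v e
          edge = trans (cong₂ _+_ (at (lo e)) (at (hi e))) (sym (ℕₚ.*-distribˡ-+ (isLeaf v) _ _))

        neighbour-weight≤1 : ∀ v e → weight (isLeaf ∘ hi) (isLeaf ∘ lo) v e ≤ 1
        neighbour-weight≤1 v e with v ∈ᵉ? e
        ... | no v∉e = subst (_≤ 1) (sym (weight-∉ (isLeaf ∘ hi) (isLeaf ∘ lo) v e v∉e)) z≤n
        ... | yes (at-lo refl) rewrite δ-refl (lo e) | δ-≢ (lo≢hi e) | ℕₚ.+-identityʳ (isLeaf (hi e)) | ℕₚ.+-identityʳ (isLeaf (hi e)) = isLeaf≤1 (hi e)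
        ... | yes (at-hi refl) rewrite δ-refl (hi e) | δ-≢ (lo≢hi e ∘ sym) | ℕₚ.+-identityʳ (isLeaf (lo e)) = isLeaf≤1 (lo e)

        leaf-end : ∀ v e → 0 < weight (isLeaf ∘ hi) (isLeaf ∘ lo) v e → v ∈ᵉ e × ∃ λ u → u ≢ v × u ∈ᵉ e × deg α u ≡ 1
        leaf-end v e 0<w with v ∈ᵉ? e
        ... | no v∉e = contradiction (sym (weight-∉ (isLeaf ∘ hi) (isLeaf ∘ lo) v e v∉e)) (ℕₚ.<⇒≢ 0<w)
        ... | yes (at-lo refl) rewrite δ-refl (lo e) | δ-≢ (lo≢hi e) | ℕₚ.+-identityʳ (isLeaf (hi e)) | ℕₚ.+-identityʳ (isLeaf (hi e)) =
          at-lo refl , hi e , lo≢hi e ∘ sym , at-hi refl , isLeaf⇒ (hi e) 0<w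
        ... | yes (at-hi refl) rewrite δ-refl (hi e) | δ-≢ (lo≢hi e ∘ sym) | ℕₚ.+-identityʳ (isLeaf (lo e)) =
          at-hi refl , lo e , lo≢hi e , at-lo refl , isLeaf⇒ (lo e) 0<w

        leafNeighbour : ∀ v β → 0 < leafNeighbours β v →
                        ∃₂ λ e β′ → β ↭ e ∷ β′ × leafNeighbours β v ≤ suc (leafNeighbours β′ v) ×
                          v ∈ᵉ e × ∃ λ u → u ≢ v × u ∈ᵉ e × deg α u ≡ 1
        leafNeighbour v β 0<s with sumℕ-positive _ β 0<s
        ... | e , β′ , β↭e∷β′ , 0<w = e , β′ , β↭e∷β′ ,
          ℕₚ.≤-trans (ℕₚ.≤-reflexive (sumℕ-↭ _ β↭e∷β′)) (ℕₚ.+-monoˡ-≤ _ (neighbour-weight≤1 v e)) , leaf-end v e 0<w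

        -- Two adjacent leaves form a component with a single edge, so exchanging them would be an
        -- automorphism.
        no-leaf-pair : ∀ v → deg α v ≡ 1 → leafNeighbours α v ≡ 0
        no-leaf-pair v v-leaf with leafNeighbours α v in eq
        ... | zero  = refl
        ... | suc _ with leafNeighbour v α (subst (0 <_) (sym eq) (s≤s z≤n))
        ...   | e , β , α↭e∷β , _ , v∈e , u , u≢v , u∈e , u-leaf = contradiction
          (fixedBy-↭ (swapPerm u v) α↭e∷β (↭-reflexive (cong₂ _∷_
            (pair-unique u≢v (subst (_∈ᵉ (swapPerm u v · e)) (swapTo-y u v) (∈-· (swapPerm u v) {e = e} v∈e))
                             (subst (_∈ᵉ (swapPerm u v · e)) (swapTo-x u v) (∈-· (swapPerm u v) {e = e} u∈e)) u∈e v∈e)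
            (swap-avoids u v β (deg-tail u α↭e∷β u∈e u-leaf) (deg-tail v α↭e∷β v∈e v-leaf)))))
          (asymmetric u v u≢v)

        -- Two leaves hanging on the same vertex could be exchanged. They are distinct, since a leaf
        -- lies on one edge only.
        no-twins : ∀ v → leafNeighbours α v ≤ 1
        no-twins v with leafNeighbours α v in eq
        ... | 0 = z≤n
        ... | 1 = ℕₚ.≤-refl
        ... | suc (suc _) with leafNeighbour v α (subst (0 <_) (sym eq) (s≤s z≤n))
        ...   | e , β , α↭e∷β , s≤ , v∈e , u , u≢v , u∈e , u-leaf with leafNeighbour v β (ℕₚ.≤-pred (ℕₚ.≤-trans (s≤s (s≤s z≤n)) (subst (_≤ suc (leafNeighbours β v)) eq s≤)))
        ...     | f , γ , β↭f∷γ , _ , v∈f , w , w≢v , w∈f , w-leaf =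
          contradiction (fixedBy-↭ (swapPerm u w) α↭e∷f∷γ exchange) (asymmetric u w u≢w)
          where
          α↭e∷f∷γ : α ↭ e ∷ f ∷ γ
          α↭e∷f∷γ = ↭-trans α↭e∷β (prep e β↭f∷γ)
          α↭f∷e∷γ : α ↭ f ∷ e ∷ γ
          α↭f∷e∷γ = ↭-trans α↭e∷f∷γ (swap e f ↭-refl)
          u≢w : u ≢ w
          u≢w refl = deg-zero u (f ∷ γ) (deg-tail u α↭e∷f∷γ u∈e u-leaf) (here refl) w∈f
          zero-tail : ∀ x g → deg (g ∷ γ) x ≡ 0 → deg γ x ≡ 0
          zero-tail x g eq = trans (sym (deg-∷-∉ {x} {g} γ (deg-zero x (g ∷ γ) eq (here refl)))) eq
          exchange : (e ∷ f ∷ γ) fixedBy swapPerm u w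
          exchange = ↭-trans (↭-reflexive (cong₂ _∷_
            (pair-unique w≢v (subst (_∈ᵉ (swapPerm u w · e)) (swapTo-x u w) (∈-· (swapPerm u w) {e = e} u∈e))
                             (subst (_∈ᵉ (swapPerm u w · e)) (swapTo-z (u≢v ∘ sym) (w≢v ∘ sym)) (∈-· (swapPerm u w) {e = e} v∈e)) w∈f v∈f)
            (cong₂ _∷_
              (pair-unique u≢v (subst (_∈ᵉ (swapPerm u w · f)) (swapTo-y u w) (∈-· (swapPerm u w) {e = f} w∈f))
                               (subst (_∈ᵉ (swapPerm u w · f)) (swapTo-z (u≢v ∘ sym) (w≢v ∘ sym)) (∈-· (swapPerm u w) {e = f} v∈f)) u∈e v∈e)
              (swap-avoids u w γ (zero-tail u f (deg-tail u α↭e∷f∷γ u∈e u-leaf)) (zero-tail w e (deg-tail w α↭f∷e∷γ w∈f w-leaf))))))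
            (swap f e ↭-refl)

        one-isolated : sumℕ isolated (allFin n) ≤ 1
        one-isolated = sumℕ-one (Uniqueₚ.allFin⁺ n) (is-0≤1 ∘ deg α) λ {v} {w} v≢w v-isolated w-isolated →
          asymmetric v w v≢w (↭-reflexive (swap-avoids v w α (is-0⇒ (deg α v) v-isolated) (is-0⇒ (deg α w) w-isolated)))

        local : ∀ v → 3 + leafNeighbours α v ≤ 2 * deg α v + leafEdges α v + 3 * isolated v
        local v = subst (λ l → 3 + leafNeighbours α v ≤ 2 * deg α v + l + 3 * isolated v) (sym (leafEdges≡ α v))
          (charge (deg α v) (leafNeighbours α v) no-edge (no-leaf-pair v) (no-twins v))
          where
          no-edge : deg α v ≡ 0 → leafNeighbours α v ≡ 0
          no-edge deg≡0 = sumℕ-≡0 α λ {e} e∈α → weight-∉ (isLeaf ∘ hi) (isLeaf ∘ lo) v e (deg-zero v α deg≡0 e∈α)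

      -- Discharging: a leaf takes one unit from the vertex it hangs on, after
      -- which all but one vertex have charge at least 3.
      asymmetric-size : 3 * n ≤ 4 * length α + 3
      asymmetric-size = ℕₚ.+-cancelʳ-≤ neighbours (3 * n) (4 * length α + 3) (begin
        3 * n + neighbours
          ≡⟨ cong (λ m → 3 * m + neighbours) (length-tabulate {n = n} id) ⟨
        3 * length (allFin n) + neighbours
          ≡⟨ cong (_+ neighbours) (sumℕ-const 3 (allFin n)) ⟨
        sumℕ (λ _ → 3) (allFin n) + neighbours
          ≡⟨ sumℕ-+ (λ _ → 3) (leafNeighbours α) (allFin n) ⟨
        sumℕ (λ v → 3 + leafNeighbours α v) (allFin n)
          ≤⟨ sumℕ-mono local (allFin n) ⟩
        sumℕ (λ v → 2 * deg α v + leafEdges α v + 3 * isolated v) (allFin n)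
          ≡⟨ trans (sumℕ-+ _ _ (allFin n)) (cong₂ _+_ (trans (sumℕ-+ _ _ (allFin n)) (cong (_+ sumℕ (leafEdges α) (allFin n)) (sumℕ-* 2 (deg α) (allFin n)))) (sumℕ-* 3 isolated (allFin n))) ⟩
        2 * sumℕ (deg α) (allFin n) + sumℕ (leafEdges α) (allFin n) + 3 * sumℕ isolated (allFin n)
          ≤⟨ ℕₚ.+-monoʳ-≤ _ (ℕₚ.*-monoʳ-≤ 3 one-isolated) ⟩
        2 * sumℕ (deg α) (allFin n) + sumℕ (leafEdges α) (allFin n) + 3
          ≡⟨ cong₂ (λ s t → 2 * s + t + 3) (trans (sum-tally _ _ α) (sumℕ-const 2 α))
               (trans (sum-tally (isLeaf ∘ lo) (isLeaf ∘ hi) α) (trans (sumℕ-cong (λ e → ℕₚ.+-comm (isLeaf (lo e)) _) α) (sym (sum-tally (isLeaf ∘ hi) (isLeaf ∘ lo) α)))) ⟩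
        2 * (2 * length α) + neighbours + 3
          ≡⟨ solve 2 (λ a b → con 2 :* (con 2 :* a) :+ b :+ con 3 := con 4 :* a :+ con 3 :+ b) refl (length α) neighbours ⟩
        4 * length α + 3 + neighbours ∎)
        where
        open ℕₚ.≤-Reasoning
        open ℕSolver.+-*-Solver
        neighbours : ℕ
        neighbours = sumℕ (leafNeighbours α) (allFin n)

    -- The contrapositive of `asymmetric-size`; the transposition itself is found by searching the
    -- finitely many choices of `i` and `k`.
    small-symmetric : ∀ α → 4 * length α + 3 < 3 * n → ∃₂ λ i k → i ≢ k × α fixedBy swapPerm i k
    small-symmetric α small with Finₚ.any? (λ i → Finₚ.any? (λ k → ¬? (i Finₚ.≟ k) ×-dec (_↭?_ _≟ᴾ_ (map (swapPerm i k ·_) α) α)))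
    ... | yes found = found
    ... | no none   = contradiction (asymmetric-size α λ i k i≢k fix → none (i , k , i≢k , fix)) (ℕₚ.<⇒≱ small)

  -- Extremal multigraphs, all of whose automorphisms are even on the pairs

  module _ {n : ℕ} where

    deg-permute : ∀ (σ : Permutation′ n) α v → deg (map (σ ·_) α) (to σ v) ≡ deg α v
    deg-permute σ []      v = refl
    deg-permute σ (e ∷ α) v with v ∈ᵉ? e
    ... | yes v∈e = trans (deg-∷-∈ {v = to σ v} {σ · e} (map (σ ·_) α) (∈-· σ {e = e} v∈e))
                      (trans (cong suc (deg-permute σ α v)) (sym (deg-∷-∈ {v = v} {e} α v∈e)))
    ... | no v∉e  = trans (deg-∷-∉ {v = to σ v} {σ · e} (map (σ ·_) α) σv∉)
                      (trans (deg-permute σ α v) (sym (deg-∷-∉ {v = v} {e} α v∉e)))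
      where
      σv∉ : ¬ (to σ v ∈ᵉ (σ · e))
      σv∉ σv∈ with third-end (∈-· σ {e = e} (at-lo refl)) (∈-· σ {e = e} (at-hi refl)) (lo≢hi e ∘ to-injective σ) σv∈
      ... | inj₁ eq = v∉e (at-lo (to-injective σ eq))
      ... | inj₂ eq = v∉e (at-hi (to-injective σ eq))

    -- These graphs have as many leaves as vertices of degree at least 2, as in
    -- the equality case of asymmetric-size.
    record Matched (γ : List (Pair n)) : Set where
      field
        mate            : Fin n → Fin n
        mate-involutive : ∀ v → mate (mate v) ≡ v
        isolated-unique : ∀ v w → deg γ v ≡ 0 → deg γ w ≡ 0 → v ≡ w
        mate-leaf       : ∀ v → deg γ v ≡ 1 → 2 ≤ deg γ (mate v)
        mate-hub        : ∀ v → 2 ≤ deg γ v → deg γ (mate v) ≡ 1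
        leaf-edge       : ∀ v → deg γ v ≡ 1 → ∀ {e} → e ∈ γ → v ∈ᵉ e → mate v ∈ᵉ e

      matePerm : Permutation′ n
      matePerm = mk↔ₛ′ mate mate mate-involutive mate-involutive

      -- An automorphism acts on the leaves as it does on their mates, so it is
      -- the product of two permutations conjugate under the matching.
      module _ (τ : Permutation′ n) (fix : γ fixedBy τ) where

        private
          deg-τ : ∀ v → deg γ (to τ v) ≡ deg γ v
          deg-τ v = trans (sym (sumℕ-↭ _ fix)) (deg-permute τ γ v)

          deg-τ⁻¹ : ∀ v → deg γ (from τ v) ≡ deg γ v
          deg-τ⁻¹ v = trans (sym (deg-τ (from τ v))) (cong (deg γ) (Inverse.strictlyInverseˡ τ v))

          -- The edge from the leaf `v` to its mate goes to an edge at the leaf `to τ v`, with ends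
          -- `to τ v` and `to τ (mate v)`. The mate of a leaf is not a leaf, hence it is the second
          -- end.
          mate-τ-leaf : ∀ v → deg γ v ≡ 1 → mate (to τ v) ≡ to τ (mate v)
          mate-τ-leaf v leaf with deg-positive {v = v} γ (subst (0 <_) (sym leaf) (s≤s z≤n))
          ... | e , e∈γ , v∈e with third-end (∈-· τ {e = e} v∈e) (∈-· τ {e = e} (leaf-edge v leaf e∈γ v∈e))
                (λ eq → mate≢ (to-injective τ eq))
                (leaf-edge (to τ v) (trans (deg-τ v) leaf) (↭ₚ.∈-resp-↭ fix (∈-map⁺ (τ ·_) e∈γ)) (∈-· τ {e = e} v∈e))
            where
            mate≢ : v ≢ mate v
            mate≢ eq with mate-leaf v leaf
            ... | 2≤ rewrite sym eq | leaf with s≤s () ← 2≤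
          ...   | inj₂ eq = eq
          ...   | inj₁ eq with mate-leaf (to τ v) (trans (deg-τ v) leaf)
          ...     | 2≤ rewrite eq | deg-τ v | leaf with s≤s () ← 2≤

          isHub? : ∀ v → Dec (2 ≤ deg γ v)
          isHub? v = 2 ℕₚ.≤? deg γ v

          onHubs : (Fin n → Fin n) → Fin n → Fin n
          onHubs f v with isHub? v
          ... | yes _ = f v
          ... | no _  = v

          onHubs-hub : ∀ f v → 2 ≤ deg γ v → onHubs f v ≡ f v
          onHubs-hub f v hub with isHub? v
          ... | yes _   = refl
          ... | no ¬hub = contradiction hub ¬hub

          onHubs-other : ∀ f v → ¬ (2 ≤ deg γ v) → onHubs f v ≡ v
          onHubs-other f v ¬hub with isHub? v
          ... | yes hub = contradiction hub ¬hub
          ... | no _    = refl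

          onHubs-inverse : ∀ {f g} → (∀ v → f (g v) ≡ v) → (∀ v → deg γ (g v) ≡ deg γ v) → ∀ v → onHubs f (onHubs g v) ≡ v
          onHubs-inverse {f} {g} fg deg-g v with isHub? v
          ... | yes hub = trans (onHubs-hub f (g v) (subst (2 ≤_) (sym (deg-g v)) hub)) (fg v)
          ... | no ¬hub = onHubs-other f v ¬hub

        hubPart : Permutation′ n
        hubPart = mk↔ₛ′ (onHubs (to τ)) (onHubs (from τ))
          (onHubs-inverse (Inverse.strictlyInverseˡ τ) deg-τ⁻¹) (onHubs-inverse (Inverse.strictlyInverseʳ τ) deg-τ)

        -- `hubPart` moves the vertices of degree at least 2, its conjugate under `mate` moves the
        -- leaves. Both `hubPart` and `mate` occur twice, so that their signs on the pairs cancel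
        -- and need not be known.
        automorphism-splits : ∀ v → to τ v ≡ to hubPart (mate (to hubPart (mate v)))
        automorphism-splits v = sym (go (deg γ v) refl)
          where
          ¬2≤1 : ¬ (2 ≤ 1)
          ¬2≤1 (s≤s ())

          hub : ∀ {d} → deg γ v ≡ suc (suc d) → 2 ≤ deg γ v
          hub d≡ = subst (2 ≤_) (sym d≡) (s≤s (s≤s z≤n))

          go : ∀ d → deg γ v ≡ d → to hubPart (mate (to hubPart (mate v))) ≡ to τ v
          go 0 d≡ = trans (cong (λ w → onHubs (to τ) (mate (onHubs (to τ) w))) mate-isolated)
            (trans (cong (onHubs (to τ) ∘ mate) (onHubs-other (to τ) v ¬hub)) (trans (cong (onHubs (to τ)) mate-isolated)
              (trans (onHubs-other (to τ) v ¬hub) (isolated-unique v (to τ v) d≡ (trans (deg-τ v) d≡)))))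
            where
            ¬hub : ¬ (2 ≤ deg γ v)
            ¬hub 2≤ rewrite d≡ with () ← 2≤
            cases : ∀ d → deg γ (mate v) ≡ d → deg γ (mate v) ≡ 0
            cases 0 eq = eq
            cases 1 eq with mate-leaf (mate v) eq
            ... | 2≤ rewrite mate-involutive v | d≡ with () ← 2≤
            cases (suc (suc _)) eq with mate-hub (mate v) (subst (2 ≤_) (sym eq) (s≤s (s≤s z≤n)))
            ... | eq′ rewrite mate-involutive v | d≡ with () ← eq′
            mate-isolated : mate v ≡ v
            mate-isolated = isolated-unique (mate v) v (cases (deg γ (mate v)) refl) d≡
          go 1 d≡ rewrite onHubs-hub (to τ) (mate v) (mate-leaf v d≡) | sym (mate-τ-leaf v d≡) | mate-involutive (to τ v) =
            onHubs-other (to τ) (to τ v) λ 2≤ → ¬2≤1 (subst (2 ≤_) (trans (deg-τ v) d≡) 2≤)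
          go (suc (suc _)) d≡ rewrite onHubs-other (to τ) (mate v) (λ 2≤ → ¬2≤1 (subst (2 ≤_) (mate-hub v (hub d≡)) 2≤))
                                    | mate-involutive v = onHubs-hub (to τ) v (hub d≡)

  open Matched

  -- The two inequalities say that the number of edges is ⌊3n/4⌋, which is `μ n` for odd `n`.
  record TightGraph (n : ℕ) : Set where
    field
      graph   : List (Pair n)
      matched : Matched graph
      lower   : 4 * length graph ≤ 3 * n
      upper   : 3 * n < 4 * length graph + 4

  open TightGraph

  -- Disjoint union with a path 0 1 2 3, whose leaves are matched with its inner vertices. The 4
  -- vertices and 3 edges add 12 to both sides of each inequality.
  addPath : ∀ {n} → TightGraph n → TightGraph (4 + n)
  addPath {n} T = record
    { graph   = γ
    ; matched = record
      { mate = mate′ ; mate-involutive = mate′-involutive ; isolated-unique = isolated-unique′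
      ; mate-leaf = mate-leaf′ ; mate-hub = mate-hub′ ; leaf-edge = leaf-edge′ }
    ; lower   = ≡.subst₂ _≤_ length-eq (sym (ℕₚ.*-distribˡ-+ 3 4 n)) (ℕₚ.+-monoʳ-≤ 12 (lower T))
    ; upper   = ≡.subst₂ _<_ (sym (ℕₚ.*-distribˡ-+ 3 4 n)) (trans (sym (ℕₚ.+-assoc 12 (4 * length (graph T)) 4)) (cong (_+ 4) length-eq)) (ℕₚ.+-monoʳ-< 12 (upper T))
    }
    where
    M : Matched (graph T)
    M = matched T

    shift4 : Pair n → Pair (4 + n)
    shift4 = shiftPair ∘ shiftPair ∘ shiftPair ∘ shiftPair

    pattern old v = suc (suc (suc (suc v)))

    e₀ e₁ e₂ : Pair (4 + n)
    e₀ = mkPair 0F 1F (s≤s z≤n)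
    e₁ = mkPair 1F 2F (s≤s (s≤s z≤n))
    e₂ = mkPair 2F 3F (s≤s (s≤s (s≤s z≤n)))

    γ : List (Pair (4 + n))
    γ = e₀ ∷ e₁ ∷ e₂ ∷ map shift4 (graph T)

    length-eq : 12 + 4 * length (graph T) ≡ 4 * length γ
    length-eq = trans (cong (λ l → 12 + 4 * l) (sym (length-map shift4 (graph T)))) (sym (ℕₚ.*-distribˡ-+ 4 3 (length (map shift4 (graph T)))))

    deg-old : ∀ α v → deg (map shift4 α) (old v) ≡ deg α v
    deg-old []      v = refl
    deg-old (e ∷ α) v = cong (weight (λ _ → 1) (λ _ → 1) v e +_) (deg-old α v)

    deg-new : ∀ α v → (∀ w → v ≢ old w) → deg (map shift4 α) v ≡ 0
    deg-new []      v new = refl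
    deg-new (e ∷ α) v new = cong₂ _+_ (weight-∉ (λ _ → 1) (λ _ → 1) v (shift4 e) (λ { (at-lo eq) → new (lo e) eq ; (at-hi eq) → new (hi e) eq })) (deg-new α v new)

    deg-γ-old : ∀ v → deg γ (old v) ≡ deg (graph T) v
    deg-γ-old v = deg-old (graph T) v

    deg-γ-0 : deg γ 0F ≡ 1
    deg-γ-0 = cong suc (deg-new (graph T) 0F λ _ ())
    deg-γ-1 : deg γ 1F ≡ 2
    deg-γ-1 = cong (2 +_) (deg-new (graph T) 1F λ _ ())
    deg-γ-2 : deg γ 2F ≡ 2
    deg-γ-2 = cong (2 +_) (deg-new (graph T) 2F λ _ ())
    deg-γ-3 : deg γ 3F ≡ 1
    deg-γ-3 = cong suc (deg-new (graph T) 3F λ _ ())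

    mate′ : Fin (4 + n) → Fin (4 + n)
    mate′ 0F = 1F
    mate′ 1F = 0F
    mate′ 2F = 3F
    mate′ 3F = 2F
    mate′ (old v) = old (mate M v)

    mate′-involutive : ∀ v → mate′ (mate′ v) ≡ v
    mate′-involutive 0F = refl
    mate′-involutive 1F = refl
    mate′-involutive 2F = refl
    mate′-involutive 3F = refl
    mate′-involutive (old v) = cong (λ w → old w) (mate-involutive M v)

    nonzero : ∀ {d k} → d ≡ suc k → ¬ (d ≡ 0)
    nonzero refl ()

    isolated-unique′ : ∀ v w → deg γ v ≡ 0 → deg γ w ≡ 0 → v ≡ w
    isolated-unique′ 0F _ p _ = contradiction p (nonzero deg-γ-0)
    isolated-unique′ 1F _ p _ = contradiction p (nonzero deg-γ-1)
    isolated-unique′ 2F _ p _ = contradiction p (nonzero deg-γ-2)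
    isolated-unique′ 3F _ p _ = contradiction p (nonzero deg-γ-3)
    isolated-unique′ (old v) 0F _ q = contradiction q (nonzero deg-γ-0)
    isolated-unique′ (old v) 1F _ q = contradiction q (nonzero deg-γ-1)
    isolated-unique′ (old v) 2F _ q = contradiction q (nonzero deg-γ-2)
    isolated-unique′ (old v) 3F _ q = contradiction q (nonzero deg-γ-3)
    isolated-unique′ (old v) (old w) p q =
      cong (λ u → old u) (isolated-unique M v w (trans (sym (deg-γ-old v)) p) (trans (sym (deg-γ-old w)) q))

    mate-leaf′ : ∀ v → deg γ v ≡ 1 → 2 ≤ deg γ (mate′ v)
    mate-leaf′ 0F _ = ℕₚ.≤-reflexive (sym deg-γ-1)
    mate-leaf′ 1F p with () ← trans (sym deg-γ-1) p
    mate-leaf′ 2F p with () ← trans (sym deg-γ-2) p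
    mate-leaf′ 3F _ = ℕₚ.≤-reflexive (sym deg-γ-2)
    mate-leaf′ (old v) p = subst (2 ≤_) (sym (deg-γ-old (mate M v))) (mate-leaf M v (trans (sym (deg-γ-old v)) p))

    mate-hub′ : ∀ v → 2 ≤ deg γ v → deg γ (mate′ v) ≡ 1
    mate-hub′ 0F p with s≤s () ← subst (2 ≤_) deg-γ-0 p
    mate-hub′ 1F _ = deg-γ-0
    mate-hub′ 2F _ = deg-γ-3
    mate-hub′ 3F p with s≤s () ← subst (2 ≤_) deg-γ-3 p
    mate-hub′ (old v) p = trans (deg-γ-old (mate M v)) (mate-hub M v (subst (2 ≤_) (deg-γ-old v) p))

    ∈-shift4 : ∀ {v e} → v ∈ᵉ e → old v ∈ᵉ shift4 e
    ∈-shift4 (at-lo refl) = at-lo refl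
    ∈-shift4 (at-hi refl) = at-hi refl

    ∈-shift4⁻ : ∀ {v e} → old v ∈ᵉ shift4 e → v ∈ᵉ e
    ∈-shift4⁻ (at-lo refl) = at-lo refl
    ∈-shift4⁻ (at-hi refl) = at-hi refl

    leaf-edge′ : ∀ v → deg γ v ≡ 1 → ∀ {e} → e ∈ γ → v ∈ᵉ e → mate′ v ∈ᵉ e
    leaf-edge′ 0F _ (here refl) _ = at-hi refl
    leaf-edge′ 0F _ (there (here refl)) (at-lo ())
    leaf-edge′ 0F _ (there (here refl)) (at-hi ())
    leaf-edge′ 0F _ (there (there (here refl))) (at-lo ())
    leaf-edge′ 0F _ (there (there (here refl))) (at-hi ())
    leaf-edge′ 0F _ (there (there (there e∈))) v∈ with ∈-map⁻ shift4 e∈ | v∈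
    ... | _ , _ , refl | at-lo ()
    ... | _ , _ , refl | at-hi ()
    leaf-edge′ 1F p _ _ with () ← trans (sym deg-γ-1) p
    leaf-edge′ 2F p _ _ with () ← trans (sym deg-γ-2) p
    leaf-edge′ 3F _ (here refl) (at-lo ())
    leaf-edge′ 3F _ (here refl) (at-hi ())
    leaf-edge′ 3F _ (there (here refl)) (at-lo ())
    leaf-edge′ 3F _ (there (here refl)) (at-hi ())
    leaf-edge′ 3F _ (there (there (here refl))) _ = at-lo refl
    leaf-edge′ 3F _ (there (there (there e∈))) v∈ with ∈-map⁻ shift4 e∈ | v∈
    ... | _ , _ , refl | at-lo ()
    ... | _ , _ , refl | at-hi ()
    leaf-edge′ (old v) _ (here refl) (at-lo ())
    leaf-edge′ (old v) _ (here refl) (at-hi ())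
    leaf-edge′ (old v) _ (there (here refl)) (at-lo ())
    leaf-edge′ (old v) _ (there (here refl)) (at-hi ())
    leaf-edge′ (old v) _ (there (there (here refl))) (at-lo ())
    leaf-edge′ (old v) _ (there (there (here refl))) (at-hi ())
    leaf-edge′ (old v) p (there (there (there e∈))) v∈ with ∈-map⁻ shift4 e∈
    ... | _ , e∈γ , refl = ∈-shift4 (leaf-edge M v (trans (sym (deg-γ-old v)) p) e∈γ (∈-shift4⁻ v∈))

  oneVertex : TightGraph 1
  oneVertex = record
    { graph   = []
    ; matched = record
      { mate = id ; mate-involutive = λ _ → refl ; isolated-unique = λ { 0F 0F _ _ → refl }
      ; mate-leaf = λ _ () ; mate-hub = λ _ () ; leaf-edge = λ _ () }
    ; lower   = z≤n
    ; upper   = ℕₚ.≤-refl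
    }

  -- A path 1 2 3 with one leaf at each vertex, and the isolated vertex 0.
  sevenVertices : TightGraph 7
  sevenVertices = record
    { graph   = γ
    ; matched = record
      { mate            = mate₇
      ; mate-involutive = from-yes (Finₚ.all? λ v → mate₇ (mate₇ v) Finₚ.≟ v)
      ; isolated-unique = from-yes (Finₚ.all? λ v → Finₚ.all? λ w → (deg γ v ℕₚ.≟ 0) →-dec ((deg γ w ℕₚ.≟ 0) →-dec (v Finₚ.≟ w)))
      ; mate-leaf       = from-yes (Finₚ.all? λ v → (deg γ v ℕₚ.≟ 1) →-dec (2 ℕₚ.≤? deg γ (mate₇ v)))
      ; mate-hub        = from-yes (Finₚ.all? λ v → (2 ℕₚ.≤? deg γ v) →-dec (deg γ (mate₇ v) ℕₚ.≟ 1))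
      ; leaf-edge       = λ v p e∈ → All.lookup (leaf-edges v p) e∈
      }
    ; lower   = from-yes (20 ℕₚ.≤? 21)
    ; upper   = from-yes (22 ℕₚ.≤? 24)
    }
    where
    γ : List (Pair 7)
    γ = mkPair 1F 2F (from-yes (2 ℕₚ.≤? 2)) ∷ mkPair 2F 3F (from-yes (3 ℕₚ.≤? 3)) ∷ mkPair 1F 4F (from-yes (2 ℕₚ.≤? 4)) ∷
        mkPair 2F 5F (from-yes (3 ℕₚ.≤? 5)) ∷ mkPair 3F 6F (from-yes (4 ℕₚ.≤? 6)) ∷ []

    mate₇ : Fin 7 → Fin 7
    mate₇ 0F = 0F
    mate₇ 1F = 4F
    mate₇ 2F = 5F
    mate₇ 3F = 6F
    mate₇ 4F = 1F
    mate₇ 5F = 2F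
    mate₇ 6F = 3F

    leaf-edges : ∀ v → deg γ v ≡ 1 → All (λ e → v ∈ᵉ e → mate₇ v ∈ᵉ e) γ
    leaf-edges = from-yes (Finₚ.all? λ v → (deg γ v ℕₚ.≟ 1) →-dec All.all? (λ e → (v ∈ᵉ? e) →-dec (mate₇ v ∈ᵉ? e)) γ)

  -- The orders grow by 4, so each odd residue class needs its own start. A matched graph with 2
  -- edges on 3 vertices does not exist, whence the start at 7.
  tightGraph : ∀ h → TightGraph (5 + 2 * h)
  tightGraph zero          = addPath oneVertex
  tightGraph (suc zero)    = sevenVertices
  tightGraph (suc (suc h)) = subst TightGraph (solve 1 (λ h → con 4 :+ (con 5 :+ con 2 :* h) := con 5 :+ con 2 :* (con 2 :+ h)) refl h)
    (addPath (tightGraph h))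
    where open ℕSolver.+-*-Solver

-- Arithmetic of `μ n` and of iterated binomial coefficients

module _ where

  open import Data.Nat.Base using (_+_; _*_)

  C-suc : ∀ n → suc n C 2 ≡ n + n C 2
  C-suc n = trans (sym (nCk+nC[k+1]≡[n+1]C[k+1] n 1)) (cong (_+ n C 2) (nC1≡n n))

  length-before : ∀ {X : Set} (xs : List X) → length (Pairs.before xs) ≡ length xs C 2
  length-before []       = refl
  length-before (x ∷ xs) = trans (length-++ (map (x ,_) xs))
    (trans (cong₂ _+_ (length-map (x ,_) xs) (length-before xs)) (sym (C-suc (length xs))))

  parity : ∀ n → (∃ λ h → n ≡ 2 * h) ⊎ (∃ λ h → n ≡ suc (2 * h))
  parity zero          = inj₁ (0 , refl)
  parity (suc zero)    = inj₂ (0 , refl)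
  parity (suc (suc n)) with parity n
  ... | inj₁ (h , refl) = inj₁ (suc h , cong suc (sym (ℕₚ.+-suc h (h + 0))))
  ... | inj₂ (h , refl) = inj₂ (suc h , cong (λ k → suc (suc k)) (sym (ℕₚ.+-suc h (h + 0))))

  odd-∤ : ∀ h → ¬ (2 ∣ suc (2 * h))
  odd-∤ h 2∣ with ∣⇒≤ (∣m+n∣m⇒∣n (subst (2 ∣_) (ℕₚ.+-comm 1 (2 * h)) 2∣) (m∣m*n h))
  ... | s≤s ()

  μ-even : ∀ h → μ (2 * h) ≡ 0
  μ-even h = cong (λ b → if b then 0 else (3 * (2 * h ∸ 1) + 3) / 4) (dec-true (2 ∣? (2 * h)) (m∣m*n h))

  -- Since 3 (n - 1) + 3 = 3n, rounding up becomes rounding down: this is ⌊3n/4⌋, the number in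
  -- `TightGraph`.
  μ-odd : ∀ h → μ (suc (2 * h)) ≡ (3 * suc (2 * h)) / 4
  μ-odd h = trans (cong (λ b → if b then 0 else (3 * (2 * h) + 3) / 4) (dec-false (2 ∣? suc (2 * h)) (odd-∤ h)))
    (cong (_/ 4) (trans (ℕₚ.+-comm (3 * (2 * h)) 3) (sym (ℕₚ.*-suc 3 (2 * h)))))

  /4-unique : ∀ {a l} → 4 * l ≤ a → a < 4 * l + 4 → a / 4 ≡ l
  /4-unique {a} {l} lower upper = ℕₚ.≤-antisym
    (ℕₚ.≤-pred (m<n*o⇒m/o<n {a} {suc l} {4} (subst (a <_) (trans (ℕₚ.+-comm (4 * l) 4) (cong (4 +_) (ℕₚ.*-comm 4 l))) upper)))
    (subst (_≤ a / 4) (m*n/n≡m l 4) (/-monoˡ-≤ 4 (subst (_≤ a) (ℕₚ.*-comm 4 l) lower)))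

  below-μ : ∀ h {l} → l < μ (suc (2 * h)) → 4 * l + 3 < 3 * suc (2 * h)
  below-μ h {l} l<μ = begin-strict
    4 * l + 3                ≡⟨ ℕₚ.+-comm (4 * l) 3 ⟩
    3 + 4 * l                <⟨ ℕₚ.n<1+n _ ⟩
    4 + 4 * l                ≡⟨ ℕₚ.*-suc 4 l ⟨
    4 * suc l                ≤⟨ ℕₚ.*-monoʳ-≤ 4 (subst (l <_) (μ-odd h) l<μ) ⟩
    4 * (3n / 4)             ≡⟨ ℕₚ.*-comm 4 (3n / 4) ⟩
    (3n / 4) * 4             ≤⟨ m/n*n≤m 3n 4 ⟩
    3n                       ∎
    where
    open ℕₚ.≤-Reasoning
    3n : ℕ
    3n = 3 * suc (2 * h)

  μ≤ : ∀ n → μ n ≤ n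
  μ≤ n with parity n
  ... | inj₁ (h , refl) = subst (_≤ 2 * h) (sym (μ-even h)) z≤n
  ... | inj₂ (h , refl) = subst (_≤ k) (sym (μ-odd h))
    (ℕₚ.≤-trans (/-monoˡ-≤ 4 (subst (3 * k ≤_) (ℕₚ.*-comm 4 k) (ℕₚ.*-monoˡ-≤ k (s≤s (s≤s (s≤s (z≤n {1}))))))) (ℕₚ.≤-reflexive (m*n/n≡m k 4)))
    where
    k : ℕ
    k = suc (2 * h)

  n+2≤nC2 : ∀ {n} → 4 ≤ n → n + 2 ≤ n C 2
  n+2≤nC2 {n} 4≤n with ℕₚ.m≤n⇒∃[o]m+o≡n 4≤n
  ... | o , refl = go o
    where
    open ℕₚ.≤-Reasoning
    go : ∀ o → 4 + o + 2 ≤ (4 + o) C 2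
    go zero    = ℕₚ.≤-refl
    go (suc o) = begin
      4 + suc o + 2              ≡⟨ cong (λ k → 4 + k + 2) (ℕₚ.+-comm 1 o) ⟩
      4 + (o + 1) + 2            ≡⟨ solve 1 (λ o → con 4 :+ (o :+ con 1) :+ con 2 := con 1 :+ (con 4 :+ o :+ con 2)) refl o ⟩
      1 + (4 + o + 2)            ≤⟨ ℕₚ.+-mono-≤ (s≤s (z≤n {3 + o})) (go o) ⟩
      4 + o + (4 + o) C 2        ≡⟨ C-suc (4 + o) ⟨
      (5 + o) C 2                ≡⟨ cong (_C 2) (ℕₚ.+-suc 4 o) ⟨
      (4 + suc o) C 2            ∎
      where open ℕSolver.+-*-Solver

  2m≤mC2 : ∀ {m} → 5 ≤ m → 2 * m ≤ m C 2
  2m≤mC2 {m} 5≤m with ℕₚ.m≤n⇒∃[o]m+o≡n 5≤m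
  ... | o , refl = go o
    where
    open ℕₚ.≤-Reasoning
    go : ∀ o → 2 * (5 + o) ≤ (5 + o) C 2
    go zero    = ℕₚ.≤-refl
    go (suc o) = begin
      2 * (5 + suc o)            ≡⟨ cong (2 *_) (ℕₚ.+-suc 5 o) ⟩
      2 * suc (5 + o)            ≡⟨ ℕₚ.*-suc 2 (5 + o) ⟩
      2 + 2 * (5 + o)            ≤⟨ ℕₚ.+-mono-≤ (s≤s (s≤s (z≤n {3 + o}))) (go o) ⟩
      5 + o + (5 + o) C 2        ≡⟨ C-suc (5 + o) ⟨
      (6 + o) C 2                ≡⟨ cong (_C 2) (ℕₚ.+-suc 5 o) ⟨
      (5 + suc o) C 2            ∎

  -- The elementary symmetric polynomials, of degree up to m, are among the generators and must
  -- respect the bound. It holds because m ≥ 5 gives 2m ≤ m C 2, and μ n ≤ n ≤ m.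
  m≤D∸μ : ∀ {n} → 4 ≤ n → n C 2 ≤ (n C 2) C 2 ∸ μ n
  m≤D∸μ {n} 4≤n = begin
    m                      ≡⟨ ℕₚ.m+n∸n≡m m m ⟨
    m + m ∸ m              ≤⟨ ℕₚ.∸-monoʳ-≤ (m + m) (ℕₚ.≤-trans (μ≤ n) n≤m) ⟩
    m + m ∸ μ n            ≡⟨ cong (λ k → m + k ∸ μ n) (ℕₚ.+-identityʳ m) ⟨
    2 * m ∸ μ n            ≤⟨ ℕₚ.∸-monoˡ-≤ (μ n) (2m≤mC2 (ℕₚ.≤-trans (ℕₚ.≤-trans (s≤s (s≤s (s≤s (s≤s (s≤s z≤n))))) (ℕₚ.+-monoˡ-≤ 2 4≤n)) (n+2≤nC2 4≤n))) ⟩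
    m C 2 ∸ μ n            ∎
    where
    open ℕₚ.≤-Reasoning
    m : ℕ
    m = n C 2
    n≤m : n ≤ m
    n≤m = ℕₚ.≤-trans (ℕₚ.m≤m+n n 2) (n+2≤nC2 4≤n)

  even-∸2 : ∀ h → 4 ≤ 2 * h → ∃ λ g → 2 * h ∸ 2 ≡ 2 * g
  even-∸2 (suc h) _ = h , cong (_∸ 1) (ℕₚ.+-suc h (h + 0))

  odd-∸2 : ∀ h → 4 ≤ suc (2 * h) → ∃ λ g → suc (2 * h) ∸ 2 ≡ suc (2 * g)
  odd-∸2 zero    (s≤s ())
  odd-∸2 (suc h) _ = h , ℕₚ.+-suc h (h + 0)

  ∸-<⇒<-+ : ∀ m n {o} → m ∸ n < o → m < n + o
  ∸-<⇒<-+ m n m∸n<o = ℕₚ.≤-<-trans (ℕₚ.m≤n+m∸n m n) (ℕₚ.+-monoʳ-< n m∸n<o)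

  <-∸⇒+-< : ∀ {m} n o → m < n ∸ o → m + o < n
  <-∸⇒+-< n       zero    m<n   = subst (_< n) (sym (ℕₚ.+-identityʳ _)) m<n
  <-∸⇒+-< (suc n) (suc o) m<n∸o = subst (_< suc n) (sym (ℕₚ.+-suc _ o)) (s≤s (<-∸⇒+-< n o m<n∸o))


-- Invariants of the vertex permutations; number and degrees of the secondary invariants

module SymmetricSumMap {c ℓ c′ ℓ′} (S : CommutativeRing c ℓ) (S′ : CommutativeRing c′ ℓ′)
  (h : CommutativeRing.Carrier S → CommutativeRing.Carrier S′)
  (h-cong : ∀ {p q} → CommutativeRing._≈_ S p q → CommutativeRing._≈_ S′ (h p) (h q))
  (h-+ : ∀ p q → CommutativeRing._≈_ S′ (h (CommutativeRing._+_ S p q)) (CommutativeRing._+_ S′ (h p) (h q))) where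

  private
    module S  = CommutativeRing S
    module S′ = CommutativeRing S′
  open RingProps S′.ring using (+-identityʳ-unique)

  h-0 : h S.0# S′.≈ S′.0#
  h-0 = +-identityʳ-unique (h S.0#) (h S.0#) (S′.trans (S′.sym (h-+ _ _)) (h-cong (S.+-identityʳ _)))

  h-neg : ∀ p → h (S.- p) S′.≈ S′.- h p
  h-neg p = +-inverseˡ-unique (h (S.- p)) (h p) (S′.trans (S′.sym (h-+ _ _)) (S′.trans (h-cong (S.-‿inverseˡ p)) h-0))
    where open RingProps S′.ring using (+-inverseˡ-unique)

  h-sumL : ∀ {a} {Y : Set a} (f : Y → S.Carrier) ys → h (ListSums.sumL S f ys) S′.≈ ListSums.sumL S′ (h ∘ f) ys
  h-sumL f []       = h-0
  h-sumL f (y ∷ ys) = S′.trans (h-+ _ _) (S′.+-congˡ (h-sumL f ys))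

  h-symSum : ∀ {n} xs F → h (SymmetricSum.symSum S S.1# (Finₚ._≟_ {n}) xs F) S′.≈
                          SymmetricSum.symSum S′ S′.1# (Finₚ._≟_ {n}) xs (h ∘ F)
  h-symSum []       F = S′.refl
  h-symSum {n} (x ∷ xs) F = S′.trans (h-+ _ _) (S′.+-cong (h-symSum xs F)
    (S′.trans (h-cong (S.*-identityˡ _)) (S′.trans (h-sumL (λ y → symSum xs (λ π → F (π ↔-∘ swapPerm x y))) xs)
      (S′.trans (ListSums.sumL-cong S′ xs λ y → h-symSum xs (λ π → F (π ↔-∘ swapPerm x y))) (S′.sym (S′.*-identityˡ _))))))
    where
    open SymmetricSum S S.1# (Finₚ._≟_ {n}) using (symSum)
    open Swaps (Finₚ._≟_ {n})

module GraphInvariants {c ℓ} (R : CommutativeRing c ℓ) (n : ℕ) (4≤n : 4 ℕ.≤ n)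
  (inverse : ∀ k → ∃ λ r → CommutativeRing._≈_ R
    (CommutativeRing._*_ R r (SemiringMult._×_ (CommutativeRing.semiring R) (suc k) (CommutativeRing.1# R))) (CommutativeRing.1# R))
  (nonzero : ∀ k → ¬ CommutativeRing._≈_ R (SemiringMult._×_ (CommutativeRing.semiring R) (suc k) (CommutativeRing.1# R)) (CommutativeRing.0# R))
  (S : CommutativeRing c ℓ) (V : GradedVariables R (Pair n) S) where

  private
    module R = CommutativeRing R
    module RM = SemiringMult R.semiring
    module RP = RingProps R.ring
  open GradedVariables V
  open CommutativeRing S hiding (zero) renaming (sym to ≈-sym; trans to ≈-trans; refl to ≈-refl)
  open RingProps ring
  open CSProps *-commutativeSemigroup using (x∙yz≈y∙xz; x∙yz≈z∙xy)
  open SemiringMult semiring using (×-assoc-*; ×-comm-*) renaming (_×_ to _×′_; ×-congʳ to ×′-congʳ; ×-assocˡ to ×′-assocˡ)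
  open import Relation.Binary.Reasoning.Setoid setoid
  open ListSums S
  open Subalgebra S κ
  module SwapsV = Swaps (Finₚ._≟_ {n})
  open SwapsV using (swapPerm; swapTo-x; swapTo-y; swapTo-z)
  module Sum⁺ = SymmetricSum S 1# (Finₚ._≟_ {n})
  module Sumᴿ = SymmetricSum R R.1# (Finₚ._≟_ {n})

  half : R.Carrier
  half = proj₁ (inverse 1)

  half-2 : half R.+ half R.≈ R.1#
  half-2 = R.trans (R.sym (R.trans (R.*-congˡ (R.+-congˡ (R.+-identityʳ _)))
    (R.trans (R.distribˡ _ _ _) (R.+-cong (R.*-identityʳ _) (R.*-identityʳ _))))) (proj₂ (inverse 1))

  open Antisymmetrization R half half-2 _≟ᴾ_ (allPairs n) (allPairs-unique n) allPairs-complete S V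
  open Pairs {Pair n} using (before; moved-forward)

  trace-map : ∀ {a} {Y : Set a} (f : Y → Carrier) ys → trace (sumL f ys) ≈ sumL (trace ∘ f) ys
  trace-map = SymmetricSumMap.h-sumL S S trace trace-cong trace-+

  trace-neg : ∀ p → trace (- p) ≈ - trace p
  trace-neg = SymmetricSumMap.h-neg S S trace trace-cong trace-+

  GInvariant : Carrier → Set ℓ
  GInvariant f = ∀ (σ : Permutation′ n) → act (σ ·_) f ≈ f

  act-·-∘ : ∀ (σ τ : Permutation′ n) f → act ((σ ↔-∘ τ) ·_) f ≈ act (σ ·_) (act (τ ·_) f)
  act-·-∘ σ τ f = ≈-trans (act-≗ (·-∘ σ τ) f) (≈-sym (act-∘ (σ ·_) (τ ·_) f))

  symmetric-GInvariant : ∀ {s} → Symmetric s → GInvariant s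
  symmetric-GInvariant s-sym σ = symmetric-invariant s-sym (pairPerm σ)

  vertices : List (Fin n)
  vertices = allFin n

  -- Summing over inverses makes `symSum-swap`, which concerns right translation, yield invariance
  -- under the left action.
  symmetrize : Carrier → Carrier
  symmetrize h = Sum⁺.symSum vertices (λ σ → act (↔-sym σ ·_) h)

  1*1≈1 : 1# * 1# ≈ 1#
  1*1≈1 = *-identityˡ 1#

  act-sumL : ∀ f {a} {Y : Set a} (g : Y → Carrier) ys → act f (sumL g ys) ≈ sumL (act f ∘ g) ys
  act-sumL f = SymmetricSumMap.h-sumL S S (act f) (act-cong f) (act-+ f)

  symmetrize-invariant : ∀ h → GInvariant (symmetrize h)
  symmetrize-invariant h = permutation-induction (λ σ → act (σ ·_) (symmetrize h) ≈ symmetrize h)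
    (λ {σ} {τ} σ≗τ eq → ≈-trans (act-≗ (λ e → ≡.sym (·-cong σ τ σ≗τ e)) _) eq)
    (≈-trans (act-≗ ·-id _) (act-id _))
    λ σ i k i≢k eq → ≈-trans (act-·-∘ σ (swapPerm i k) _) (≈-trans (act-cong _ (by-swap i k i≢k)) eq)
    where
    by-swap : ∀ i k → i ≢ k → act (swapPerm i k ·_) (symmetrize h) ≈ symmetrize h
    by-swap i k i≢k = begin
      act (swapPerm i k ·_) (symmetrize h)
        ≈⟨ SymmetricSumMap.h-symSum S S (act _) (act-cong _) (act-+ _) vertices _ ⟩
      Sum⁺.symSum vertices (λ σ → act (swapPerm i k ·_) (act (↔-sym σ ·_) h))
        ≈⟨ Sum⁺.symSum-cong vertices (λ σ → ≈-sym (act-·-∘ (swapPerm i k) (↔-sym σ) h)) ⟩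
      Sum⁺.symSum vertices (λ σ → act (↔-sym (σ ↔-∘ swapPerm i k) ·_) h)
        ≈⟨ Sum⁺.symSum-swap vertices {λ σ → act (↔-sym σ ·_) h} (Uniqueₚ.allFin⁺ n) 1*1≈1
             (λ σ τ σ≗τ → act-≗ (·-cong (↔-sym σ) (↔-sym τ) (from-≗ σ τ σ≗τ)) h) i≢k (∈-allFin i) (∈-allFin k) ⟩
      1# * symmetrize h
        ≈⟨ *-identityˡ _ ⟩
      symmetrize h ∎

  symmetrize-GInvariant : ∀ {f} → GInvariant f → symmetrize f ≈ (n !) ×′ f
  symmetrize-GInvariant {f} f-inv = begin
    symmetrize f                                         ≈⟨ Sum⁺.symSum-cong vertices (λ σ → f-inv (↔-sym σ)) ⟩
    Sum⁺.symSum vertices (λ _ → f)                       ≈⟨ Sum⁺.symSum-constant vertices {λ _ → f} (Uniqueₚ.allFin⁺ n) 1*1≈1 (λ _ _ _ _ → ≈-sym (*-identityˡ f)) ⟩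
    (length vertices !) ×′ f                             ≈⟨ reflexive (cong (λ k → (k !) ×′ f) (length-tabulate {n = n} id)) ⟩
    (n !) ×′ f                                           ∎

  symmetrize-cong : ∀ {f g} → f ≈ g → symmetrize f ≈ symmetrize g
  symmetrize-cong f≈g = Sum⁺.symSum-cong vertices λ σ → act-cong _ f≈g

  symmetrize-*ˡ : ∀ {s} h → GInvariant s → symmetrize (s * h) ≈ s * symmetrize h
  symmetrize-*ˡ {s} h s-inv = ≈-trans (Sum⁺.symSum-cong vertices λ σ → ≈-trans (act-* _ s h) (*-congʳ (s-inv (↔-sym σ))))
    (Sum⁺.symSum-*ˡ s vertices _)

  symmetrize-sumL : ∀ {a} {Y : Set a} (g : Y → Carrier) ys → symmetrize (sumL g ys) ≈ sumL (symmetrize ∘ g) ys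
  symmetrize-sumL g ys = ≈-trans (Sum⁺.symSum-cong vertices λ σ → act-sumL _ g ys) (Sum⁺.symSum-sumL vertices _ ys)

  -- The coefficients `trace (mon b * f)` are symmetric in all pairs, so the symmetrization passes
  -- through them and reaches only `mon c`.
  invariant-expansion : ∀ {f} → GInvariant f →
    (n !) ×′ f ≈ sumL (λ (b , r , c) → trace (mon b * f) * (κ r * symmetrize (mon c))) terms
  invariant-expansion {f} f-inv = begin
    (n !) ×′ f                                                                     ≈⟨ symmetrize-GInvariant f-inv ⟨
    symmetrize f                                                                   ≈⟨ symmetrize-cong (≈-sym (trace-expansion f)) ⟩
    symmetrize (sumL (λ (b , r , c) → trace (mon b * f) * (κ r * mon c)) terms)    ≈⟨ symmetrize-sumL _ terms ⟩
    sumL (λ (b , r , c) → symmetrize (trace (mon b * f) * (κ r * mon c))) terms    ≈⟨ sumL-cong terms (λ (b , r , c) →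
      ≈-trans (symmetrize-*ˡ _ (symmetric-GInvariant (trace-symmetric (mon b * f)))) (*-congˡ (symmetrize-*ˡ _ (λ σ → act-κ _ r)))) ⟩
    sumL (λ (b , r , c) → trace (mon b * f) * (κ r * symmetrize (mon c))) terms    ∎

  factors-cong : ∀ {u u′ v v′} → (∀ x → u x ≈ u′ x) → (∀ x → v x ≈ v′ x) → ∀ ps → factors u v ps ≈ factors u′ v′ ps
  factors-cong u≈ v≈ []             = ≈-refl
  factors-cong u≈ v≈ ((j , i) ∷ ps) = *-cong (+-cong (u≈ j) (-‿cong (v≈ i))) (factors-cong u≈ v≈ ps)

  -- The trace of the Reynolds operator, up to the factor n!.
  symmetrize-trace : sumL (λ (b , r , c) → trace (mon b * (κ r * symmetrize (mon c)))) terms ≈ ((n C 2) !) ×′ 1#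
  symmetrize-trace = begin
    sumL (λ (b , r , c) → trace (mon b * (κ r * symmetrize (mon c)))) terms
      ≈⟨ sumL-cong terms (λ (b , r , c) → ≈-trans
           (trace-cong (≈-trans (*-congˡ (≈-sym (Sum⁺.symSum-*ˡ (κ r) vertices _))) (≈-sym (Sum⁺.symSum-*ˡ (mon b) vertices _))))
           (SymmetricSumMap.h-symSum S S trace trace-cong trace-+ vertices _)) ⟩
    sumL (λ (b , r , c) → Sum⁺.symSum vertices (λ σ → trace (mon b * (κ r * act (↔-sym σ ·_) (mon c))))) terms
      ≈⟨ Sum⁺.symSum-sumL vertices _ terms ⟨
    Sum⁺.symSum vertices (λ σ → sumL (λ (b , r , c) → trace (mon b * (κ r * act (↔-sym σ ·_) (mon c)))) terms)
      ≈⟨ Sum⁺.symSum-cong vertices (λ σ → ≈-trans (≈-sym (trace-map _ terms)) (trace-cong (≈-trans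
           (sumL-cong terms λ (b , r , c) → *-congˡ (*-congˡ (act-mon _ c)))
           (kernel-factors var (var ∘ (↔-sym σ ·_)) (before (allPairs n)))))) ⟩
    Sum⁺.symSum vertices (λ σ → trace (factors var (var ∘ (↔-sym σ ·_)) (before (allPairs n))))
      ≈⟨ Sum⁺.symSum-identity vertices (Uniqueₚ.allFin⁺ n) (λ σ v moved → ≈-trans (trace-cong (vanish σ moved)) trace-0) ⟩
    trace (factors var (var ∘ (↔-sym (↔-id (Fin n)) ·_)) (before (allPairs n)))
      ≈⟨ trace-cong (factors-cong (λ _ → ≈-refl) (λ e → reflexive (cong var (≡.trans (·-cong (↔-sym (↔-id (Fin n))) (↔-id (Fin n)) (λ _ → refl) e) (·-id e)))) (before (allPairs n))) ⟩
    trace vandermonde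
      ≈⟨ trace-vandermonde ⟩
    (length (allPairs n) !) ×′ 1#
      ≈⟨ reflexive (cong (λ k → (k !) ×′ 1#) (length-allPairs n)) ⟩
    ((n C 2) !) ×′ 1# ∎
    where
    vanish : ∀ σ {v} → to σ v ≢ v → factors var (var ∘ (↔-sym σ ·_)) (before (allPairs n)) ≈ 0#
    vanish σ moved with ·-faithful (ℕₚ.≤-trans (s≤s (s≤s (s≤s z≤n))) 4≤n) σ moved
    ... | e , σe≢e with moved-forward _≟ᴾ_ (allPairs n) (allPairs-unique n) (pairPerm σ) (λ z z∉ → contradiction (allPairs-complete z) z∉) σe≢e
    ...   | f , f∈ = factors-zero var (var ∘ (↔-sym σ ·_)) (before (allPairs n)) f∈
      (reflexive (cong var (≡.sym (Inverse.strictlyInverseʳ (pairPerm σ) f))))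

  -- A sign kept as a number of sign changes: no parity has to be decided, and exponents add under
  -- composition.
  negate : ℕ → Carrier → Carrier
  negate zero    p = p
  negate (suc k) p = - negate k p

  negate-cong : ∀ k {p q} → p ≈ q → negate k p ≈ negate k q
  negate-cong zero    p≈q = p≈q
  negate-cong (suc k) p≈q = -‿cong (negate-cong k p≈q)

  negate-even : ∀ h p → negate (2 ℕ.* h) p ≈ p
  negate-even zero    p = ≈-refl
  negate-even (suc h) p = ≈-trans (reflexive (cong (λ k → - negate k p) (ℕₚ.+-suc h (h ℕ.+ 0)))) (≈-trans (-‿involutive _) (negate-even h p))

  negate-parity : ∀ k → (∀ p → negate k p ≈ p) ⊎ (∀ p → negate k p ≈ - p)
  negate-parity k with parity k
  ... | inj₁ (h , refl) = inj₁ (negate-even h)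
  ... | inj₂ (h , refl) = inj₂ λ p → -‿cong (negate-even h p)

  -- A transposition of two vertices acts on the pairs as a product of n - 2
  -- transpositions.
  trace-transposition : ∀ i k → i ≢ k → ∀ f → trace (act (swapPerm i k ·_) f) ≈ negate (n ∸ 2) (trace f)
  trace-transposition i k i≢k f with ∈-extract (∈-allFin i)
  ... | vs , all↭i∷vs with ∈-extract {x = k} {vs} k∈vs
    where
    k∈vs : k ∈ vs
    k∈vs with ↭ₚ.∈-resp-↭ all↭i∷vs (∈-allFin k)
    ... | here k≡i   = contradiction (≡.sym k≡i) i≢k
    ... | there k∈vs = k∈vs
  ...   | us , vs↭k∷us = begin
    trace (act (swapPerm i k ·_) f)                 ≈⟨ trace-cong (act-≗ (transposition-pairSwaps i k i≢k us avoids unique-us others) f) ⟩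
    trace (act (pairSwaps i k i≢k us avoids) f)     ≈⟨ signs us avoids f ⟩
    negate (length us) (trace f)                    ≈⟨ reflexive (cong (λ m → negate m (trace f)) length-us) ⟩
    negate (n ∸ 2) (trace f)                        ∎
    where
    all↭ : vertices ↭ i ∷ k ∷ us
    all↭ = ↭-trans all↭i∷vs (prep i vs↭k∷us)
    unique-ikus : Unique (i ∷ k ∷ us)
    unique-ikus = unique-↭ all↭ (Uniqueₚ.allFin⁺ n)
    unique-us : Unique us
    unique-us = unique-tail (unique-tail unique-ikus)
    avoids : All (Avoids i k i≢k) us
    avoids = All.tabulate λ {u} u∈us → (λ i≡u → unique-∉ unique-ikus (there (subst (_∈ us) (≡.sym i≡u) u∈us))) ,
                                       (λ k≡u → unique-∉ (unique-tail unique-ikus) (subst (_∈ us) (≡.sym k≡u) u∈us))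
    others : ∀ v → i ≢ v → k ≢ v → v ∈ us
    others v i≢v k≢v with ↭ₚ.∈-resp-↭ all↭ (∈-allFin v)
    ... | here v≡i           = contradiction (≡.sym v≡i) i≢v
    ... | there (here v≡k)   = contradiction (≡.sym v≡k) k≢v
    ... | there (there v∈us) = v∈us
    length-us : length us ≡ n ∸ 2
    length-us = cong (_∸ 2) (≡.trans (≡.sym (↭ₚ.↭-length all↭)) (length-tabulate {n = n} id))
    signs : ∀ us ps f → trace (act (pairSwaps i k i≢k us ps) f) ≈ negate (length us) (trace f)
    signs []       []             f = trace-cong (act-id f)
    signs (u ∷ us) ((p , q) ∷ ps) f = ≈-trans (trace-cong (≈-sym (act-∘ _ (pairSwaps i k i≢k us ps) f)))
      (≈-trans (trace-swap _ edges-≢) (-‿cong (signs us ps f)))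
      where
      edges-≢ : unordered i u p ≢ unordered k u q
      edges-≢ eq with ∈-unordered⁻ k u q (subst (i ∈ᵉ_) eq (∈-unorderedˡ i u p))
      ... | inj₁ i≡k = i≢k i≡k
      ... | inj₂ i≡u = p i≡u

  Signed : Permutation′ n → Set (c ⊔ ℓ)
  Signed σ = ∃ λ k → ∀ f → trace (act (σ ·_) f) ≈ negate k (trace f)

  negate-+ : ∀ k l p → negate k (negate l p) ≈ negate (k ℕ.+ l) p
  negate-+ zero    l p = ≈-refl
  negate-+ (suc k) l p = -‿cong (negate-+ k l p)

  abstract
    -- Only some exponent is asked for. Its parity is determined by σ all the same, because the
    -- trace of the Vandermonde product is not 0.
    signed : ∀ σ → Signed σ
    signed = permutation-induction Signed
      (λ {σ} {τ} σ≗τ (k , eq) → k , λ f → ≈-trans (trace-cong (act-≗ (λ e → ≡.sym (·-cong σ τ σ≗τ e)) f)) (eq f))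
      (0 , λ f → trace-cong (≈-trans (act-≗ ·-id f) (act-id f)))
      λ σ i k i≢k (l , eq) → l ℕ.+ (n ∸ 2) , λ f → ≈-trans (trace-cong (act-·-∘ σ (swapPerm i k) f))
        (≈-trans (eq _) (≈-trans (negate-cong l (trace-transposition i k i≢k f)) (negate-+ l (n ∸ 2) (trace f))))

  trace-odd : ∀ h → n ≡ suc (2 ℕ.* h) → ∀ i k → i ≢ k → ∀ f → trace (act (swapPerm i k ·_) f) ≈ - trace f
  trace-odd h n≡ i k i≢k f with odd-∸2 h (subst (4 ℕ.≤_) n≡ 4≤n)
  ... | g , eq = ≈-trans (trace-transposition i k i≢k f)
    (≈-trans (reflexive (cong (λ m → negate m (trace f)) (≡.trans (cong (_∸ 2) n≡) eq))) (-‿cong (negate-even g (trace f))))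

  trace-even : ∀ h → n ≡ 2 ℕ.* h → ∀ i k → i ≢ k → ∀ f → trace (act (swapPerm i k ·_) f) ≈ trace f
  trace-even h n≡ i k i≢k f with even-∸2 h (subst (4 ℕ.≤_) n≡ 4≤n)
  ... | g , eq = ≈-trans (trace-transposition i k i≢k f)
    (≈-trans (reflexive (cong (λ m → negate m (trace f)) (≡.trans (cong (_∸ 2) n≡) eq))) (negate-even g (trace f)))

  -- A monomial of degree less than μ n is fixed by a transposition of
  -- vertices, which changes the sign of the trace when n is odd.
  trace-below-μ : ∀ b {f} → GInvariant f → length b ℕ.< μ n → trace (mon b * f) ≈ 0#
  trace-below-μ b {f} f-inv b<μ with parity n
  ... | inj₁ (h , n≡2h) with () ← subst (length b ℕ.<_) (≡.trans (cong μ n≡2h) (μ-even h)) b<μ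
  ... | inj₂ (h , n≡) with small-symmetric b (subst (λ m → 4 ℕ.* length b ℕ.+ 3 ℕ.< 3 ℕ.* m) (≡.sym n≡) (below-μ h (subst (λ m → length b ℕ.< μ m) n≡ b<μ)))
  ...   | i , k , i≢k , fixed = double≈0 (≈-trans (+-congˡ eq) (-‿inverseʳ _))
    where
    eq : trace (mon b * f) ≈ - trace (mon b * f)
    eq = ≈-trans (trace-cong (≈-sym (≈-trans (act-* _ _ _) (*-cong (≈-trans (act-mon-map _ b) (mon-↭ fixed)) (f-inv (swapPerm i k))))))
      (trace-odd h n≡ i k i≢k (mon b * f))

  abstract
    -- For even `n` every vertex permutation is even on the pairs, so the monomial 1 serves. For odd
    -- `n` a tight graph serves, by `automorphism-splits`.
    extremal : ∃ λ γ → length γ ≡ μ n × (∀ (τ : Permutation′ n) → map (τ ·_) γ ↭ γ → ∀ f → trace (act (τ ·_) f) ≈ trace f)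
    extremal with parity n
    ... | inj₁ (h , n≡2h) = [] , ≡.sym (≡.trans (cong μ n≡2h) (μ-even h)) , λ τ _ → even-sign τ
      where
      even-sign : ∀ τ f → trace (act (τ ·_) f) ≈ trace f
      even-sign = permutation-induction (λ τ → ∀ f → trace (act (τ ·_) f) ≈ trace f)
        (λ {σ} {τ} σ≗τ eq f → ≈-trans (trace-cong (act-≗ (λ e → ≡.sym (·-cong σ τ σ≗τ e)) f)) (eq f))
        (λ f → trace-cong (≈-trans (act-≗ ·-id f) (act-id f)))
        λ σ i k i≢k eq f → ≈-trans (trace-cong (act-·-∘ σ (swapPerm i k) f))
          (≈-trans (eq _) (trace-even h n≡2h i k i≢k f))
    ... | inj₂ (h , n≡) with subst TightGraph (≡.sym n≡) (tight h (subst (4 ℕ.≤_) n≡ 4≤n))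
      where
      tight : ∀ h → 4 ℕ.≤ suc (2 ℕ.* h) → TightGraph (suc (2 ℕ.* h))
      tight (suc (suc h)) _ = subst TightGraph (≡.sym (cong suc (ℕₚ.*-distribˡ-+ 2 2 h))) (tightGraph h)
      tight 0 (s≤s ())
      tight 1 (s≤s (s≤s (s≤s ())))
    ...   | T = graph , ≡.sym (≡.trans (cong μ n≡) (≡.trans (μ-odd h) (≡.trans (cong (λ m → (3 ℕ.* m) ℕ./ 4) (≡.sym n≡)) (/4-unique lower upper)))) , stabilizer
      where
      open TightGraph T
      open Matched matched
      stabilizer : ∀ τ → map (τ ·_) graph ↭ graph → ∀ f → trace (act (τ ·_) f) ≈ trace f
      stabilizer τ fixed f = begin
        trace (act (τ ·_) f)
          ≈⟨ trace-cong (act-≗ (·-cong τ (π ↔-∘ (matePerm ↔-∘ (π ↔-∘ matePerm))) (automorphism-splits τ fixed)) f) ⟩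
        trace (act ((π ↔-∘ (matePerm ↔-∘ (π ↔-∘ matePerm))) ·_) f)
          ≈⟨ trace-cong (≈-trans (act-·-∘ π (matePerm ↔-∘ (π ↔-∘ matePerm)) f) (act-cong (π ·_)
               (≈-trans (act-·-∘ matePerm (π ↔-∘ matePerm) f) (act-cong (matePerm ·_) (act-·-∘ π matePerm f))))) ⟩
        trace (act (π ·_) (act (matePerm ·_) (act (π ·_) (act (matePerm ·_) f))))
          ≈⟨ ≈-trans (proj₂ sπ _) (negate-cong kπ (≈-trans (proj₂ sκ _) (negate-cong kκ (≈-trans (proj₂ sπ _) (negate-cong kπ (proj₂ sκ f)))))) ⟩
        negate kπ (negate kκ (negate kπ (negate kκ (trace f))))
          ≈⟨ cancel (negate-parity kπ) (negate-parity kκ) ⟩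
        trace f ∎
        where
        π : Permutation′ n
        π = hubPart τ fixed
        sπ : Signed π
        sπ = signed π
        sκ : Signed matePerm
        sκ = signed matePerm
        kπ kκ : ℕ
        kπ = proj₁ sπ
        kκ = proj₁ sκ
        cancel : (∀ p → negate kπ p ≈ p) ⊎ (∀ p → negate kπ p ≈ - p) → (∀ p → negate kκ p ≈ p) ⊎ (∀ p → negate kκ p ≈ - p) →
                 ∀ {p} → negate kπ (negate kκ (negate kπ (negate kκ p))) ≈ p
        cancel (inj₁ a) (inj₁ b) = ≈-trans (a _) (≈-trans (b _) (≈-trans (a _) (b _)))
        cancel (inj₂ a) (inj₁ b) = ≈-trans (a _) (≈-trans (-‿cong (≈-trans (b _) (≈-trans (a _) (-‿cong (b _))))) (-‿involutive _))
        cancel (inj₁ a) (inj₂ b) = ≈-trans (a _) (≈-trans (b _) (≈-trans (-‿cong (≈-trans (a _) (b _))) (-‿involutive _)))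
        cancel (inj₂ a) (inj₂ b) = ≈-trans (a _) (≈-trans (-‿cong (≈-trans (b _) (-‿cong (≈-trans (a _) (-‿cong (b _)))))) (≈-trans (-‿involutive _) (-‿involutive _)))

  κ-× : ∀ k → κ (k RM.× R.1#) ≈ k ×′ 1#
  κ-× zero    = κ-0
  κ-× (suc k) = ≈-trans (κ-+ _ _) (+-cong κ-1 (κ-× k))

  const-coeff-× : ∀ k → const-coeff (k ×′ 1#) R.≈ k RM.× R.1#
  const-coeff-× k = R.trans (const-coeff-cong (≈-sym (κ-× k))) (const-coeff-κ _)

  ×1-injective : ∀ {a b} → a RM.× R.1# R.≈ b RM.× R.1# → a ≡ b
  ×1-injective {zero}  {zero}  _  = refl
  ×1-injective {zero}  {suc b} eq = contradiction (R.sym eq) (nonzero b)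
  ×1-injective {suc a} {zero}  eq = contradiction eq (nonzero a)
  ×1-injective {suc a} {suc b} eq = cong suc (×1-injective (RP.+-cancelˡ R.1# _ _ eq))

  !-nonzero : ∀ k → ¬ ((k !) RM.× R.1# R.≈ R.0#)
  !-nonzero k eq with k ! | ℕ.>-nonZero⁻¹ (k !) {{k !≢0}}
  ... | suc l | _ = nonzero l eq

  -- The field carries no order, so positivity is tracked in ℕ: the other summands can only add to
  -- the contribution of the identity.
  symSum-natural : ∀ xs (N : Permutation′ n → ℕ) →
                   ∃ λ k → Sumᴿ.symSum xs (λ σ → N σ RM.× R.1#) R.≈ (N (↔-id (Fin n)) ℕ.+ k) RM.× R.1#
  symSum-natural []       N = 0 , R.reflexive (cong (RM._× R.1#) (≡.sym (ℕₚ.+-identityʳ (N (↔-id (Fin n))))))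
  symSum-natural (x ∷ xs) N = k ℕ.+ proj₁ rest ,
    R.trans (R.+-cong (proj₂ (symSum-natural xs N)) (R.trans (R.*-identityˡ _) (proj₂ rest)))
      (R.trans (R.sym (RM.×-homo-+ R.1# (N (↔-id (Fin n)) ℕ.+ k) (proj₁ rest)))
        (R.reflexive (cong (RM._× R.1#) (ℕₚ.+-assoc (N (↔-id (Fin n))) k (proj₁ rest)))))
    where
    k : ℕ
    k = proj₁ (symSum-natural xs N)
    translated : Fin n → R.Carrier
    translated y = Sumᴿ.symSum xs (λ π → N (π ↔-∘ swapPerm x y) RM.× R.1#)
    translated-natural : ∀ y → ∃ λ l → translated y R.≈ l RM.× R.1#
    translated-natural y = N (↔-id (Fin n) ↔-∘ swapPerm x y) ℕ.+ proj₁ ih , proj₂ ih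
      where
      ih : ∃ λ l → translated y R.≈ (N (↔-id (Fin n) ↔-∘ swapPerm x y) ℕ.+ l) RM.× R.1#
      ih = symSum-natural xs (λ π → N (π ↔-∘ swapPerm x y))
    sum-natural : ∀ ys → ∃ λ l → ListSums.sumL R translated ys R.≈ l RM.× R.1#
    sum-natural []       = 0 , R.refl
    sum-natural (y ∷ ys) = proj₁ (translated-natural y) ℕ.+ proj₁ (sum-natural ys) ,
      R.trans (R.+-cong (proj₂ (translated-natural y)) (proj₂ (sum-natural ys)))
        (R.sym (RM.×-homo-+ R.1# (proj₁ (translated-natural y)) (proj₁ (sum-natural ys))))
    rest : ∃ λ l → ListSums.sumL R translated xs R.≈ l RM.× R.1#
    rest = sum-natural xs

  symSum-positive : ∀ xs (N : Permutation′ n → ℕ) {k} → N (↔-id (Fin n)) ≡ suc k →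
                    ∃ λ l → Sumᴿ.symSum xs (λ σ → N σ RM.× R.1#) R.≈ suc l RM.× R.1#
  symSum-positive xs N {k} eq with symSum-natural xs N
  ... | l , eq′ = k ℕ.+ l , R.trans eq′ (R.reflexive (cong (λ m → (m ℕ.+ l) RM.× R.1#) eq))

  degree≡ : degree ≡ (n C 2) C 2
  degree≡ = ≡.trans (length-before (allPairs n)) (cong (_C 2) (length-allPairs n))

  top : ℕ
  top = (n C 2) C 2 ∸ μ n

  -- Coefficients are symmetric elements instead of polynomials in the elementary symmetric ones,
  -- because traces arise in that form.
  record Secondary {t : ℕ} (η : Fin t → Carrier) (deg : Fin t → ℕ) : Set (c ⊔ ℓ) where
    field
      invariant   : ∀ j → GInvariant (η j)
      homogeneous : ∀ j → Hom (deg j) (η j)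
      spanning    : ∀ {f} → GInvariant f → ∃ λ (p : Fin t → Carrier) →
                    (∀ j → Symmetric (p j)) × f ≈ sumL (λ j → η j * p j) (allFin t)
      independent : ∀ (p : Fin t → Carrier) → (∀ j → Symmetric (p j)) →
                    sumL (λ j → η j * p j) (allFin t) ≈ 0# → ∀ j → p j ≈ 0#

    private
      coordinate : List (Pair n) → Fin t → Carrier
      coordinate c = proj₁ (spanning (symmetrize-invariant (mon c)))

      coordinate-symmetric : ∀ c j → Symmetric (coordinate c j)
      coordinate-symmetric c = proj₁ (proj₂ (spanning (symmetrize-invariant (mon c))))

      symmetrize≈ : ∀ c → symmetrize (mon c) ≈ sumL (λ j → η j * coordinate c j) (allFin t)
      symmetrize≈ c = proj₂ (proj₂ (spanning (symmetrize-invariant (mon c))))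

      -- The matrix, in the basis `η`, of the symmetrization restricted to the invariants. It is
      -- read off from `invariant-expansion` by expanding each symmetrized monomial in the basis.
      entry : Fin t → Fin t → Carrier
      entry j k = sumL (λ (b , r , c) → trace (mon b * η j) * (κ r * coordinate c k)) terms

      generated-sumL : ∀ {a} {Y : Set a} {g : Y → Carrier} ys → (∀ y → Symmetric (g y)) → Symmetric (sumL g ys)
      generated-sumL []       h = generated-0
      generated-sumL (y ∷ ys) h = h y ⊕ generated-sumL ys h

      entry-symmetric : ∀ j k → Symmetric (entry j k)
      entry-symmetric j k = generated-sumL terms λ (b , r , c) → trace-symmetric (mon b * η j) ⊗ (con r ⊗ coordinate-symmetric c k)

      entry-sum : ∀ j → sumL (λ k → η k * entry j k) (allFin t) ≈ (n !) ×′ η j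
      entry-sum j = begin
        sumL (λ k → η k * entry j k) (allFin t)
          ≈⟨ sumL-cong (allFin t) (λ k → ≈-trans (≈-sym (sumL-*ˡ (η k) _ terms)) (sumL-cong terms λ (b , r , c) →
               ≈-trans (x∙yz≈y∙xz _ _ _) (*-congˡ (x∙yz≈y∙xz _ _ _)))) ⟩
        sumL (λ k → sumL (λ (b , r , c) → trace (mon b * η j) * (κ r * (η k * coordinate c k))) terms) (allFin t)
          ≈⟨ sumL-swap _ (allFin t) terms ⟩
        sumL (λ (b , r , c) → sumL (λ k → trace (mon b * η j) * (κ r * (η k * coordinate c k))) (allFin t)) terms
          ≈⟨ sumL-cong terms (λ (b , r , c) → ≈-trans (sumL-*ˡ _ _ (allFin t)) (*-congˡ (≈-trans (sumL-*ˡ _ _ (allFin t)) (*-congˡ (≈-sym (symmetrize≈ c)))))) ⟩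
        sumL (λ (b , r , c) → trace (mon b * η j) * (κ r * symmetrize (mon c))) terms
          ≈⟨ invariant-expansion (invariant j) ⟨
        (n !) ×′ η j ∎

      scalar : Fin t → Fin t → Carrier
      scalar j k = if does (j Finₚ.≟ k) then (n !) ×′ 1# else 0#

      scalar-same : ∀ j → scalar j j ≡ (n !) ×′ 1#
      scalar-same j with j Finₚ.≟ j
      ... | yes _  = refl
      ... | no j≢j = contradiction refl j≢j

      scalar-other : ∀ {j k} → j ≢ k → scalar j k ≡ 0#
      scalar-other {j} {k} j≢k with j Finₚ.≟ k
      ... | yes j≡k = contradiction j≡k j≢k
      ... | no _    = refl

      scalar-symmetric : ∀ j k → Symmetric (scalar j k)
      scalar-symmetric j k with j Finₚ.≟ k
      ... | yes _ = resp (κ-× (n !)) (con _)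
      ... | no _  = generated-0

      scalar-sum : ∀ j → sumL (λ k → η k * scalar j k) (allFin t) ≈ (n !) ×′ η j
      scalar-sum j with ∈-extract (∈-allFin j)
      ... | ks , all↭j∷ks = begin
        sumL (λ k → η k * scalar j k) (allFin t)                      ≈⟨ sumL-↭ _ all↭j∷ks ⟩
        η j * scalar j j + sumL (λ k → η k * scalar j k) ks           ≈⟨ +-cong (*-congˡ (reflexive (scalar-same j)))
          (≈-trans (sumL-cong-∈ ks λ k k∈ks → ≈-trans (*-congˡ (reflexive (scalar-other λ j≡k → j∉ks (subst (_∈ ks) (≡.sym j≡k) k∈ks)))) (zeroʳ _)) (sumL-0 ks)) ⟩
        η j * (n !) ×′ 1# + 0#                                        ≈⟨ +-identityʳ _ ⟩
        η j * (n !) ×′ 1#                                             ≈⟨ ×-comm-* (n !) (η j) 1# ⟩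
        (n !) ×′ (η j * 1#)                                           ≈⟨ ×′-congʳ (n !) (*-identityʳ (η j)) ⟩
        (n !) ×′ η j                                                  ∎
        where
        j∉ks : j ∉ ks
        j∉ks = unique-∉ (unique-↭ all↭j∷ks (Uniqueₚ.allFin⁺ t))

    -- The rows of `entry` and of the scalar matrix n! both hold coordinates of n! times `η j`, and
    -- coordinates are unique.
    diagonal : ∀ j → entry j j ≈ (n !) ×′ 1#
    diagonal j = ≈-trans (x∙y⁻¹≈ε⇒x≈y _ _ (independent (λ k → entry j k - scalar j k)
      (λ k → entry-symmetric j k ⊕ generated-neg (scalar-symmetric j k)) (begin
        sumL (λ k → η k * (entry j k - scalar j k)) (allFin t)
          ≈⟨ sumL-cong (allFin t) (λ k → ≈-trans (distribˡ _ _ _) (+-congˡ (≈-sym (≈-trans (-1*x≈-x _) (-‿distribʳ-* _ _))))) ⟩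
        sumL (λ k → η k * entry j k + - 1# * (η k * scalar j k)) (allFin t)
          ≈⟨ ≈-trans (sumL-+ _ _ (allFin t)) (+-cong (entry-sum j) (≈-trans (sumL-*ˡ (- 1#) _ (allFin t)) (≈-trans (*-congˡ (scalar-sum j)) (-1*x≈-x _)))) ⟩
        (n !) ×′ η j - (n !) ×′ η j
          ≈⟨ -‿inverseʳ _ ⟩
        0# ∎) j)) (reflexive (scalar-same j))

    -- Two evaluations of the trace of `entry`: t · n! along the diagonal, and, after contracting
    -- the basis, the trace of the symmetrization on the whole polynomial ring. Constant
    -- coefficients and characteristic zero bring the equation down to ℕ.
    count : t ℕ.* n ! ≡ (n C 2) !
    count = ×1-injective (R.trans (R.sym (const-coeff-× (t ℕ.* n !))) (R.trans (const-coeff-cong (begin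
      (t ℕ.* n !) ×′ 1#
        ≈⟨ ×′-assocˡ 1# t (n !) ⟨
      t ×′ ((n !) ×′ 1#)
        ≈⟨ sum-const ((n !) ×′ 1#) ⟨
      sumL (λ _ → (n !) ×′ 1#) (allFin t)
        ≈⟨ sumL-cong (allFin t) diagonal ⟨
      sumL (λ j → entry j j) (allFin t)
        ≈⟨ sumL-swap _ (allFin t) terms ⟩
      sumL (λ (b , r , c) → sumL (λ j → trace (mon b * η j) * (κ r * coordinate c j)) (allFin t)) terms
        ≈⟨ sumL-cong terms (λ (b , r , c) → collect b r c) ⟩
      sumL (λ (b , r , c) → trace (mon b * (κ r * symmetrize (mon c)))) terms
        ≈⟨ symmetrize-trace ⟩
      ((n C 2) !) ×′ 1# ∎)) (const-coeff-× ((n C 2) !))))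
      where
      sum-const : ∀ p → sumL (λ _ → p) (allFin t) ≈ t ×′ p
      sum-const p = ≈-trans (go (allFin t)) (reflexive (cong (_×′ p) (length-tabulate {n = t} id)))
        where
        go : ∀ (ks : List (Fin t)) → sumL (λ _ → p) ks ≈ length ks ×′ p
        go []       = ≈-refl
        go (_ ∷ ks) = +-congˡ (go ks)
      collect : ∀ b r c → sumL (λ j → trace (mon b * η j) * (κ r * coordinate c j)) (allFin t) ≈ trace (mon b * (κ r * symmetrize (mon c)))
      collect b r c = begin
        sumL (λ j → trace (mon b * η j) * (κ r * coordinate c j)) (allFin t)
          ≈⟨ sumL-cong (allFin t) (λ j → ≈-trans (*-comm _ _) (≈-sym (trace-*ˡ (mon b * η j) (symmetric-invariant (con r ⊗ coordinate-symmetric c j))))) ⟩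
        sumL (λ j → trace (κ r * coordinate c j * (mon b * η j))) (allFin t)
          ≈⟨ trace-map _ (allFin t) ⟨
        trace (sumL (λ j → κ r * coordinate c j * (mon b * η j)) (allFin t))
          ≈⟨ trace-cong (≈-trans (sumL-cong (allFin t) λ j → rearrange (κ r) (coordinate c j) (mon b) (η j))
               (≈-trans (sumL-*ˡ _ _ (allFin t)) (*-congˡ (≈-trans (sumL-*ˡ _ _ (allFin t)) (*-congˡ (≈-sym (symmetrize≈ c))))))) ⟩
        trace (mon b * (κ r * symmetrize (mon c))) ∎
        where
        open import Algebra.Solver.Ring.NaturalCoefficients.Default commutativeSemiring using (solve; _:=_; _:*_)
        rearrange : ∀ k p m h → k * p * (m * h) ≈ m * (k * (h * p))
        rearrange = solve 4 (λ k p m h → k :* p :* (m :* h) := m :* (k :* (h :* p))) ≈-refl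

    -- Otherwise every term of `entry j j` has constant coefficient 0: a left part of degree below μ
    -- n gives trace 0, and with any other one the degree of `mon b * η j` exceeds that of the
    -- Vandermonde product. But the constant coefficient is n!.
    degree-≤ : ∀ j → deg j ℕ.≤ top
    degree-≤ j with deg j ℕₚ.≤? top
    ... | yes ≤top = ≤top
    ... | no ¬≤top = contradiction (R.trans (R.sym (const-coeff-× (n !))) (R.trans (const-coeff-cong (≈-sym (diagonal j))) constant≈0)) (!-nonzero n)
      where
      module C = SymmetricSumMap S R const-coeff const-coeff-cong const-coeff-+
      D<μ+deg : degree ℕ.< μ n ℕ.+ deg j
      D<μ+deg = subst (ℕ._< μ n ℕ.+ deg j) (≡.sym degree≡) (∸-<⇒<-+ _ (μ n) (ℕₚ.≰⇒> ¬≤top))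
      term≈0 : ∀ b r c → const-coeff (trace (mon b * η j) * (κ r * coordinate c j)) R.≈ R.0#
      term≈0 b r c with length b ℕₚ.<? μ n
      ... | yes b<μ = R.trans (const-coeff-cong (≈-trans (*-congʳ (trace-below-μ b (invariant j) b<μ)) (zeroˡ _))) C.h-0
      ... | no b≮μ  = R.trans (const-coeff-* _ _) (R.trans (R.*-congʳ (trace-const (Hom-* (Hom-mon b) (homogeneous j))
        (λ eq → ℕₚ.<⇒≱ D<μ+deg (ℕₚ.≤-trans (ℕₚ.+-monoˡ-≤ (deg j) (ℕₚ.≮⇒≥ b≮μ)) (ℕₚ.≤-reflexive eq))))) (R.zeroˡ _))
      constant≈0 : const-coeff (entry j j) R.≈ R.0#
      constant≈0 = R.trans (C.h-sumL _ terms) (R.trans (ListSums.sumL-cong R terms λ (b , r , c) → term≈0 b r c) (ListSums.sumL-0 R terms))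

    degree-attained : ∃ λ j → top ℕ.≤ deg j
    degree-attained with Finₚ.any? (λ j → top ℕₚ.≤? deg j)
    ... | yes found = found
    ... | no none   = ⊥-elim (nonzero (proj₁ multiplicity) (R.trans (R.sym (proj₂ multiplicity)) vanishes))
      where
      γ : List (Pair n)
      γ = proj₁ extremal
      stabilizer : ∀ τ → map (τ ·_) γ ↭ γ → ∀ f → trace (act (τ ·_) f) ≈ trace f
      stabilizer = proj₂ (proj₂ extremal)

      low : ∀ j → length γ ℕ.+ deg j ℕ.< degree
      low j = ≡.subst₂ ℕ._<_ (≡.trans (ℕₚ.+-comm (deg j) (μ n)) (cong (ℕ._+ deg j) (≡.sym (proj₁ (proj₂ extremal))))) (≡.sym degree≡)
        (<-∸⇒+-< _ (μ n) (ℕₚ.≰⇒> λ top≤ → none (j , top≤)))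

      trace-γ : ∀ {f} → GInvariant f → trace (mon γ * f) ≈ 0#
      trace-γ {f} f-inv with spanning f-inv
      ... | p , p-sym , f≈ = begin
        trace (mon γ * f)                                                      ≈⟨ trace-cong (≈-trans (*-congˡ f≈) (≈-trans (≈-sym (sumL-*ˡ _ _ (allFin t))) (sumL-cong (allFin t) λ j → x∙yz≈z∙xy _ _ _))) ⟩
        trace (sumL (λ j → p j * (mon γ * η j)) (allFin t))                    ≈⟨ trace-map _ (allFin t) ⟩
        sumL (λ j → trace (p j * (mon γ * η j))) (allFin t)                    ≈⟨ sumL-cong (allFin t) (λ j → ≈-trans (trace-*ˡ _ (symmetric-invariant (p-sym j)))
          (≈-trans (*-congˡ (trace-low (Hom-* (Hom-mon γ) (homogeneous j)) (low j))) (zeroʳ _))) ⟩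
        sumL (λ _ → 0#) (allFin t)                                             ≈⟨ sumL-0 (allFin t) ⟩
        0#                                                                     ∎

      -- The sign is that of σ on the pairs, which need not be its sign on the vertices. It is
      -- therefore carried by the summands, and the sum over them is unsigned.
      translate : Permutation′ n → Carrier
      translate σ = negate (proj₁ (signed σ)) (act (σ ·_) (mon γ))

      -- A semi-invariant orthogonal to everything under the trace form.
      g : Carrier
      g = Sum⁺.symSum vertices translate

      negate-*ʳ : ∀ k p q → negate k p * q ≈ negate k (p * q)
      negate-*ʳ zero    p q = ≈-refl
      negate-*ʳ (suc k) p q = ≈-trans (≈-sym (-‿distribˡ-* _ _)) (-‿cong (negate-*ʳ k p q))

      trace-negate : ∀ k p → trace (negate k p) ≈ negate k (trace p)
      trace-negate zero    p = ≈-refl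
      trace-negate (suc k) p = ≈-trans (trace-neg _) (-‿cong (trace-negate k p))

      negate-negate : ∀ k p → negate k (negate k p) ≈ p
      negate-negate k p with negate-parity k
      ... | inj₁ even = ≈-trans (even _) (even p)
      ... | inj₂ odd  = ≈-trans (odd _) (≈-trans (-‿cong (odd p)) (-‿involutive p))

      -- Moving σ from γ to the other factor produces a sign that cancels the one in `translate`.
      -- What remains is the trace of γ times a symmetrization, an invariant.
      g-orthogonal : ∀ h → trace (g * h) ≈ 0#
      g-orthogonal h = begin
        trace (g * h)                                                              ≈⟨ trace-cong (≈-trans (*-comm g h) (≈-sym (Sum⁺.symSum-*ˡ h vertices translate))) ⟩
        trace (Sum⁺.symSum vertices (λ σ → h * translate σ))                       ≈⟨ SymmetricSumMap.h-symSum S S trace trace-cong trace-+ vertices _ ⟩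
        Sum⁺.symSum vertices (λ σ → trace (h * translate σ))                       ≈⟨ Sum⁺.symSum-cong vertices move ⟩
        Sum⁺.symSum vertices (λ σ → trace (mon γ * act (↔-sym σ ·_) h))            ≈⟨ SymmetricSumMap.h-symSum S S trace trace-cong trace-+ vertices _ ⟨
        trace (Sum⁺.symSum vertices (λ σ → mon γ * act (↔-sym σ ·_) h))            ≈⟨ trace-cong (Sum⁺.symSum-*ˡ (mon γ) vertices _) ⟩
        trace (mon γ * symmetrize h)                                               ≈⟨ trace-γ (symmetrize-invariant h) ⟩
        0#                                                                         ∎
        where
        move : ∀ σ → trace (h * translate σ) ≈ trace (mon γ * act (↔-sym σ ·_) h)
        move σ = begin
          trace (h * translate σ)                                                  ≈⟨ trace-cong (≈-trans (*-comm _ _) (negate-*ʳ k _ h)) ⟩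
          trace (negate k (act (σ ·_) (mon γ) * h))                                ≈⟨ trace-negate k _ ⟩
          negate k (trace (act (σ ·_) (mon γ) * h))                                ≈⟨ negate-cong k (trace-cong (≈-sym (≈-trans (act-* (σ ·_) _ _) (*-congˡ inverse-act)))) ⟩
          negate k (trace (act (σ ·_) (mon γ * act (↔-sym σ ·_) h)))               ≈⟨ negate-cong k (proj₂ (signed σ) _) ⟩
          negate k (negate k (trace (mon γ * act (↔-sym σ ·_) h)))                 ≈⟨ negate-negate k _ ⟩
          trace (mon γ * act (↔-sym σ ·_) h)                                       ∎
          where
          k : ℕ
          k = proj₁ (signed σ)
          inverse-act : act (σ ·_) (act (↔-sym σ ·_) h) ≈ h
          inverse-act = ≈-trans (act-∘ _ _ h) (≈-trans (act-≗ (Inverse.strictlyInverseˡ (pairPerm σ)) h) (act-id h))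

      -- The trace form is nondegenerate: by `trace-expansion` an element is recovered from its
      -- traces against monomials.
      g≈0 : g ≈ 0#
      g≈0 = ≈-trans (≈-sym (trace-expansion g)) (≈-trans (sumL-cong terms λ (b , r , c) →
        ≈-trans (*-congʳ (≈-trans (trace-cong (*-comm (mon b) g)) (g-orthogonal (mon b)))) (zeroˡ _)) (sumL-0 terms))

      module Cγ = SymmetricSumMap S R (coefficient γ) (coefficient-cong γ) (coefficient-+ γ)

      vanishes : Sumᴿ.symSum vertices (coefficient γ ∘ translate) R.≈ R.0#
      vanishes = R.trans (R.sym (Cγ.h-symSum vertices translate)) (R.trans (coefficient-cong γ g≈0) Cγ.h-0)

      fixes? : ∀ σ → Dec (map (σ ·_) γ ↭ γ)
      fixes? σ = _↭?_ _≟ᴾ_ (map (σ ·_) γ) γ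

      indicator : Permutation′ n → ℕ
      indicator σ = if does (fixes? σ) then 1 else 0

      -- An element of the stabilizer of γ has sign 1, since the trace of the
      -- Vandermonde product is not 0.
      coefficient-translate : ∀ σ → coefficient γ (translate σ) R.≈ indicator σ RM.× R.1#
      coefficient-translate σ with fixes? σ
      ... | no moved = R.trans (coefficient-cong γ (negate-cong (proj₁ (signed σ)) (act-mon-map _ γ))) (zero-negate (negate-parity (proj₁ (signed σ))))
        where
        zero-negate : (∀ p → negate (proj₁ (signed σ)) p ≈ p) ⊎ (∀ p → negate (proj₁ (signed σ)) p ≈ - p) →
                      coefficient γ (negate (proj₁ (signed σ)) (mon (map (σ ·_) γ))) R.≈ R.0#
        zero-negate (inj₁ even) = R.trans (coefficient-cong γ (even _)) (coefficient-other moved)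
        zero-negate (inj₂ odd)  = R.trans (coefficient-cong γ (odd _)) (R.trans (Cγ.h-neg _)
          (R.trans (R.-‿cong (coefficient-other moved)) RP.-0#≈0#))
      ... | yes fixed with negate-parity (proj₁ (signed σ))
      ...   | inj₁ even = R.trans (coefficient-cong γ (≈-trans (even _) (act-mon-map _ γ))) (R.trans (coefficient-same fixed) (R.sym (R.+-identityʳ _)))
      ...   | inj₂ odd  = contradiction (R.trans (R.sym (const-coeff-× (length (allPairs n) !)))
        (R.trans (const-coeff-cong (≈-trans (≈-sym trace-vandermonde) (double≈0 (≈-trans (+-congˡ opposite) (-‿inverseʳ _)))))
          (SymmetricSumMap.h-0 S R const-coeff const-coeff-cong const-coeff-+))) (!-nonzero (length (allPairs n)))
        where
        opposite : trace vandermonde ≈ - trace vandermonde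
        opposite = ≈-trans (≈-sym (stabilizer σ fixed vandermonde)) (≈-trans (proj₂ (signed σ) vandermonde) (odd _))

      multiplicity : ∃ λ k → Sumᴿ.symSum vertices (coefficient γ ∘ translate) R.≈ suc k RM.× R.1#
      multiplicity with symSum-positive vertices indicator (proj₂ id-fixes)
        where
        id-fixes : ∃ λ k → indicator (↔-id (Fin n)) ≡ suc k
        id-fixes with fixes? (↔-id (Fin n))
        ... | yes _  = 0 , refl
        ... | no ¬id = contradiction (↭-reflexive (≡.trans (map-cong ·-id γ) (map-id γ))) ¬id
      ... | k , eq = k , R.trans (Sumᴿ.symSum-cong vertices coefficient-translate) eq

    last-degree : (∀ i j → i Fin.≤ j → deg i ℕ.≤ deg j) → ∃ λ (last : Fin t) → suc (toℕ last) ≡ t × deg last ≡ top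
    last-degree monotone = go t deg monotone degree-≤ degree-attained
      where
      go : ∀ t (deg : Fin t → ℕ) → (∀ i j → i Fin.≤ j → deg i ℕ.≤ deg j) → (∀ j → deg j ℕ.≤ top) → (∃ λ j → top ℕ.≤ deg j) →
           ∃ λ (last : Fin t) → suc (toℕ last) ≡ t × deg last ≡ top
      go (suc t) deg monotone ≤top (j , top≤) = Fin.fromℕ t , cong suc (Finₚ.toℕ-fromℕ t) ,
        ℕₚ.≤-antisym (≤top _) (ℕₚ.≤-trans top≤ (monotone j (Fin.fromℕ t) (Finₚ.≤fromℕ j)))

-- Elementary symmetric polynomials, and the polynomial ring as an instance of the axioms

module ElementarySymmetric {c ℓ} (R : CommutativeRing c ℓ) {X : Set} where

  open Polynomials R
  open CommutativeRing R using (1#)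

  -- The sublists enumerated by elementarySymmetric are computed by a function
  -- local to its definition.  Unification recovers that function from the
  -- value at a one-element list, once its four arguments there have been
  -- generalised to distinct variables.
  mutual
    localChoose : ℕ → List X → ℕ → List X → List (Monomial X)
    localChoose = _

    localChoose-defining : ∀ k x → elementarySymmetric (suc k) (x ∷ []) ≡
                           map (1# ,_) (map (x ∷_) (localChoose (suc k) (x ∷ []) k []) ++ [])
    localChoose-defining k x with suc k | List X ∋ x ∷ []
    ... | k₀ | xs₀ with List X ∋ []
    ... | xs = refl

  sublists : ℕ → List X → List (Monomial X)
  sublists zero    xs       = [] ∷ []
  sublists (suc k) []       = []
  sublists (suc k) (x ∷ xs) = map (x ∷_) (sublists k xs) ++ sublists (suc k) xs

  localChoose≡sublists : ∀ k₀ xs₀ k xs → localChoose k₀ xs₀ k xs ≡ sublists k xs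
  localChoose≡sublists k₀ xs₀ zero    xs       = refl
  localChoose≡sublists k₀ xs₀ (suc k) []       = refl
  localChoose≡sublists k₀ xs₀ (suc k) (x ∷ xs) =
    cong₂ (λ ys zs → map (x ∷_) ys ++ zs) (localChoose≡sublists k₀ xs₀ k xs) (localChoose≡sublists k₀ xs₀ (suc k) xs)

  elementarySymmetric≡ : ∀ k xs → elementarySymmetric k xs ≡ map (1# ,_) (sublists k xs)
  elementarySymmetric≡ k xs = cong (map (1# ,_)) (localChoose≡sublists k xs k xs)

module PolynomialVariables {c ℓ} (R : CommutativeRing c ℓ) {X : Set} (_≟_ : DecidableEquality X) where

  open CommutativeRing R hiding (zero) renaming (sym to ≈-sym; trans to ≈-trans; refl to ≈-refl)
  open RingProps ring
  open import Relation.Binary.Reasoning.Setoid setoid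
  open Polynomials R
  open Coefficients _≟_
  open PolynomialRing R _≟_
  open Subalgebra polynomialRing const
  private module S = CommutativeRing polynomialRing

  variable-of : X → Poly X
  variable-of x = (1# , x ∷ []) ∷ []

  const-cong : ∀ {r s} → r ≈ s → const r ≈ₚ const s
  const-cong {r} {s} r≈s = ≈ₚ-ext (const r) (const s) λ _ → +-congʳ (*-congʳ r≈s)

  const-+ : ∀ r s → const (r + s) ≈ₚ (const r +ₚ const s)
  const-+ r s = ≈ₚ-ext (const (r + s)) (const r +ₚ const s) λ {φ} _ →
    ≈-trans (+-congʳ (distribʳ (φ []) r s)) (+-assoc _ _ _)

  const-* : ∀ r s → const (r * s) ≈ₚ (const r *ₚ const s)
  const-* r s α = ≈-refl

  generated-by-variables : ∀ p → Generated (λ q → ∃ λ x → q ≈ₚ variable-of x) p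
  generated-by-variables []            = resp zero-const (con 0#)
    where
    zero-const : const 0# ≈ₚ 0ₚ
    zero-const = ≈ₚ-ext (const 0#) 0ₚ λ _ → ≈-trans (+-identityʳ _) (zeroˡ _)
  generated-by-variables ((r , β) ∷ p) = resp head-tail ((con r ⊗ monomial β) ⊕ generated-by-variables p)
    where
    monomial : ∀ β → Generated (λ q → ∃ λ x → q ≈ₚ variable-of x) ((1# , β) ∷ [])
    monomial []      = con 1#
    monomial (x ∷ β) = resp (≈ₚ-ext (variable-of x *ₚ ((1# , β) ∷ [])) ((1# , x ∷ β) ∷ []) λ _ → +-congʳ (*-congʳ (*-identityˡ 1#)))
      (gen {p = variable-of x} (x , S.refl {variable-of x}) ⊗ monomial β)
    head-tail : (const r *ₚ ((1# , β) ∷ []) +ₚ p) ≈ₚ ((r , β) ∷ p)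
    head-tail = ≈ₚ-ext (const r *ₚ ((1# , β) ∷ []) +ₚ p) ((r , β) ∷ p) λ _ → +-congʳ (*-congʳ (*-identityʳ r))

  rename-cong : ∀ f {p q} → p ≈ₚ q → rename f p ≈ₚ rename f q
  rename-cong f {p} {q} p≈q = ≈ₚ-ext (rename f p) (rename f q) λ {φ} φ-resp → begin
    lin φ (rename f p)    ≈⟨ lin-rename φ f p ⟩
    lin (φ ∘ map f) p     ≈⟨ lin-resp (λ β↭γ → φ-resp (↭ₚ.map⁺ f β↭γ)) {p} {q} p≈q ⟩
    lin (φ ∘ map f) q     ≈⟨ lin-rename φ f q ⟨
    lin φ (rename f q)    ∎

  rename-* : ∀ f p q → rename f (p *ₚ q) ≈ₚ (rename f p *ₚ rename f q)
  rename-* f p q = ≈ₚ-ext (rename f (p *ₚ q)) (rename f p *ₚ rename f q) λ {φ} φ-resp → begin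
    lin φ (rename f (p *ₚ q))                                          ≈⟨ lin-rename φ f (p *ₚ q) ⟩
    lin (φ ∘ map f) (p *ₚ q)                                           ≈⟨ lin-* _ p q ⟩
    lin (λ β → lin (λ γ → φ (map f (β ++ γ))) q) p                     ≈⟨ lin-cong (λ β → lin-cong (λ γ → reflexive (cong φ (map-++ f β γ))) q) p ⟩
    lin (λ β → lin (λ γ → φ (map f β ++ map f γ)) q) p                 ≈⟨ lin-cong (λ β → lin-rename _ f q) p ⟨
    lin (λ β → lin (λ γ → φ (map f β ++ γ)) (rename f q)) p            ≈⟨ lin-rename _ f p ⟨
    lin (λ β → lin (λ γ → φ (β ++ γ)) (rename f q)) (rename f p)       ≈⟨ lin-* φ (rename f p) (rename f q) ⟨
    lin φ (rename f p *ₚ rename f q)                                   ∎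

  rename-≗ : ∀ {f g : X → X} → (∀ x → f x ≡ g x) → ∀ p → rename f p ≈ₚ rename g p
  rename-≗ {f} {g} f≗g p α =
    reflexive (cong (coeff α) (map-cong (λ (r , β) → cong (r ,_) (map-cong f≗g β)) p))

  rename-∘ : ∀ (f g : X → X) p → rename f (rename g p) ≈ₚ rename (f ∘ g) p
  rename-∘ f g p α = reflexive (cong (coeff α)
    (≡.trans (≡.sym (map-∘ p)) (map-cong (λ (r , β) → cong (r ,_) (≡.sym (map-∘ β))) p)))

  rename-id : ∀ p → rename (id {A = X}) p ≈ₚ p
  rename-id p α = reflexive (cong (coeff α) (≡.trans (map-cong (λ (r , β) → cong (r ,_) (map-id β)) p) (map-id p)))

  private
    -- `Homogeneous` constrains coefficients only, and a formal sum may list terms of other degrees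
    -- that cancel. Here terms are selected by their listed length.
    component : ℕ → Poly X → Poly X
    component d []            = []
    component d ((r , β) ∷ p) with length β ℕₚ.≟ d
    ... | yes _ = (r , β) ∷ component d p
    ... | no _  = component d p

    restrict : ℕ → (Monomial X → Carrier) → Monomial X → Carrier
    restrict d φ β with length β ℕₚ.≟ d
    ... | yes _ = φ β
    ... | no _  = 0#

    restrict-≡ : ∀ {d} φ β → length β ≡ d → restrict d φ β ≡ φ β
    restrict-≡ {d} φ β eq with length β ℕₚ.≟ d
    ... | yes _  = refl
    ... | no neq = contradiction eq neq

    restrict-≢ : ∀ {d} φ β → length β ≢ d → restrict d φ β ≡ 0#
    restrict-≢ {d} φ β neq with length β ℕₚ.≟ d
    ... | yes eq = contradiction eq neq
    ... | no _   = refl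

    restrict-resp : ∀ d {φ} → Respects↭ φ → Respects↭ (restrict d φ)
    restrict-resp d {φ} φ-resp {β} {γ} β↭γ with length γ ℕₚ.≟ d
    ... | yes eq = ≈-trans (reflexive (restrict-≡ φ β (≡.trans (↭ₚ.↭-length β↭γ) eq))) (φ-resp β↭γ)
    ... | no neq = reflexive (restrict-≢ φ β (neq ∘ ≡.trans (≡.sym (↭ₚ.↭-length β↭γ))))

    restrict-cong : ∀ d {φ ψ} → (∀ β → length β ≡ d → φ β ≈ ψ β) → ∀ β → restrict d φ β ≈ restrict d ψ β
    restrict-cong d φ≈ψ β with length β ℕₚ.≟ d
    ... | yes eq = φ≈ψ β eq
    ... | no _   = ≈-refl

    lin-component : ∀ d φ p → lin φ (component d p) ≈ lin (restrict d φ) p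
    lin-component d φ []            = ≈-refl
    lin-component d φ ((r , β) ∷ p) with length β ℕₚ.≟ d
    ... | yes _ = +-congˡ (lin-component d φ p)
    ... | no _  = ≈-trans (lin-component d φ p) (≈-trans (≈-sym (+-identityˡ _)) (+-congʳ (≈-sym (zeroʳ r))))

    coeff-component : ∀ α p → coeff α (component (length α) p) ≈ coeff α p
    coeff-component α p = begin
      coeff α (component (length α) p)              ≈⟨ coeff≈lin α (component (length α) p) ⟩
      lin (λ β → 𝟙[ β ≈ α ]) (component (length α) p)   ≈⟨ lin-component (length α) _ p ⟩
      lin (restrict (length α) (λ β → 𝟙[ β ≈ α ])) p    ≈⟨ lin-cong agree p ⟩
      lin (λ β → 𝟙[ β ≈ α ]) p                      ≈⟨ coeff≈lin α p ⟨
      coeff α p                                     ∎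
      where
      agree : ∀ β → restrict (length α) (λ β → 𝟙[ β ≈ α ]) β ≈ 𝟙[ β ≈ α ]
      agree β with length β ℕₚ.≟ length α
      ... | yes _  = ≈-refl
      ... | no neq = reflexive (≡.sym (𝟙-no β α (neq ∘ ↭ₚ.↭-length)))

    homogeneous-component : ∀ {d p} → Homogeneous d p → p ≈ₚ component d p
    homogeneous-component {d} {p} hom α with length α ℕₚ.≟ d
    ... | yes refl = ≈-sym (coeff-component α p)
    ... | no neq   = ≈-trans (hom α neq) (≈-sym (begin
      coeff α (component d p)                        ≈⟨ coeff≈lin α (component d p) ⟩
      lin (λ β → 𝟙[ β ≈ α ]) (component d p)         ≈⟨ lin-component d _ p ⟩
      lin (restrict d (λ β → 𝟙[ β ≈ α ])) p          ≈⟨ lin-0 vanish p ⟩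
      0#                                             ∎))
      where
      vanish : ∀ β → restrict d (λ β → 𝟙[ β ≈ α ]) β ≈ 0#
      vanish β with length β ℕₚ.≟ d
      ... | yes refl = reflexive (𝟙-no β α (neq ∘ ≡.sym ∘ ↭ₚ.↭-length))
      ... | no _     = ≈-refl

  -- A homogeneous polynomial equals its component, where only monomials of length `d` are listed;
  -- `restrict` expresses the component through functionals.
  homogeneous-lin : ∀ {d p φ ψ} → Respects↭ φ → Respects↭ ψ → Homogeneous d p →
                    (∀ β → length β ≡ d → φ β ≈ ψ β) → lin φ p ≈ lin ψ p
  homogeneous-lin {d} {p} {φ} {ψ} φ-resp ψ-resp hom φ≈ψ = begin
    lin φ p                   ≈⟨ lin-resp φ-resp {p} {component d p} (homogeneous-component {p = p} hom) ⟩
    lin φ (component d p)     ≈⟨ lin-component d φ p ⟩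
    lin (restrict d φ) p      ≈⟨ lin-cong (restrict-cong d φ≈ψ) p ⟩
    lin (restrict d ψ) p      ≈⟨ lin-component d ψ p ⟨
    lin ψ (component d p)     ≈⟨ lin-resp ψ-resp {p} {component d p} (homogeneous-component {p = p} hom) ⟨
    lin ψ p                   ∎

  homogeneous-lin-0 : ∀ {d p φ} → Respects↭ φ → Homogeneous d p → (∀ β → length β ≡ d → φ β ≈ 0#) → lin φ p ≈ 0#
  homogeneous-lin-0 {p = p} φ-resp hom φ≈0 =
    ≈-trans (homogeneous-lin {p = p} φ-resp (λ _ → ≈-refl) hom φ≈0) (lin-0 (λ _ → ≈-refl) p)

  homogeneous-+ : ∀ {d p q} → Homogeneous d p → Homogeneous d q → Homogeneous d (p +ₚ q)
  homogeneous-+ {d} {p} {q} hom-p hom-q α neq =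
    ≈-trans (coeff-++ α p q) (≈-trans (+-cong (hom-p α neq) (hom-q α neq)) (+-identityʳ 0#))

  private
    ++-resp : ∀ {φ} → Respects↭ φ → ∀ q → Respects↭ (λ β → lin (λ γ → φ (β ++ γ)) q)
    ++-resp φ-resp q β↭β′ = lin-cong (λ γ → φ-resp (↭ₚ.++⁺ʳ γ β↭β′)) q

  homogeneous-* : ∀ {d e p q} → Homogeneous d p → Homogeneous e q → Homogeneous (d ℕ.+ e) (p *ₚ q)
  homogeneous-* {d} {e} {p} {q} hom-p hom-q α neq = begin
    coeff α (p *ₚ q)                                        ≈⟨ coeff≈lin α (p *ₚ q) ⟩
    lin (λ β → 𝟙[ β ≈ α ]) (p *ₚ q)                         ≈⟨ lin-* _ p q ⟩
    lin (λ β → lin (λ γ → 𝟙[ β ++ γ ≈ α ]) q) p             ≈⟨ homogeneous-lin-0 {p = p} (++-resp (𝟙-resp α) q) hom-p (λ β ∣β∣ →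
      homogeneous-lin-0 {p = q} (λ γ↭γ′ → 𝟙-resp α (↭ₚ.++⁺ˡ β γ↭γ′)) hom-q λ γ ∣γ∣ →
        reflexive (𝟙-no (β ++ γ) α λ βγ↭α → neq (≡.trans (≡.sym (↭ₚ.↭-length βγ↭α)) (≡.trans (length-++ β) (cong₂ ℕ._+_ ∣β∣ ∣γ∣))))) ⟩
    0#                                                      ∎

  private
    monomial-homogeneous : ∀ r β → Homogeneous (length β) ((r , β) ∷ [])
    monomial-homogeneous r β α neq rewrite dec-false (_↭?_ _≟_ β α) (λ β↭α → neq (≡.sym (↭ₚ.↭-length β↭α))) = +-identityʳ 0#

  homogeneous-rename : ∀ f {d p} → Homogeneous d p → Homogeneous d (rename f p)
  homogeneous-rename f {d} {p} hom α neq = begin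
    coeff α (rename f p)                       ≈⟨ coeff≈lin α (rename f p) ⟩
    lin (λ β → 𝟙[ β ≈ α ]) (rename f p)        ≈⟨ lin-rename _ f p ⟩
    lin (λ β → 𝟙[ map f β ≈ α ]) p             ≈⟨ homogeneous-lin-0 {p = p} (λ β↭γ → 𝟙-resp α (↭ₚ.map⁺ f β↭γ)) hom (λ β ∣β∣ →
      reflexive (𝟙-no (map f β) α λ fβ↭α → neq (≡.trans (≡.sym (↭ₚ.↭-length fβ↭α)) (≡.trans (length-map f β) ∣β∣)))) ⟩
    0#                                         ∎

  private
    Regular : Poly X → Set (c ⊔ ℓ)
    Regular p = ∀ q → (p *ₚ q) ≈ₚ 0ₚ → q ≈ₚ 0ₚ

    -- `p` times the degree `k` component of `q` is the degree D + k part of the product, which is 0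
    -- unless D + k = d. Regularity then removes `p`.
    component-cancel : ∀ {D d p q} → Regular p → Homogeneous D p → Homogeneous d (p *ₚ q) →
                       ∀ k → D ℕ.+ k ≢ d → component k q ≈ₚ 0ₚ
    component-cancel {D} {d} {p} {q} reg hom-p hom-pq k neq = reg (component k q)
      (≈ₚ-ext (p *ₚ component k q) 0ₚ λ {φ} φ-resp → begin
        lin φ (p *ₚ component k q)
          ≈⟨ lin-* φ p (component k q) ⟩
        lin (λ β → lin (λ γ → φ (β ++ γ)) (component k q)) p
          ≈⟨ homogeneous-lin {p = p} (++-resp φ-resp (component k q)) (++-resp (restrict-resp (D ℕ.+ k) φ-resp) q) hom-p (λ β ∣β∣ →
               ≈-trans (lin-component k _ q) (lin-cong (λ γ → agree φ β ∣β∣ γ) q)) ⟩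
        lin (λ β → lin (λ γ → restrict (D ℕ.+ k) φ (β ++ γ)) q) p
          ≈⟨ lin-* _ p q ⟨
        lin (restrict (D ℕ.+ k) φ) (p *ₚ q)
          ≈⟨ homogeneous-lin-0 {p = p *ₚ q} (restrict-resp (D ℕ.+ k) φ-resp) hom-pq (λ β ∣β∣ →
               reflexive (restrict-≢ φ β λ eq → neq (≡.trans (≡.sym eq) ∣β∣))) ⟩
        0# ∎)
      where
      agree : ∀ φ β → length β ≡ D → ∀ γ → restrict k (λ γ → φ (β ++ γ)) γ ≈ restrict (D ℕ.+ k) φ (β ++ γ)
      agree φ β refl γ with length γ ℕₚ.≟ k
      ... | yes refl = reflexive (≡.sym (restrict-≡ φ (β ++ γ) (length-++ β)))
      ... | no ∣γ∣≢k = reflexive (≡.sym (restrict-≢ φ (β ++ γ) λ eq → ∣γ∣≢k (ℕₚ.+-cancelˡ-≡ (length β) _ _ (≡.trans (≡.sym (length-++ β)) eq))))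

  homogeneous-cancel : ∀ {D d p q} → Regular p → Homogeneous D p → Homogeneous d (p *ₚ q) → d ℕ.< D → q ≈ₚ 0ₚ
  homogeneous-cancel {D} {d} {p} {q} reg hom-p hom-pq d<D α = ≈-trans (≈-sym (coeff-component α q))
    (component-cancel {p = p} {q} reg hom-p hom-pq (length α) (λ eq → ℕₚ.<⇒≱ d<D (subst (D ℕ.≤_) eq (ℕₚ.m≤m+n D _))) α)

  homogeneous-cancel-const : ∀ {D d p q} → Regular p → Homogeneous D p → Homogeneous d (p *ₚ q) → d ≢ D → coeff [] q ≈ 0#
  homogeneous-cancel-const {D} {d} {p} {q} reg hom-p hom-pq d≢D = ≈-trans (≈-sym (coeff-component [] q))
    (component-cancel {p = p} {q} reg hom-p hom-pq 0 (λ eq → d≢D (≡.trans (≡.sym eq) (ℕₚ.+-identityʳ D))) [])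

  constant-* : ∀ p q → coeff [] (p *ₚ q) ≈ coeff [] p * coeff [] q
  constant-* p q = begin
    coeff [] (p *ₚ q)                                         ≈⟨ coeff≈lin [] (p *ₚ q) ⟩
    lin (λ β → 𝟙[ β ≈ [] ]) (p *ₚ q)                          ≈⟨ lin-* _ p q ⟩
    lin (λ β → lin (λ γ → 𝟙[ β ++ γ ≈ [] ]) q) p              ≈⟨ lin-cong (λ β → ≈-trans (lin-cong (λ γ → split β γ) q) (≈-trans (lin-*ˡ _ _ q) (*-comm _ _))) p ⟩
    lin (λ β → lin (λ γ → 𝟙[ γ ≈ [] ]) q * 𝟙[ β ≈ [] ]) p     ≈⟨ lin-*ˡ _ _ p ⟩
    lin (λ γ → 𝟙[ γ ≈ [] ]) q * lin (λ β → 𝟙[ β ≈ [] ]) p     ≈⟨ *-comm _ _ ⟩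
    lin (λ β → 𝟙[ β ≈ [] ]) p * lin (λ γ → 𝟙[ γ ≈ [] ]) q     ≈⟨ *-cong (coeff≈lin [] p) (coeff≈lin [] q) ⟨
    coeff [] p * coeff [] q                                   ∎
    where
    split : ∀ β γ → 𝟙[ β ++ γ ≈ [] ] ≈ 𝟙[ β ≈ [] ] * 𝟙[ γ ≈ [] ]
    split []      γ = ≈-sym (*-identityˡ _)
    split (x ∷ β) γ = ≈-sym (zeroˡ _)

  private
    replicate-split : ∀ y α → ∃₂ λ k β → α ↭ replicate k y ++ β × y ∉ β
    replicate-split y []      = 0 , [] , ↭-refl , λ ()
    replicate-split y (x ∷ α) with replicate-split y α | x ≟ y
    ... | k , β , α↭ , y∉β | yes refl = suc k , β , prep y α↭ , y∉β
    ... | k , β , α↭ , y∉β | no x≢y   = k , x ∷ β , ↭-trans (prep x α↭) (↭-sym (↭ₚ.shift x (replicate k y) β)) ,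
      λ { (here y≡x) → x≢y (≡.sym y≡x) ; (there y∈β) → y∉β y∈β }

  -- If (x - y) q = 0 then, comparing coefficients, trading a factor y of a
  -- monomial for a factor x does not change its coefficient in q.
  variable-regular : ∀ {x y} → x ≢ y → Regular (variable-of x +ₚ (-ₚ variable-of y))
  variable-regular {x} {y} x≢y q eq α with replicate-split y α
  ... | k , β , α↭ , y∉β = ≈-trans (coeff-resp q α↭) (go k β y∉β)
    where
    shift≈ : ∀ {φ} → Respects↭ φ → lin (λ γ → φ (x ∷ γ)) q ≈ lin (λ γ → φ (y ∷ γ)) q
    shift≈ {φ} φ-resp = x∙y⁻¹≈ε⇒x≈y _ _ (begin
      lin (λ γ → φ (x ∷ γ)) q - lin (λ γ → φ (y ∷ γ)) q
        ≈⟨ +-cong (≈-sym (*-identityˡ _)) (≈-trans (≈-sym (-1*x≈-x _)) (≈-sym (+-identityʳ _))) ⟩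
      1# * lin (λ γ → φ (x ∷ γ)) q + (- 1# * lin (λ γ → φ (y ∷ γ)) q + 0#)
        ≈⟨ lin-* φ (variable-of x +ₚ (-ₚ variable-of y)) q ⟨
      lin φ ((variable-of x +ₚ (-ₚ variable-of y)) *ₚ q)
        ≈⟨ lin-resp φ-resp {(variable-of x +ₚ (-ₚ variable-of y)) *ₚ q} {0ₚ} eq ⟩
      0# ∎)

    cons-𝟙 : ∀ z α γ → 𝟙[ z ∷ γ ≈ z ∷ α ] ≈ 𝟙[ γ ≈ α ]
    cons-𝟙 z α γ with _↭?_ _≟_ γ α
    ... | yes γ↭α = reflexive (𝟙-yes (z ∷ γ) (z ∷ α) (prep z γ↭α))
    ... | no ¬γ↭α = reflexive (𝟙-no (z ∷ γ) (z ∷ α) (¬γ↭α ∘ ↭ₚ.drop-∷))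

    coeff-cons : ∀ z α → coeff α q ≈ lin (λ γ → 𝟙[ z ∷ γ ≈ z ∷ α ]) q
    coeff-cons z α = ≈-trans (coeff≈lin α q) (≈-sym (lin-cong (cons-𝟙 z α) q))

    go : ∀ k β → y ∉ β → coeff (replicate k y ++ β) q ≈ 0#
    go zero β y∉β = begin
      coeff β q                                  ≈⟨ coeff-cons x β ⟩
      lin (λ γ → 𝟙[ x ∷ γ ≈ x ∷ β ]) q           ≈⟨ shift≈ (𝟙-resp (x ∷ β)) ⟩
      lin (λ γ → 𝟙[ y ∷ γ ≈ x ∷ β ]) q           ≈⟨ lin-0 (λ γ → reflexive (𝟙-no (y ∷ γ) (x ∷ β) (absent γ))) q ⟩
      0#                                         ∎
      where
      absent : ∀ γ → ¬ (y ∷ γ ↭ x ∷ β)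
      absent γ p with ↭ₚ.∈-resp-↭ p (here refl)
      ... | here y≡x  = x≢y (≡.sym y≡x)
      ... | there y∈β = y∉β y∈β
    go (suc k) β y∉β = begin
      coeff (y ∷ replicate k y ++ β) q                                  ≈⟨ coeff-cons x (y ∷ replicate k y ++ β) ⟩
      lin (λ γ → 𝟙[ x ∷ γ ≈ x ∷ y ∷ replicate k y ++ β ]) q             ≈⟨ shift≈ (𝟙-resp (x ∷ y ∷ replicate k y ++ β)) ⟩
      lin (λ γ → 𝟙[ y ∷ γ ≈ x ∷ y ∷ replicate k y ++ β ]) q             ≈⟨ coeff≈shifted ⟨
      coeff (replicate k y ++ x ∷ β) q                                  ≈⟨ go k (x ∷ β) (λ { (here y≡x) → x≢y (≡.sym y≡x) ; (there y∈β) → y∉β y∈β }) ⟩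
      0#                                                                ∎
      where
      target↭ : y ∷ replicate k y ++ x ∷ β ↭ x ∷ y ∷ replicate k y ++ β
      target↭ = ↭ₚ.shift x (y ∷ replicate k y) β
      coeff≈shifted : coeff (replicate k y ++ x ∷ β) q ≈ lin (λ γ → 𝟙[ y ∷ γ ≈ x ∷ y ∷ replicate k y ++ β ]) q
      coeff≈shifted = ≈-trans (coeff-cons y _) (lin-cong (λ γ → same γ) q)
        where
        same : ∀ γ → 𝟙[ y ∷ γ ≈ y ∷ replicate k y ++ x ∷ β ] ≈ 𝟙[ y ∷ γ ≈ x ∷ y ∷ replicate k y ++ β ]
        same γ with _↭?_ _≟_ (y ∷ γ) (x ∷ y ∷ replicate k y ++ β)
        ... | yes p = reflexive (𝟙-yes (y ∷ γ) (y ∷ replicate k y ++ x ∷ β) (↭-trans p (↭-sym target↭)))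
        ... | no ¬p = reflexive (𝟙-no (y ∷ γ) (y ∷ replicate k y ++ x ∷ β) λ p → ¬p (↭-trans p target↭))

  monomial≈ : ∀ β → foldr (λ x → variable-of x *ₚ_) 1ₚ β ≈ₚ ((1# , β) ∷ [])
  monomial≈ []      = λ α → ≈-refl
  monomial≈ (x ∷ β) = S.trans {variable-of x *ₚ foldr (λ x → variable-of x *ₚ_) 1ₚ β} {variable-of x *ₚ ((1# , β) ∷ [])} {(1# , x ∷ β) ∷ []}
    (S.*-congˡ {variable-of x} {foldr (λ x → variable-of x *ₚ_) 1ₚ β} {(1# , β) ∷ []} (monomial≈ β))
    (≈ₚ-ext (variable-of x *ₚ ((1# , β) ∷ [])) ((1# , x ∷ β) ∷ []) λ _ → +-congʳ (*-congʳ (*-identityˡ 1#)))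

  coeff-monomial : ∀ β γ → coeff γ (foldr (λ x → variable-of x *ₚ_) 1ₚ β) ≈ 𝟙[ β ≈ γ ]
  coeff-monomial β γ = ≈-trans (monomial≈ β γ) (≈-trans (coeff≈lin γ ((1# , β) ∷ [])) (≈-trans (+-identityʳ _) (*-identityˡ _)))

  polynomialVariables : GradedVariables R X polynomialRing
  polynomialVariables = record
    { κ = const ; κ-cong = const-cong ; κ-+ = const-+ ; κ-* = const-* ; κ-1 = λ α → ≈-refl
    ; var = variable-of
    ; generated = generated-by-variables
    ; var-regular = variable-regular
    ; act = rename
    ; act-cong = λ f {p} {q} → rename-cong f {p} {q}
    ; act-+ = λ f p q α → reflexive (cong (coeff α) (map-++ _ p q))
    ; act-* = rename-*
    ; act-κ = λ f r α → ≈-refl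
    ; act-var = λ f x α → ≈-refl
    ; act-≗ = rename-≗
    ; act-∘ = rename-∘
    ; act-id = rename-id
    ; Hom = Homogeneous
    ; Hom-resp = λ p≈q hom α neq → ≈-trans (≈-sym (p≈q α)) (hom α neq)
    ; Hom-0 = λ d α neq → ≈-refl
    ; Hom-+ = λ {d} {p} {q} → homogeneous-+ {d} {p} {q}
    ; Hom-* = λ {d} {e} {p} {q} → homogeneous-* {d} {e} {p} {q}
    ; Hom-κ = λ r → monomial-homogeneous r []
    ; Hom-var = λ x → monomial-homogeneous 1# (x ∷ [])
    ; Hom-act = λ f {d} {p} → homogeneous-rename f {d} {p}
    ; coefficient = coeff
    ; coefficient-cong = λ γ p≈q → p≈q γ
    ; coefficient-+ = coeff-++
    ; coefficient-same = λ {β} {γ} β↭γ → ≈-trans (coeff-monomial β γ) (reflexive (𝟙-yes β γ β↭γ))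
    ; coefficient-other = λ {β} {γ} ¬β↭γ → ≈-trans (coeff-monomial β γ) (reflexive (𝟙-no β γ ¬β↭γ))
    ; const-coeff = coeff []
    ; const-coeff-cong = λ p≈q → p≈q []
    ; const-coeff-+ = coeff-++ []
    ; const-coeff-* = constant-*
    ; const-coeff-κ = λ r → +-identityʳ r
    ; Hom-cancel = λ {D} {d} {p} {q} → homogeneous-cancel {D} {d} {p} {q}
    ; Hom-cancel-const = λ {D} {d} {p} {q} → homogeneous-cancel-const {D} {d} {p} {q}
    }

-- Polynomial expressions in generators, and generators of bounded degree

module Evaluation {c ℓ} {R : CommutativeRing c ℓ} {X : Set} {S : CommutativeRing c ℓ} (V : GradedVariables R X S) where

  private module R = CommutativeRing R
  open Polynomials R using (Poly; _*ₚ_; const)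
  open GradedVariables V
  open CommutativeRing S hiding (zero) renaming (sym to ≈-sym; trans to ≈-trans; refl to ≈-refl)
  open Subalgebra S κ
  open import Relation.Binary.Reasoning.Setoid setoid
  open import Algebra.Solver.Ring.NaturalCoefficients.Default commutativeSemiring using (solve; _:=_; _:*_)

  module _ {Y : Set} (θ : Y → Carrier) where

    monomialValue : Monomial Y → Carrier
    monomialValue = foldr (λ y → θ y *_) 1#

    value : Poly Y → Carrier
    value []            = 0#
    value ((r , β) ∷ P) = κ r * monomialValue β + value P

    monomialValue-++ : ∀ β γ → monomialValue (β ++ γ) ≈ monomialValue β * monomialValue γ
    monomialValue-++ []      γ = ≈-sym (*-identityˡ _)
    monomialValue-++ (y ∷ β) γ = ≈-trans (*-congˡ (monomialValue-++ β γ)) (≈-sym (*-assoc _ _ _))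

    value-++ : ∀ P Q → value (P ++ Q) ≈ value P + value Q
    value-++ []            Q = ≈-sym (+-identityˡ _)
    value-++ ((r , β) ∷ P) Q = ≈-trans (+-congˡ (value-++ P Q)) (≈-sym (+-assoc _ _ _))

    value-scale : ∀ r β Q → value (map (λ (s , γ) → r R.* s , β ++ γ) Q) ≈ κ r * monomialValue β * value Q
    value-scale r β []            = ≈-sym (zeroʳ _)
    value-scale r β ((s , γ) ∷ Q) = begin
      κ (r R.* s) * monomialValue (β ++ γ) + value (map _ Q)
        ≈⟨ +-cong (≈-trans (*-cong (κ-* r s) (monomialValue-++ β γ))
             (solve 4 (λ r s b g → r :* s :* (b :* g) := r :* b :* (s :* g)) ≈-refl (κ r) (κ s) (monomialValue β) (monomialValue γ)))
             (value-scale r β Q) ⟩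
      κ r * monomialValue β * (κ s * monomialValue γ) + κ r * monomialValue β * value Q
        ≈⟨ distribˡ _ _ _ ⟨
      κ r * monomialValue β * (κ s * monomialValue γ + value Q) ∎

    value-* : ∀ P Q → value (P *ₚ Q) ≈ value P * value Q
    value-* []            Q = ≈-sym (zeroˡ _)
    value-* ((r , β) ∷ P) Q = ≈-trans (value-++ (map _ Q) (P *ₚ Q))
      (≈-trans (+-cong (value-scale r β Q) (value-* P Q)) (≈-sym (distribʳ _ _ _)))

    value-const : ∀ r → value (const r) ≈ κ r
    value-const r = ≈-trans (+-identityʳ _) (*-identityʳ _)

    value-variable : ∀ y → value ((R.1# , y ∷ []) ∷ []) ≈ θ y
    value-variable y = ≈-trans (+-identityʳ _) (≈-trans (*-cong κ-1 (*-identityʳ _)) (*-identityˡ _))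

    -- Turns membership in a subalgebra into the explicit polynomial that `IsSecondary` and
    -- `GeneratedInDegree≤` ask for.
    generated⇒value : ∀ {p} → Generated (λ p → ∃ λ y → p ≈ θ y) p → ∃ λ P → p ≈ value P
    generated⇒value (gen (y , p≈)) = (R.1# , y ∷ []) ∷ [] , ≈-trans p≈ (≈-sym (value-variable y))
    generated⇒value (con r)        = const r , ≈-sym (value-const r)
    generated⇒value (g ⊕ h) with generated⇒value g | generated⇒value h
    ... | P , eq | Q , eq′ = P ++ Q , ≈-trans (+-cong eq eq′) (≈-sym (value-++ P Q))
    generated⇒value (g ⊗ h) with generated⇒value g | generated⇒value h
    ... | P , eq | Q , eq′ = P *ₚ Q , ≈-trans (*-cong eq eq′) (≈-sym (value-* P Q))
    generated⇒value (resp eq g) with generated⇒value g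
    ... | P , eq′ = P , ≈-trans (≈-sym eq) eq′

    value-generated : Generated (λ p → ∃ λ y → p ≈ θ y) 0# → ∀ P → Generated (λ p → ∃ λ y → p ≈ θ y) (value P)
    value-generated zero-gen []            = zero-gen
    value-generated zero-gen ((r , β) ∷ P) = (con r ⊗ monomial β) ⊕ value-generated zero-gen P
      where
      monomial : ∀ β → Generated (λ p → ∃ λ y → p ≈ θ y) (monomialValue β)
      monomial []      = resp κ-1 (con R.1#)
      monomial (y ∷ β) = gen (y , ≈-refl) ⊗ monomial β

module Generation {c ℓ} (R : CommutativeRing c ℓ) (n : ℕ) (4≤n : 4 ℕ.≤ n)
  (inverse : ∀ k → ∃ λ r → CommutativeRing._≈_ R
    (CommutativeRing._*_ R r (SemiringMult._×_ (CommutativeRing.semiring R) (suc k) (CommutativeRing.1# R))) (CommutativeRing.1# R))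
  (nonzero : ∀ k → ¬ CommutativeRing._≈_ R (SemiringMult._×_ (CommutativeRing.semiring R) (suc k) (CommutativeRing.1# R)) (CommutativeRing.0# R))
  (S : CommutativeRing c ℓ) (V : GradedVariables R (Pair n) S) where

  private module R = CommutativeRing R
  open GraphInvariants R n 4≤n inverse nonzero S V public
  open GradedVariables V
  open CommutativeRing S hiding (zero) renaming (sym to ≈-sym; trans to ≈-trans; refl to ≈-refl)
  open Subalgebra S κ
  open ListSums S
  open SemiringMult semiring using (×-assoc-*) renaming (_×_ to _×′_; ×-congʳ to ×′-congʳ)
  open Antisymmetrization R half half-2 _≟ᴾ_ (allPairs n) (allPairs-unique n) allPairs-complete S V public
  open Polynomials R using (Poly)
  open import Relation.Binary.Reasoning.Setoid setoid

  θ : Fin (n C 2) → Carrier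
  θ k = e (suc (toℕ k)) (allPairs n)

  -- `e` of index 0 is 1, and beyond the number of variables `e` vanishes, so only the m functions
  -- `θ` remain as generators.
  symmetric⇒θ : ∀ {p} → Symmetric p → Generated (λ p → ∃ λ k → p ≈ θ k) p
  symmetric⇒θ = generated-map λ (k , p≈) → resp (≈-sym p≈) (elementary-generated k)
    where
    elementary-generated : ∀ k → Generated (λ p → ∃ λ k → p ≈ θ k) (e k (allPairs n))
    elementary-generated zero    = generated-1
    elementary-generated (suc k) with k ℕₚ.<? n C 2
    ... | yes k<m = gen (Fin.fromℕ< k<m , reflexive (cong (λ j → e (suc j) (allPairs n)) (≡.sym (Finₚ.toℕ-fromℕ< k<m))))
    ... | no k≮m  = resp (≈-sym (e-vanish (allPairs n) (s≤s (ℕₚ.≤-trans (ℕₚ.≤-reflexive (length-allPairs n)) (ℕₚ.≮⇒≥ k≮m))))) generated-0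

  θ⇒symmetric : ∀ {p} → Generated (λ p → ∃ λ k → p ≈ θ k) p → Symmetric p
  θ⇒symmetric = generated-map λ (k , p≈) → gen (suc (toℕ k) , p≈)

  Hom-e : ∀ k xs → Hom k (e k xs)
  Hom-e zero    xs       = Hom-1
  Hom-e (suc k) []       = Hom-0 (suc k)
  Hom-e (suc k) (x ∷ xs) = Hom-+ (Hom-* (Hom-var x) (Hom-e k xs)) (Hom-e (suc k) xs)

  Hom-symmetrize : ∀ {d h} → Hom d h → Hom d (symmetrize h)
  Hom-symmetrize {d} hom = go (allFin n) λ σ → Hom-act _ hom
    where
    open Sum⁺ using (symSum)
    Hom-sumL : ∀ {a} {Y : Set a} {g : Y → Carrier} ys → (∀ y → Hom d (g y)) → Hom d (sumL g ys)
    Hom-sumL []       h = Hom-0 d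
    Hom-sumL (y ∷ ys) h = Hom-+ (h y) (Hom-sumL ys h)
    go : ∀ xs {F} → (∀ σ → Hom d (F σ)) → Hom d (symSum xs F)
    go []       h = h _
    go (x ∷ xs) h = Hom-+ (go xs h) (Hom-resp (≈-sym (*-identityˡ _)) (Hom-sumL xs λ y → go xs λ π → h _))

  Generator : Set
  Generator = Fin (n C 2) ⊎ Fin (length terms)

  -- Terms with a short left part yield 0 instead of being filtered out, which keeps the generators
  -- indexed by positions in `terms`.
  termGenerator : Term → Carrier
  termGenerator (b , _ , c) with μ n ℕₚ.≤? length b
  ... | yes _ = symmetrize (mon c)
  ... | no _  = 0#

  generator : Generator → Carrier
  generator (inj₁ k) = θ k
  generator (inj₂ i) = termGenerator (lookup terms i)

  generator-invariant : ∀ g → GInvariant (generator g)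
  generator-invariant (inj₁ k) = symmetric-GInvariant (gen (suc (toℕ k) , ≈-refl))
  generator-invariant (inj₂ i) with lookup terms i
  ... | b , _ , c with μ n ℕₚ.≤? length b
  ...   | yes _ = symmetrize-invariant (mon c)
  ...   | no _  = λ σ → act-0 _

  -- The lengths of `b` and `c` add up to the degree of the Vandermonde product, so a left part of
  -- length at least μ n leaves at most `top` for `c`.
  generator-degree : ∀ g → ∃ λ d → d ℕ.≤ top × Hom d (generator g)
  generator-degree (inj₁ k) = suc (toℕ k) , ℕₚ.≤-trans (Finₚ.toℕ<n k) (m≤D∸μ 4≤n) , Hom-e _ (allPairs n)
  generator-degree (inj₂ i) with lookup terms i | All.lookup (kernel-length (Pairs.before (allPairs n))) (∈-lookup {xs = terms} i)
  ... | b , _ , c | ∣b∣+∣c∣ with μ n ℕₚ.≤? length b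
  ...   | yes μ≤b = length c , ℕₚ.≤-trans (ℕₚ.≤-reflexive (≡.trans (≡.sym (ℕₚ.m+n∸m≡n (length b) (length c))) (cong (_∸ length b) (≡.trans ∣b∣+∣c∣ degree≡))))
                      (ℕₚ.∸-monoʳ-≤ _ μ≤b) , Hom-symmetrize (Hom-mon c)
  ...   | no _    = 0 , z≤n , Hom-0 0

  -- This is `invariant-expansion` divided by n!; the terms with a short left part have coefficient
  -- 0 by `trace-below-μ`.
  generates : ∀ {f} → GInvariant f → Generated (λ p → ∃ λ g → p ≈ generator g) f
  generates {f} f-inv = resp (proj₂ divide) (con (proj₁ divide) ⊗ resp (≈-sym (invariant-expansion f-inv)) (sum-generated terms (λ T∈ → T∈)))
    where
    term : Term → Carrier
    term (b , r , c) = trace (mon b * f) * (κ r * symmetrize (mon c))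

    divide : ∃ λ r → κ r * ((n !) ×′ f) ≈ f
    divide with n ! | ℕ.>-nonZero⁻¹ (n !) {{n !≢0}}
    ... | suc l | _ with inverse l
    ...   | r , eq = r , (begin
      κ r * suc l ×′ f               ≈⟨ *-congˡ (≈-trans (×′-congʳ (suc l) (≈-sym (*-identityˡ f))) (≈-sym (×-assoc-* (suc l) 1# f))) ⟩
      κ r * (suc l ×′ 1# * f)        ≈⟨ *-assoc _ _ _ ⟨
      κ r * suc l ×′ 1# * f          ≈⟨ *-congʳ (≈-trans (*-congˡ (≈-sym (κ-× (suc l)))) (≈-trans (≈-sym (κ-* r _)) (≈-trans (κ-cong eq) κ-1))) ⟩
      1# * f                         ≈⟨ *-identityˡ f ⟩
      f                              ∎)

    term-generated : ∀ {T} → T ∈ terms → Generated (λ p → ∃ λ g → p ≈ generator g) (term T)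
    term-generated {b , r , c} T∈ with length b ℕₚ.<? μ n
    ... | yes b<μ = resp (≈-sym (≈-trans (*-congʳ (trace-below-μ b f-inv b<μ)) (zeroˡ _))) generated-0
    ... | no b≮μ  = generated-map (λ (k , p≈) → gen (inj₁ k , p≈)) (symmetric⇒θ (trace-symmetric (mon b * f))) ⊗
                    (con r ⊗ gen (inj₂ (index T∈) , ≈-trans (≈-sym symmetrize≈) (reflexive (cong termGenerator (lookup-index T∈)))))
      where
      symmetrize≈ : termGenerator (b , r , c) ≈ symmetrize (mon c)
      symmetrize≈ with μ n ℕₚ.≤? length b
      ... | yes _  = ≈-refl
      ... | no ¬μ≤ = contradiction (ℕₚ.≮⇒≥ b≮μ) ¬μ≤

    sum-generated : ∀ ts → (∀ {T} → T ∈ ts → T ∈ terms) → Generated (λ p → ∃ λ g → p ≈ generator g) (sumL term ts)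
    sum-generated []       _    = generated-0
    sum-generated (T ∷ ts) ts⊆ = term-generated (ts⊆ (here refl)) ⊕ sum-generated ts (ts⊆ ∘ there)

  module _ (θ′ : Fin (n C 2) → Carrier) (θ′≈θ : ∀ k → θ′ k ≈ θ k) where

    open Evaluation V
    open import Data.Vec.Functional using () renaming (foldr to foldrV)

    record SecondaryValues {t : ℕ} (η : Fin t → Carrier) (d : Fin t → ℕ) : Set (c ⊔ ℓ) where
      field
        invariant   : ∀ j → GInvariant (η j)
        homogeneous : ∀ j → Hom (d j) (η j)
        spanning    : ∀ f → GInvariant f → ∃ λ (P : Fin t → Poly (Fin (n C 2))) →
                      f ≈ foldrV _+_ 0# (λ j → η j * value θ′ (P j))
        independent : ∀ (P : Fin t → Poly (Fin (n C 2))) →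
                      foldrV _+_ 0# (λ j → η j * value θ′ (P j)) ≈ 0# → ∀ j → value θ′ (P j) ≈ 0#

    value-symmetric : ∀ P → Symmetric (value θ′ P)
    value-symmetric P = θ⇒symmetric (generated-map (λ (k , p≈) → gen (k , ≈-trans p≈ (θ′≈θ k))) (value-generated θ′ generated-0 P))

    symmetric-value : ∀ {p} → Symmetric p → ∃ λ P → p ≈ value θ′ P
    symmetric-value p-sym = generated⇒value θ′ (generated-map (λ (k , p≈) → gen (k , ≈-trans p≈ (≈-sym (θ′≈θ k)))) (symmetric⇒θ p-sym))

    foldr≡sumL : ∀ {A : Set} {t} (g : A → Carrier) (h : Fin t → A) → foldrV _+_ 0# (g ∘ h) ≡ sumL g (tabulate h)
    foldr≡sumL {t = zero}  g h = refl
    foldr≡sumL {t = suc t} g h = cong (g (h zero) +_) (foldr≡sumL g (h ∘ suc))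

    secondary : ∀ {t} {η : Fin t → Carrier} {d : Fin t → ℕ} → SecondaryValues η d → Secondary η d
    secondary {t} {η} values = record
      { invariant   = invariant
      ; homogeneous = homogeneous
      ; spanning    = λ {f} f-inv → let (P , f≈) = spanning f f-inv in
          (λ j → value θ′ (P j)) , (λ j → value-symmetric (P j)) , ≈-trans f≈ (reflexive (foldr≡sumL (λ j → η j * value θ′ (P j)) id))
      ; independent = λ p p-sym sum≈0 j →
          let P = λ i → proj₁ (symmetric-value (p-sym i))
              p≈ = λ i → proj₂ (symmetric-value (p-sym i))
          in ≈-trans (p≈ j) (independent P (≈-trans (reflexive (foldr≡sumL (λ i → η i * value θ′ (P i)) id))
               (≈-trans (sumL-cong (allFin t) λ i → *-congˡ (≈-sym (p≈ i))) sum≈0)) j)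
      }
      where open SecondaryValues values

    secondary-degrees : ∀ {t} {η : Fin t → Carrier} {d : Fin t → ℕ} → SecondaryValues η d →
                        (∀ i j → i Fin.≤ j → d i ℕ.≤ d j) →
                        (t ℕ.* n ! ≡ (n C 2) !) × (∃ λ (last : Fin t) → (suc (toℕ last) ≡ t) × (d last ≡ top))
    secondary-degrees values monotone = Secondary.count (secondary values) , Secondary.last-degree (secondary values) monotone

    abstract
      generated-in-degree : ∀ f → GInvariant f → ∃₂ λ k (g : Fin k → Carrier) →
                            (∀ i → GInvariant (g i) × ∃ λ d → d ℕ.≤ top × Hom d (g i)) × ∃ λ P → f ≈ value g P
      generated-in-degree f f-inv = n C 2 ℕ.+ length terms , g , (λ i → generator-invariant (split i) , generator-degree (split i)) ,
        generated⇒value g (generated-map rejoin (generates f-inv))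
        where
        split : Fin (n C 2 ℕ.+ length terms) → Generator
        split = Fin.splitAt (n C 2)
        g : Fin (n C 2 ℕ.+ length terms) → Carrier
        g = generator ∘ split
        rejoin : ∀ {q} → (∃ λ s → q ≈ generator s) → Generated (λ q → ∃ λ i → q ≈ g i) q
        rejoin (s , q≈) = gen (Fin.join (n C 2) (length terms) s ,
          ≈-trans q≈ (reflexive (cong generator (≡.sym (Finₚ.splitAt-join (n C 2) (length terms) s)))))

-- Specialization to a field of characteristic zero

module CharacteristicZeroField {c ℓ₁ ℓ₂} (K : HeytingField c ℓ₁ ℓ₂) (char0 : CharacteristicZero K) where

  private
    module K = HeytingField K
    R : CommutativeRing c ℓ₁
    R = ringOf K
    module R = CommutativeRing R
  open SemiringMult R.semiring using () renaming (_×_ to _×′_)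

  natural-inverse : ∀ k → ∃ λ r → r R.* (suc k ×′ R.1#) R.≈ R.1#
  natural-inverse k with K.#⇒invertible (char0 k)
  ... | r , r*[k-0]≈1 , _ = r , R.trans (R.*-congˡ (R.sym (R.trans (R.+-congˡ -0#≈0#) (R.+-identityʳ _)))) r*[k-0]≈1
    where open RingProps R.ring using (-0#≈0#)

  natural-nonzero : ∀ k → ¬ (suc k ×′ R.1# R.≈ R.0#)
  natural-nonzero k k≈0 = K.#-irrefl k≈0 (char0 k)

module Proposition {c ℓ₁ ℓ₂} (K : HeytingField c ℓ₁ ℓ₂) (char0 : CharacteristicZero K) (n : ℕ) (4≤n : 4 ≤ n) where

  private
    R : CommutativeRing c ℓ₁
    R = ringOf K
    module R = CommutativeRing R
  open Invariants R n
  open PolynomialRing R (_≟ᴾ_ {n}) using (polynomialRing)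
  open PolynomialVariables R (_≟ᴾ_ {n})
  private module S = CommutativeRing polynomialRing
  open Evaluation polynomialVariables
  open ElementarySymmetric R {Pair n}
  open CharacteristicZeroField K char0
  module G = Generation R n 4≤n natural-inverse natural-nonzero polynomialRing polynomialVariables

  private
    Element : Set c
    Element = Poly (Pair n)

  prepend : ∀ (x : Pair n) αs → map (R.1# ,_) (map (x ∷_) αs) ≈ₚ (variable-of x *ₚ map (R.1# ,_) αs)
  prepend x []       α = R.refl
  prepend x (β ∷ αs) α = R.+-cong (same _) (prepend x αs α)
    where
    same : ∀ b → (if b then R.1# else R.0#) R.≈ (if b then R.1# R.* R.1# else R.0#)
    same true  = R.sym (R.*-identityˡ _)
    same false = R.refl

  sublists≈e : ∀ k xs → map (R.1# ,_) (sublists k xs) ≈ₚ G.e k xs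
  sublists≈e zero    xs       = λ α → R.refl
  sublists≈e (suc k) []       = λ α → R.refl
  sublists≈e (suc k) (x ∷ xs) = S.trans {i = map (R.1# ,_) (sublists (suc k) (x ∷ xs))}
    {map (R.1# ,_) (map (x ∷_) (sublists k xs)) +ₚ map (R.1# ,_) (sublists (suc k) xs)} {G.e (suc k) (x ∷ xs)}
    (S.reflexive (map-++ _ (map (x ∷_) (sublists k xs)) _))
    (S.+-cong {map (R.1# ,_) (map (x ∷_) (sublists k xs))} {variable-of x *ₚ G.e k xs} {map (R.1# ,_) (sublists (suc k) xs)} {G.e (suc k) xs}
      (S.trans {map (R.1# ,_) (map (x ∷_) (sublists k xs))} {variable-of x *ₚ map (R.1# ,_) (sublists k xs)} {variable-of x *ₚ G.e k xs}
        (prepend x (sublists k xs)) (S.*-congˡ {variable-of x} {map (R.1# ,_) (sublists k xs)} {G.e k xs} (sublists≈e k xs)))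
      (sublists≈e (suc k) xs))

  elementary≈θ : ∀ k → elementary k ≈ₚ G.θ k
  elementary≈θ k = S.trans {elementary k} {map (R.1# ,_) (sublists (suc (toℕ k)) (allPairs n))} {G.θ k}
    (S.reflexive (elementarySymmetric≡ (suc (toℕ k)) (allPairs n))) (sublists≈e (suc (toℕ k)) (allPairs n))

  eval≡value : ∀ {Y : Set} (ρ : Y → Element) P → eval ρ P ≡ value ρ P
  eval≡value ρ []            = refl
  eval≡value ρ ((r , β) ∷ P) = cong (const r *ₚ monomialValue ρ β +ₚ_) (eval≡value ρ P)

  values : ∀ {t} {η : Fin t → Element} {d : Fin t → ℕ} → IsSecondary elementary η d → G.SecondaryValues elementary elementary≈θ η d
  values {t} {η} isSec = record
    { invariant   = invariant
    ; homogeneous = homogeneous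
    ; spanning    = λ f f-inv → let (P , f≈) = spanning f f-inv in
        P , subst (f ≈ₚ_) (sums P) f≈
    ; independent = λ P sum≈0 j → subst (_≈ₚ 0ₚ) (eval≡value elementary (P j))
        (independent P (subst (_≈ₚ 0ₚ) (≡.sym (sums P)) sum≈0) j)
    }
    where
    open IsSecondary isSec
    foldr-cong : ∀ {t} {f g : Fin t → Element} → (∀ i → f i ≡ g i) → Vector.foldr _+ₚ_ 0ₚ f ≡ Vector.foldr _+ₚ_ 0ₚ g
    foldr-cong {zero}  f≡g = refl
    foldr-cong {suc t} f≡g = cong₂ _+ₚ_ (f≡g zero) (foldr-cong (f≡g ∘ suc))
    sums : ∀ (P : Fin t → Poly (Fin (n C 2))) →
           sumₚ (λ j → η j *ₚ eval elementary (P j)) ≡ Vector.foldr _+ₚ_ 0ₚ (λ j → η j *ₚ value elementary (P j))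
    sums P = foldr-cong λ j → cong (η j *ₚ_) (eval≡value elementary (P j))

  generatedInDegree : GeneratedInDegree≤ ((n C 2) C 2 ∸ μ n)
  generatedInDegree f f-inv = convert (G.generated-in-degree elementary elementary≈θ f f-inv)
    where
    degreeAtMost : ∀ p → (∃ λ d → d ≤ (n C 2) C 2 ∸ μ n × Homogeneous d p) → DegreeAtMost ((n C 2) C 2 ∸ μ n) p
    degreeAtMost p (d , d≤top , hom) α top<∣α∣ =
      hom α λ ∣α∣≡d → ℕₚ.<⇒≱ top<∣α∣ (subst (_≤ (n C 2) C 2 ∸ μ n) (≡.sym ∣α∣≡d) d≤top)

    convert : (∃₂ λ k (g : Fin k → Element) →
                 (∀ i → IsInvariant (g i) × ∃ λ d → d ≤ (n C 2) C 2 ∸ μ n × Homogeneous d (g i)) × ∃ λ P → f ≈ₚ value g P) →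
              ∃ λ k → Σ (Fin k → Element) λ g →
                (∀ i → IsInvariant (g i) × DegreeAtMost ((n C 2) C 2 ∸ μ n) (g i)) × ∃ λ P → f ≈ₚ eval g P
    convert (k , g , bounded , P , f≈) = k , g ,
      (λ i → proj₁ (bounded i) , degreeAtMost (g i) (proj₂ (bounded i))) , P , subst (f ≈ₚ_) (≡.sym (eval≡value g P)) f≈

open import Data.Nat.Base using (_*_)

proposition3p1 : ∀ {c ℓ₁ ℓ₂} (K : HeytingField c ℓ₁ ℓ₂) → CharacteristicZero K →
  (n : ℕ) → 4 ≤ n →
  let m = n C 2
      open Invariants (ringOf K) n
  in
  (∀ (t : ℕ) (η : Fin t → Poly (Pair n)) (e : Fin t → ℕ) →
    IsSecondary elementary η e →
    (∀ i j → i Fin.≤ j → e i ≤ e j) →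
    (t * n ! ≡ m !) ×
    (∃ λ (last : Fin t) → (suc (toℕ last) ≡ t) × (e last ≡ (m C 2) ∸ μ n))) ×
  GeneratedInDegree≤ ((m C 2) ∸ μ n) ×
  (∀ β → Isβ β → β ≤ (m C 2) ∸ μ n)
proposition3p1 K char0 n 4≤n =
  (λ t η e isSec → G.secondary-degrees elementary elementary≈θ (values isSec)) ,
  generatedInDegree ,
  λ β isβ → proj₂ isβ _ generatedInDegree
  where
  open Invariants (ringOf K) n using (elementary)
  open Proposition K char0 n 4≤n
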